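{- Let $n\ge 2$ be an integer, let $\varepsilon$ be a positive real number and let ${\bf a}=(a_1,\ldots ,a_n)$ be an $n$-tuple of non-zero rational numbers. There exists a positive number $s_1$, which is effectively computable in terms of $\varepsilon$ and ${\bf a}$, with the property that for every integer $s\geq s_1$ there is a set of primes $S$ of cardinality $s$ such that $$g({\bf a},S)\geq \exp\big\{(4-\varepsilon )s^{1/2}(\log s)^{ -1/2}\big\}.$$
   Context: For a set $S$ of (rational) prime numbers, an $S$-unit is a non-zero rational number (of either sign) such that both the denominator and the numerator of its simplified representation are composed of primes from $S$. The total degree of a polynomial $P$ is the maximum of the sums $k_1+\cdots +k_n$ taken over all monomials $X_1^{k_1}\cdots X_n^{k_n}$ occurring in $P$. For a set of primes $S$ and a tuple ${\bf a}=(a_1,\ldots ,a_n)$ of non-zero rational numbers, $g({\bf a},S)$ denotes the smallest integer $g$ with the following property: there exists a polynomial $P\in\mathbb{C}[X_1,\ldots ,X_n]$ of total degree $g$, not divisible by $a_1X_1+\cdots +a_nX_n-1$, such that $P(x_1,\ldots ,x_n)=0$ for every tuple $(x_1,\ldots ,x_n)$ of $S$-units with $a_1x_1+\cdots +a_nx_n=1$. -}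

module Defs where

import Algebra.Definitions.RawSemiring
open import Data.Integer.Base as ℤ using (ℤ; +_)
import Data.Integer.Properties as ℤₚ
open import Data.List.Base as List using (List; []; _∷_)
open import Data.List.Membership.Propositional using (_∈_)
import Data.List.Relation.Unary.All as ListAll
open import Data.List.Relation.Unary.Unique.Propositional using (Unique)
open import Data.Nat.Base as ℕ using (ℕ; zero; suc; z≤n; s≤s; _!; NonTrivial)
open import Data.Nat.Divisibility using (_∣_)
open import Data.Nat.Primality using (Prime)
import Data.Nat.Properties as ℕₚ
open import Data.Product.Base using (∃; ∃-syntax; _×_; _,_; proj₁; proj₂)
open import Data.Rational.Base as ℚ
open import Data.Rational.Properties
import Data.Rational.Unnormalised.Base as ℚᵘ
import Data.Rational.Unnormalised.Properties as ℚᵘₚ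
open import Data.Sum.Base using (_⊎_; inj₁; inj₂)
open import Data.Vec.Base as Vec using (Vec)
import Data.Vec.Properties as Vecₚ
import Data.Vec.Relation.Unary.All as VecAll
open import Level using (0ℓ)
open import Relation.Binary.PropositionalEquality
open import Relation.Nullary using (¬_; yes; no; contradiction)
open import Relation.Nullary.Decidable using (dec⇒maybe)
open import Tactic.RingSolver using (solve-∀)
open import Tactic.RingSolver.Core.AlmostCommutativeRing
  using (AlmostCommutativeRing; fromCommutativeRing)

open Algebra.Definitions.RawSemiring ℚ.+-*-rawSemiring using (_^_)

fromℕ : ℕ → ℚ
fromℕ n = + n / 1

-- Total by inv 0 = 0, so that the reciprocal of a positive real can be taken
-- termwise even if finitely many approximations vanish.
inv : ℚ → ℚ
inv q with q ≟ 0ℚ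
... | yes _   = 0ℚ
... | no  q≢0 = (1/ q) {{≢-nonZero q≢0}}

psum : (ℕ → ℚ) → ℕ → ℚ
psum u zero    = 0ℚ
psum u (suc n) = psum u n + u n

private
  ring : AlmostCommutativeRing 0ℓ 0ℓ
  ring = fromCommutativeRing +-*-commutativeRing (λ x → dec⇒maybe (0ℚ ≟ x))

  0≤1 : 0ℚ ≤ 1ℚ
  0≤1 = nonNegative⁻¹ 1ℚ

  0<1 : 0ℚ < 1ℚ
  0<1 = positive⁻¹ 1ℚ

  *-mono : ∀ {r p q} → 0ℚ ≤ r → p ≤ q → r * p ≤ r * q
  *-mono {r} 0≤r = *-monoˡ-≤-nonNeg r {{nonNegative 0≤r}}

  *-mono′ : ∀ {r p q} → 0ℚ ≤ r → p ≤ q → p * r ≤ q * r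
  *-mono′ {r} 0≤r = *-monoʳ-≤-nonNeg r {{nonNegative 0≤r}}

  *-cancel : ∀ {r p q} → 0ℚ < r → r * p ≤ r * q → p ≤ q
  *-cancel {r} 0<r = *-cancelˡ-≤-pos r {{positive 0<r}}

  0≤* : ∀ {p q} → 0ℚ ≤ p → 0ℚ ≤ q → 0ℚ ≤ p * q
  0≤* {p} {q} 0≤p 0≤q = subst (_≤ p * q) (*-zeroʳ p) (*-mono 0≤p 0≤q)

  0<* : ∀ {p q} → 0ℚ < p → 0ℚ < q → 0ℚ < p * q
  0<* {p} {q} 0<p 0<q =
    positive⁻¹ (p * q) {{pos*pos⇒pos p {{positive 0<p}} q {{positive 0<q}}}}

  0≤+ : ∀ {p q} → 0ℚ ≤ p → 0ℚ ≤ q → 0ℚ ≤ p + q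
  0≤+ = +-mono-≤

  0<+ : ∀ {p q} → 0ℚ < p → 0ℚ ≤ q → 0ℚ < p + q
  0<+ = +-mono-<-≤

  p≤p+q : ∀ {p q} → 0ℚ ≤ q → p ≤ p + q
  p≤p+q {p} {q} 0≤q = subst (_≤ p + q) (+-identityʳ p) (+-monoʳ-≤ p 0≤q)

  q≤p+q : ∀ {p q} → 0ℚ ≤ p → q ≤ p + q
  q≤p+q {p} {q} 0≤p = subst (_≤ p + q) (+-identityˡ q) (+-monoˡ-≤ q 0≤p)

  0≤-⇒≤ : ∀ {p q} → 0ℚ ≤ q - p → p ≤ q
  0≤-⇒≤ {p} {q} h = subst (p ≤_) (eq p q) (p≤p+q h)
    where
    eq : ∀ p q → p + (q - p) ≡ q
    eq = solve-∀ ring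

  ≤⇒0≤- : ∀ {p q} → p ≤ q → 0ℚ ≤ q - p
  ≤⇒0≤- {p} {q} h = subst (_≤ q - p) (+-inverseʳ p) (+-monoˡ-≤ (- p) h)

  p≤∣p∣ : ∀ p → p ≤ ∣ p ∣
  p≤∣p∣ p with ≤-total 0ℚ p
  ... | inj₁ 0≤p = ≤-reflexive (sym (0≤p⇒∣p∣≡p 0≤p))
  ... | inj₂ p≤0 = ≤-trans p≤0 (0≤∣p∣ p)

  ≤∧-≤⇒∣∣≤ : ∀ {p q} → p ≤ q → - p ≤ q → ∣ p ∣ ≤ q
  ≤∧-≤⇒∣∣≤ {p} {q} p≤q -p≤q with ∣p∣≡p∨∣p∣≡-p p
  ... | inj₁ e = subst (_≤ q) (sym e) p≤q
  ... | inj₂ e = subst (_≤ q) (sym e) -p≤q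

  ∣-∣-sym : ∀ p q → ∣ p - q ∣ ≡ ∣ q - p ∣
  ∣-∣-sym p q = trans (sym (∣-p∣≡∣p∣ (p - q))) (cong ∣_∣ (eq p q))
    where
    eq : ∀ p q → - (p - q) ≡ q - p
    eq = solve-∀ ring

  ∣-∣-triangle : ∀ p q r → ∣ p - r ∣ ≤ ∣ p - q ∣ + ∣ q - r ∣
  ∣-∣-triangle p q r =
    subst (λ t → ∣ t ∣ ≤ ∣ p - q ∣ + ∣ q - r ∣) (eq p q r)
      (∣p+q∣≤∣p∣+∣q∣ (p - q) (q - r))
    where
    eq : ∀ p q r → (p - q) + (q - r) ≡ p - r
    eq = solve-∀ ring

  ∣*-*∣ : ∀ a b c d → ∣ a * b - c * d ∣ ≤ ∣ a ∣ * ∣ b - d ∣ + ∣ d ∣ * ∣ a - c ∣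
  ∣*-*∣ a b c d = begin
    ∣ a * b - c * d ∣                       ≡⟨ cong ∣_∣ (eq a b c d) ⟩
    ∣ a * (b - d) + d * (a - c) ∣           ≤⟨ ∣p+q∣≤∣p∣+∣q∣ (a * (b - d)) (d * (a - c)) ⟩
    ∣ a * (b - d) ∣ + ∣ d * (a - c) ∣       ≡⟨ cong₂ _+_ (∣p*q∣≡∣p∣*∣q∣ a (b - d)) (∣p*q∣≡∣p∣*∣q∣ d (a - c)) ⟩
    ∣ a ∣ * ∣ b - d ∣ + ∣ d ∣ * ∣ a - c ∣   ∎
    where
    open ≤-Reasoning
    eq : ∀ a b c d → a * b - c * d ≡ a * (b - d) + d * (a - c)
    eq = solve-∀ ring

  inv-inverse : ∀ {q} → q ≢ 0ℚ → q * inv q ≡ 1ℚ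
  inv-inverse {q} q≢0 with q ≟ 0ℚ
  ... | yes q≡0 = contradiction q≡0 q≢0
  ... | no  h   = *-inverseʳ q {{≢-nonZero h}}

  pos⇒≢0 : ∀ {q} → 0ℚ < q → q ≢ 0ℚ
  pos⇒≢0 0<q q≡0 = <-irrefl (sym q≡0) 0<q

  inv-pos : ∀ {q} → 0ℚ < q → 0ℚ < inv q
  inv-pos {q} 0<q with q ≟ 0ℚ
  ... | yes q≡0 = contradiction q≡0 (pos⇒≢0 0<q)
  ... | no  h   = positive⁻¹ _ {{1/pos⇒pos q {{positive 0<q}}}}

  *inv : ∀ {q} → 0ℚ < q → q * inv q ≡ 1ℚ
  *inv 0<q = inv-inverse (pos⇒≢0 0<q)

  cancel-inv : ∀ {q} p → 0ℚ < q → q * (p * inv q) ≡ p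
  cancel-inv {q} p 0<q = trans (eq q p (inv q)) (trans (cong (p *_) (*inv 0<q)) (*-identityʳ p))
    where
    eq : ∀ q p i → q * (p * i) ≡ p * (q * i)
    eq = solve-∀ ring

  inv-antitone : ∀ {p q} → 0ℚ < p → p ≤ q → inv q ≤ inv p
  inv-antitone {p} {q} 0<p p≤q = *-cancel 0<p (*-cancel 0<q (begin
    q * (p * inv q)  ≡⟨ cancel-inv p 0<q ⟩
    p                ≤⟨ p≤q ⟩
    q                ≡⟨ *-identityʳ q ⟨
    q * 1ℚ           ≡⟨ cong (q *_) (*inv 0<p) ⟨
    q * (p * inv p)  ∎))
    where
    open ≤-Reasoning
    0<q = <-≤-trans 0<p p≤q

  fromℕ-suc : ∀ k → fromℕ (suc k) ≡ 1ℚ + fromℕ k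
  fromℕ-suc k = toℚᵘ-injective (begin
    toℚᵘ (fromℕ (suc k))                ≈⟨ toℚᵘ-fromℚᵘ (ℚᵘ.mkℚᵘ (+ suc k) 0) ⟩
    ℚᵘ.mkℚᵘ (+ suc k) 0                 ≈⟨ ℚᵘ.*≡* (eq k) ⟩
    ℚᵘ.mkℚᵘ (+ 1) 0 ℚᵘ.+ ℚᵘ.mkℚᵘ (+ k) 0 ≈⟨ ℚᵘₚ.+-cong (ℚᵘₚ.≃-refl {ℚᵘ.mkℚᵘ (+ 1) 0}) (toℚᵘ-fromℚᵘ (ℚᵘ.mkℚᵘ (+ k) 0)) ⟨
    toℚᵘ 1ℚ ℚᵘ.+ toℚᵘ (fromℕ k)         ≈⟨ toℚᵘ-homo-+ 1ℚ (fromℕ k) ⟨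
    toℚᵘ (1ℚ + fromℕ k)                 ∎)
    where
    open ℚᵘₚ.≃-Reasoning
    eq : ∀ k → (+ suc k) ℤ.* + 1 ≡ (+ 1 ℤ.+ + k ℤ.* + 1) ℤ.* + 1
    eq k = cong (ℤ._* + 1) (cong (λ t → + 1 ℤ.+ t) (sym (ℤₚ.*-identityʳ (+ k))))

  fromℕ-nonNeg : ∀ n → 0ℚ ≤ fromℕ n
  fromℕ-nonNeg n = nonNegative⁻¹ (fromℕ n) {{normalize-nonNeg n 1}}

  fromℕ-pos : ∀ n → 0ℚ < fromℕ (suc n)
  fromℕ-pos n = positive⁻¹ (fromℕ (suc n)) {{normalize-pos (suc n) 1}}

  fromℕ-mono : ∀ {m n} → m ℕ.≤ n → fromℕ m ≤ fromℕ n
  fromℕ-mono {n = n} z≤n = fromℕ-nonNeg n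
  fromℕ-mono (s≤s {m} {n} m≤n) =
    subst₂ _≤_ (sym (fromℕ-suc m)) (sym (fromℕ-suc n)) (+-monoʳ-≤ 1ℚ (fromℕ-mono m≤n))

  archimedean : ∀ q → ∃[ N ] q ≤ fromℕ N
  archimedean q = N , toℚᵘ-cancel-≤ (ℚᵘₚ.≤-respʳ-≃ (ℚᵘₚ.≃-sym (toℚᵘ-fromℚᵘ (ℚᵘ.mkℚᵘ (+ N) 0))) (le q))
    where
    N = ℤ.∣ ↥ q ∣
    ≤abs : ∀ i → i ℤ.≤ + ℤ.∣ i ∣
    ≤abs (+ n)        = ℤₚ.≤-refl
    ≤abs (ℤ.-[1+ n ]) = ℤ.-≤+
    le : ∀ q → toℚᵘ q ℚᵘ.≤ ℚᵘ.mkℚᵘ (+ ℤ.∣ ↥ q ∣) 0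
    le (mkℚ i d _) = ℚᵘ.*≤* (ℤₚ.≤-trans
      (ℤₚ.≤-reflexive (ℤₚ.*-identityʳ i))
      (ℤₚ.≤-trans (≤abs i) (subst (ℤ._≤ + ℤ.∣ i ∣ ℤ.* + suc d) (ℤₚ.*-identityʳ (+ ℤ.∣ i ∣))
        (ℤₚ.*-monoˡ-≤-nonNeg (+ ℤ.∣ i ∣) (ℤ.+≤+ (s≤s z≤n))))))

  unit : ℕ → ℚ
  unit k = + 1 / suc k

  fromℕ*unit : ∀ k → fromℕ (suc k) * unit k ≡ 1ℚ
  fromℕ*unit k = toℚᵘ-injective (begin
    toℚᵘ (fromℕ (suc k) * unit k)               ≈⟨ toℚᵘ-homo-* (fromℕ (suc k)) (unit k) ⟩
    toℚᵘ (fromℕ (suc k)) ℚᵘ.* toℚᵘ (unit k)     ≈⟨ ℚᵘₚ.*-cong (toℚᵘ-fromℚᵘ (ℚᵘ.mkℚᵘ (+ suc k) 0)) (toℚᵘ-fromℚᵘ (ℚᵘ.mkℚᵘ (+ 1) k)) ⟩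
    ℚᵘ.mkℚᵘ (+ suc k) 0 ℚᵘ.* ℚᵘ.mkℚᵘ (+ 1) k    ≈⟨ ℚᵘ.*≡* (eq k) ⟩
    toℚᵘ 1ℚ                                     ∎)
    where
    open ℚᵘₚ.≃-Reasoning
    eq : ∀ k → (+ suc k ℤ.* + 1) ℤ.* + 1 ≡ + 1 ℤ.* (+ (1 ℕ.* suc k))
    eq k = trans (ℤₚ.*-identityʳ (+ suc k ℤ.* + 1)) (trans (ℤₚ.*-identityʳ (+ suc k))
      (trans (cong +_ (sym (ℕₚ.*-identityˡ (suc k)))) (sym (ℤₚ.*-identityˡ (+ (1 ℕ.* suc k))))))

  unit-pos : ∀ k → 0ℚ < unit k
  unit-pos k = positive⁻¹ (unit k) {{normalize-pos 1 (suc k)}}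

  unit≤1 : ∀ k → unit k ≤ 1ℚ
  unit≤1 k = subst₂ _≤_ (*-identityˡ (unit k)) (fromℕ*unit k)
    (*-mono′ (<⇒≤ (unit-pos k)) (fromℕ-mono {1} {suc k} (s≤s z≤n)))

-- The Σ-type makes the modulus of convergence part of the data.
Cauchy : (ℕ → ℚ) → Set
Cauchy f = ∀ δ → 0ℚ < δ → ∃[ N ] (∀ m n → N ℕ.≤ m → N ℕ.≤ n → ∣ f m - f n ∣ ≤ δ)

record ℝ : Set where
  constructor mkℝ
  field
    seq    : ℕ → ℚ
    cauchy : Cauchy seq

open ℝ public

infix 4 _≃ᴿ_ _≤ᴿ_ _<ᴿ_

_≃ᴿ_ : ℝ → ℝ → Set
x ≃ᴿ y = ∀ δ → 0ℚ < δ → ∃[ N ] (∀ n → N ℕ.≤ n → ∣ seq x n - seq y n ∣ ≤ δ)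

_≤ᴿ_ : ℝ → ℝ → Set
x ≤ᴿ y = ∀ δ → 0ℚ < δ → ∃[ N ] (∀ n → N ℕ.≤ n → seq x n ≤ seq y n + δ)

_<ᴿ_ : ℝ → ℝ → Set
x <ᴿ y = ∃[ δ ] (0ℚ < δ × ∃[ N ] (∀ n → N ℕ.≤ n → seq x n + δ ≤ seq y n))

private
  cauchy-scaled : ∀ (f : ℕ → ℚ) K → 0ℚ < K →
    (∀ δ → 0ℚ < δ → ∃[ N ] (∀ m n → N ℕ.≤ m → N ℕ.≤ n → ∣ f m - f n ∣ ≤ K * δ)) →
    Cauchy f
  cauchy-scaled f K 0<K h δ 0<δ with h (δ * inv K) (0<* 0<δ (inv-pos 0<K))
  ... | N , bd = N , λ m n N≤m N≤n →
    subst (∣ f m - f n ∣ ≤_) (cancel-inv δ 0<K) (bd m n N≤m N≤n)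

  symmetrise : ∀ (f : ℕ → ℚ) η →
    ∃[ N ] (∀ m n → N ℕ.≤ m → m ℕ.≤ n → ∣ f m - f n ∣ ≤ η) →
    ∃[ N ] (∀ m n → N ℕ.≤ m → N ℕ.≤ n → ∣ f m - f n ∣ ≤ η)
  symmetrise f η (N , bd) = N , go
    where
    go : ∀ m n → N ℕ.≤ m → N ℕ.≤ n → ∣ f m - f n ∣ ≤ η
    go m n N≤m N≤n with ℕₚ.≤-total m n
    ... | inj₁ m≤n = bd m n N≤m m≤n
    ... | inj₂ n≤m = subst (_≤ η) (∣-∣-sym (f n) (f m)) (bd n m N≤n n≤m)

  Bounded : (ℕ → ℚ) → Set
  Bounded f = ∃[ B ] (0ℚ < B × ∃[ N ] (∀ n → N ℕ.≤ n → ∣ f n ∣ ≤ B))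

  bounded : ∀ f → Cauchy f → Bounded f
  bounded f cf with cf 1ℚ 0<1
  ... | N , bd = 1ℚ + ∣ f N ∣ , 0<+ 0<1 (0≤∣p∣ (f N)) , N , λ n N≤n → begin
      ∣ f n ∣                    ≡⟨ cong ∣_∣ (eq (f n) (f N)) ⟩
      ∣ (f n - f N) + f N ∣      ≤⟨ ∣p+q∣≤∣p∣+∣q∣ (f n - f N) (f N) ⟩
      ∣ f n - f N ∣ + ∣ f N ∣    ≤⟨ +-monoˡ-≤ ∣ f N ∣ (bd n N N≤n ℕₚ.≤-refl) ⟩
      1ℚ + ∣ f N ∣               ∎
    where
    open ≤-Reasoning
    eq : ∀ p q → p ≡ (p - q) + q
    eq = solve-∀ ring

  ⊔ˡ : ∀ {a b n} → a ℕ.⊔ b ℕ.≤ n → a ℕ.≤ n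
  ⊔ˡ {a} {b} = ℕₚ.≤-trans (ℕₚ.m≤m⊔n a b)

  ⊔ʳ : ∀ {a b n} → a ℕ.⊔ b ℕ.≤ n → b ℕ.≤ n
  ⊔ʳ {a} {b} = ℕₚ.≤-trans (ℕₚ.m≤n⊔m a b)

  const-cauchy : ∀ q → Cauchy (λ _ → q)
  const-cauchy q δ 0<δ = 0 , λ _ _ _ _ →
    subst (λ t → ∣ t ∣ ≤ δ) (sym (+-inverseʳ q)) (<⇒≤ 0<δ)

  +-cauchy : ∀ f g → Cauchy f → Cauchy g → Cauchy (λ n → f n + g n)
  +-cauchy f g cf cg = cauchy-scaled (λ n → f n + g n) (1ℚ + 1ℚ) (0<+ 0<1 0≤1) λ δ 0<δ →
    let N₁ , b₁ = cf δ 0<δ ; N₂ , b₂ = cg δ 0<δ in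
    N₁ ℕ.⊔ N₂ , λ m n p q → begin
      ∣ (f m + g m) - (f n + g n) ∣        ≡⟨ cong ∣_∣ (eq (f m) (g m) (f n) (g n)) ⟩
      ∣ (f m - f n) + (g m - g n) ∣        ≤⟨ ∣p+q∣≤∣p∣+∣q∣ (f m - f n) (g m - g n) ⟩
      ∣ f m - f n ∣ + ∣ g m - g n ∣        ≤⟨ +-mono-≤ (b₁ m n (⊔ˡ p) (⊔ˡ q)) (b₂ m n (⊔ʳ {N₁} p) (⊔ʳ {N₁} q)) ⟩
      δ + δ                                ≡⟨ eq₂ δ ⟩
      (1ℚ + 1ℚ) * δ                        ∎
    where
    open ≤-Reasoning
    eq : ∀ a b c d → (a + b) - (c + d) ≡ (a - c) + (b - d)
    eq = solve-∀ ring
    eq₂ : ∀ d → d + d ≡ (1ℚ + 1ℚ) * d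
    eq₂ = solve-∀ ring

  neg-cauchy : ∀ f → Cauchy f → Cauchy (λ n → - f n)
  neg-cauchy f cf δ 0<δ with cf δ 0<δ
  ... | N , bd = N , λ m n p q → subst (_≤ δ)
      (trans (sym (∣-p∣≡∣p∣ (f m - f n))) (cong ∣_∣ (eq (f m) (f n)))) (bd m n p q)
    where
    eq : ∀ a b → - (a - b) ≡ - a - - b
    eq = solve-∀ ring

  *-cauchy : ∀ f g → Cauchy f → Cauchy g → Cauchy (λ n → f n * g n)
  *-cauchy f g cf cg =
    let A , 0<A , Nᶠ , bᶠ = bounded f cf ; B , 0<B , Nᵍ , bᵍ = bounded g cg in
    cauchy-scaled (λ n → f n * g n) (A + B) (0<+ 0<A (<⇒≤ 0<B)) λ δ 0<δ →
    let N₁ , b₁ = cf δ 0<δ ; N₂ , b₂ = cg δ 0<δ in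
    (Nᶠ ℕ.⊔ Nᵍ) ℕ.⊔ (N₁ ℕ.⊔ N₂) , λ m n p q → begin
      ∣ f m * g m - f n * g n ∣                        ≤⟨ ∣*-*∣ (f m) (g m) (f n) (g n) ⟩
      ∣ f m ∣ * ∣ g m - g n ∣ + ∣ g n ∣ * ∣ f m - f n ∣ ≤⟨ +-mono-≤
          (≤-trans (*-mono (0≤∣p∣ (f m)) (b₂ m n (⊔ʳ {N₁} (⊔ʳ {Nᶠ ℕ.⊔ Nᵍ} p)) (⊔ʳ {N₁} (⊔ʳ {Nᶠ ℕ.⊔ Nᵍ} q))))
                   (*-mono′ (<⇒≤ 0<δ) (bᶠ m (⊔ˡ {Nᶠ} (⊔ˡ {Nᶠ ℕ.⊔ Nᵍ} p)))))
          (≤-trans (*-mono (0≤∣p∣ (g n)) (b₁ m n (⊔ˡ {N₁} (⊔ʳ {Nᶠ ℕ.⊔ Nᵍ} p)) (⊔ˡ {N₁} (⊔ʳ {Nᶠ ℕ.⊔ Nᵍ} q))))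
                   (*-mono′ (<⇒≤ 0<δ) (bᵍ n (⊔ʳ {Nᶠ} (⊔ˡ {Nᶠ ℕ.⊔ Nᵍ} q))))) ⟩
      A * δ + B * δ                                    ≡⟨ *-distribʳ-+ δ A B ⟨
      (A + B) * δ                                      ∎
    where open ≤-Reasoning

  inv-cauchy : ∀ f → Cauchy f → ∀ {c} → 0ℚ < c → ∃[ M ] (∀ n → M ℕ.≤ n → c ≤ f n) →
    Cauchy (λ n → inv (f n))
  inv-cauchy f cf {c} 0<c (M , c≤f) =
    cauchy-scaled (λ n → inv (f n)) (inv c * inv c) (0<* (inv-pos 0<c) (inv-pos 0<c)) λ δ 0<δ →
    let N , bd = cf δ 0<δ in
    M ℕ.⊔ N , λ m n p q → begin
      ∣ inv (f m) - inv (f n) ∣                     ≡⟨ cong ∣_∣ (diff (0<f m (⊔ˡ p)) (0<f n (⊔ˡ q))) ⟩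
      ∣ inv (f m) * inv (f n) * (f n - f m) ∣       ≡⟨ ∣p*q∣≡∣p∣*∣q∣ (inv (f m) * inv (f n)) (f n - f m) ⟩
      ∣ inv (f m) * inv (f n) ∣ * ∣ f n - f m ∣     ≡⟨ cong (_* ∣ f n - f m ∣)
          (0≤p⇒∣p∣≡p (0≤* (0≤i m (⊔ˡ p)) (0≤i n (⊔ˡ q)))) ⟩
      inv (f m) * inv (f n) * ∣ f n - f m ∣         ≤⟨ *-mono
          (0≤* (0≤i m (⊔ˡ p)) (0≤i n (⊔ˡ q))) (bd n m (⊔ʳ {M} q) (⊔ʳ {M} p)) ⟩
      inv (f m) * inv (f n) * δ                     ≤⟨ *-mono′ (<⇒≤ 0<δ)
          (≤-trans (*-mono (0≤i m (⊔ˡ p)) (inv-antitone 0<c (c≤f n (⊔ˡ q))))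
                   (*-mono′ (<⇒≤ (inv-pos 0<c)) (inv-antitone 0<c (c≤f m (⊔ˡ p))))) ⟩
      inv c * inv c * δ                             ∎
    where
    open ≤-Reasoning
    0<f : ∀ n → M ℕ.≤ n → 0ℚ < f n
    0<f n M≤n = <-≤-trans 0<c (c≤f n M≤n)
    0≤i : ∀ n → M ℕ.≤ n → 0ℚ ≤ inv (f n)
    0≤i n M≤n = <⇒≤ (inv-pos (0<f n M≤n))
    eq : ∀ i j a b → i * j * (b - a) ≡ i * (b * j) - j * (a * i)
    eq = solve-∀ ring
    eq₁ : ∀ i j → i - j ≡ i * 1ℚ - j * 1ℚ
    eq₁ = solve-∀ ring
    diff : ∀ {a b} → 0ℚ < a → 0ℚ < b → inv a - inv b ≡ inv a * inv b * (b - a)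
    diff {a} {b} 0<a 0<b = trans (eq₁ (inv a) (inv b)) (trans
      (cong₂ (λ s t → inv a * s - inv b * t) (sym (*inv 0<b)) (sym (*inv 0<a)))
      (sym (eq (inv a) (inv b) a b)))

infixl 7 _*ᴿ_
infixl 6 _+ᴿ_ _-ᴿ_
infix  8 -ᴿ_

fromℚ : ℚ → ℝ
fromℚ q = mkℝ (λ _ → q) (const-cauchy q)

_+ᴿ_ : ℝ → ℝ → ℝ
x +ᴿ y = mkℝ (λ n → seq x n + seq y n) (+-cauchy (seq x) (seq y) (cauchy x) (cauchy y))

-ᴿ_ : ℝ → ℝ
-ᴿ x = mkℝ (λ n → - seq x n) (neg-cauchy (seq x) (cauchy x))

_-ᴿ_ : ℝ → ℝ → ℝ
x -ᴿ y = x +ᴿ (-ᴿ y)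

_*ᴿ_ : ℝ → ℝ → ℝ
x *ᴿ y = mkℝ (λ n → seq x n * seq y n) (*-cauchy (seq x) (seq y) (cauchy x) (cauchy y))

0ᴿ 1ᴿ : ℝ
0ᴿ = fromℚ 0ℚ
1ᴿ = fromℚ 1ℚ

private
  positive-below : ∀ x → 0ᴿ <ᴿ x → ∃[ c ] (0ℚ < c × ∃[ N ] (∀ n → N ℕ.≤ n → c ≤ seq x n))
  positive-below x (δ , 0<δ , N , h) =
    δ , 0<δ , N , λ n N≤n → subst (_≤ seq x n) (+-identityˡ δ) (h n N≤n)

recip : (x : ℝ) → 0ᴿ <ᴿ x → ℝ
recip x 0<x = mkℝ (λ n → inv (seq x n))
  (let _ , 0<c , h = positive-below x 0<x in inv-cauchy (seq x) (cauchy x) 0<c h)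

private
  ∣psum-psum∣ : ∀ u v → (∀ k → ∣ u k ∣ ≤ v k) → ∀ m j →
    ∣ psum u m - psum u (j ℕ.+ m) ∣ ≤ psum v (j ℕ.+ m) - psum v m
  ∣psum-psum∣ u v h m zero = ≤-reflexive
    (trans (cong ∣_∣ (+-inverseʳ (psum u m))) (sym (+-inverseʳ (psum v m))))
  ∣psum-psum∣ u v h m (suc j) = begin
    ∣ Um - (U + a) ∣           ≡⟨ cong ∣_∣ (eq Um U a) ⟩
    ∣ (Um - U) + - a ∣         ≤⟨ ∣p+q∣≤∣p∣+∣q∣ (Um - U) (- a) ⟩
    ∣ Um - U ∣ + ∣ - a ∣       ≤⟨ +-mono-≤ (∣psum-psum∣ u v h m j)
        (≤-trans (≤-reflexive (∣-p∣≡∣p∣ a)) (h (j ℕ.+ m))) ⟩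
    (V - Vm) + v (j ℕ.+ m)     ≡⟨ eq₂ V Vm (v (j ℕ.+ m)) ⟩
    (V + v (j ℕ.+ m)) - Vm     ∎
    where
    open ≤-Reasoning
    Um = psum u m ; U = psum u (j ℕ.+ m) ; Vm = psum v m ; V = psum v (j ℕ.+ m)
    a = u (j ℕ.+ m)
    eq : ∀ x y z → x - (y + z) ≡ (x - y) + - z
    eq = solve-∀ ring
    eq₂ : ∀ x y z → (x - y) + z ≡ (x + z) - y
    eq₂ = solve-∀ ring

  ∣psum-psum∣≤* : ∀ u w v d → (∀ k → ∣ u k - w k ∣ ≤ v k * d) → ∀ n →
    ∣ psum u n - psum w n ∣ ≤ psum v n * d
  ∣psum-psum∣≤* u w v d h zero = ≤-reflexive (sym (*-zeroˡ d))
  ∣psum-psum∣≤* u w v d h (suc n) = begin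
    ∣ (psum u n + u n) - (psum w n + w n) ∣      ≡⟨ cong ∣_∣ (eq (psum u n) (u n) (psum w n) (w n)) ⟩
    ∣ (psum u n - psum w n) + (u n - w n) ∣      ≤⟨ ∣p+q∣≤∣p∣+∣q∣ (psum u n - psum w n) (u n - w n) ⟩
    ∣ psum u n - psum w n ∣ + ∣ u n - w n ∣      ≤⟨ +-mono-≤ (∣psum-psum∣≤* u w v d h n) (h n) ⟩
    psum v n * d + v n * d                       ≡⟨ *-distribʳ-+ d (psum v n) (v n) ⟨
    (psum v n + v n) * d                         ∎
    where
    open ≤-Reasoning
    eq : ∀ a b c d → (a + b) - (c + d) ≡ (a - c) + (b - d)
    eq = solve-∀ ring

  -- Weierstrass majorant test for a function series u with Lipschitz terms,
  -- evaluated along a Cauchy sequence.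
  majorant-cauchy : ∀ x (u : ℕ → ℚ → ℚ) v (D : ℚ → Set) → Cauchy x → Cauchy (psum v) →
    ∃[ N ] (∀ n → N ℕ.≤ n → D (x n)) →
    (∀ k q → D q → ∣ u k q ∣ ≤ v k) →
    (∀ k q r → D q → D r → ∣ u k q - u k r ∣ ≤ v k * ∣ q - r ∣) →
    Cauchy (λ n → psum (λ k → u k (x n)) n)
  majorant-cauchy x u v D cx cv (M , inD) size lip =
    let C , 0<C , N₁ , bv = bounded (psum v) cv in
    cauchy-scaled (λ n → psum (λ k → u k (x n)) n) (C + 1ℚ) (0<+ 0<C 0≤1) (λ δ 0<δ →
    symmetrise (λ n → psum (λ k → u k (x n)) n) ((C + 1ℚ) * δ)
    (let N₂ , b₂ = cx δ 0<δ ; N₃ , b₃ = cv δ 0<δ in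
    (M ℕ.⊔ N₁) ℕ.⊔ (N₂ ℕ.⊔ N₃) , λ m n p m≤n →
    let q  = ℕₚ.≤-trans p m≤n
        Dm = inD m (⊔ˡ {M} (⊔ˡ {M ℕ.⊔ N₁} p))
        Dn = inD n (⊔ˡ {M} (⊔ˡ {M ℕ.⊔ N₁} q))
        S  = λ i j → psum (λ k → u k (x j)) i
    in begin
      ∣ S m m - S n n ∣                              ≤⟨ ∣-∣-triangle (S m m) (S m n) (S n n) ⟩
      ∣ S m m - S m n ∣ + ∣ S m n - S n n ∣          ≤⟨ +-mono-≤
          (≤-trans (∣psum-psum∣≤* (λ k → u k (x m)) (λ k → u k (x n)) v ∣ x m - x n ∣ (λ k → lip k (x m) (x n) Dm Dn) m)
            (≤-trans (*-mono′ (0≤∣p∣ (x m - x n)) (≤-trans (p≤∣p∣ (psum v m)) (bv m (⊔ʳ {M} (⊔ˡ {M ℕ.⊔ N₁} p)))))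
                     (*-mono (<⇒≤ 0<C) (b₂ m n (⊔ˡ (⊔ʳ {M ℕ.⊔ N₁} p)) (⊔ˡ (⊔ʳ {M ℕ.⊔ N₁} q))))))
          (≤-trans (tail (x n) Dn m≤n)
            (≤-trans (p≤∣p∣ (psum v n - psum v m))
                     (b₃ n m (⊔ʳ {N₂} (⊔ʳ {M ℕ.⊔ N₁} q)) (⊔ʳ {N₂} (⊔ʳ {M ℕ.⊔ N₁} p))))) ⟩
      C * δ + δ                                      ≡⟨ eq C δ ⟩
      (C + 1ℚ) * δ                                   ∎))
    where
    open ≤-Reasoning
    eq : ∀ c d → c * d + d ≡ (c + 1ℚ) * d
    eq = solve-∀ ring
    tail : ∀ {m n} q → D q → m ℕ.≤ n →
      ∣ psum (λ k → u k q) m - psum (λ k → u k q) n ∣ ≤ psum v n - psum v m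
    tail {m} {n} q Dq m≤n =
      subst (λ t → ∣ psum (λ k → u k q) m - psum (λ k → u k q) t ∣ ≤ psum v t - psum v m)
        (ℕₚ.m∸n+n≡m m≤n) (∣psum-psum∣ (λ k → u k q) v (λ k → size k q Dq) m (n ℕ.∸ m))

  ratio-cauchy : ∀ v K {c} → 0ℚ < c → (∀ k → 0ℚ ≤ v k) →
    (∀ k → K ℕ.≤ k → c * v k ≤ v k - v (suc k)) → Cauchy (psum v)
  ratio-cauchy v K {c} 0<c 0≤v ratio =
    λ δ 0<δ → symmetrise (psum v) δ
      (let δ′ = c * δ
           0<δ′ = 0<* 0<c 0<δ
           J , le = archimedean (v K * inv (c * δ′))
           N = suc J ℕ.+ K
       in N , λ m n N≤m m≤n → *-cancel 0<c (begin
        c * ∣ psum v m - psum v n ∣   ≤⟨ *-mono (<⇒≤ 0<c) (tail m≤n) ⟩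
        c * (psum v n - psum v m)     ≤⟨ telescope m n (ℕₚ.≤-trans (ℕₚ.m≤n+m K (suc J)) N≤m) m≤n ⟩
        v m                           ≤⟨ decreasing N m (ℕₚ.m≤n+m K (suc J)) N≤m ⟩
        v (suc J ℕ.+ K)               ≤⟨ *-cancel (0<* 0<c (fromℕ-pos J)) (begin
             c * fromℕ (suc J) * v (suc J ℕ.+ K)    ≡⟨ *-assoc c (fromℕ (suc J)) (v (suc J ℕ.+ K)) ⟩
             c * (fromℕ (suc J) * v (suc J ℕ.+ K))  ≤⟨ *-mono (<⇒≤ 0<c) (slow (suc J)) ⟩
             c * (psum v (suc J ℕ.+ K) - psum v K)  ≤⟨ telescope K (suc J ℕ.+ K) ℕₚ.≤-refl (ℕₚ.m≤n+m K (suc J)) ⟩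
             v K                                    ≡⟨ cancel-inv (v K) (0<* 0<c 0<δ′) ⟨
             c * δ′ * (v K * inv (c * δ′))          ≤⟨ *-mono (<⇒≤ (0<* 0<c 0<δ′)) (≤-trans le (fromℕ-mono (ℕₚ.n≤1+n J))) ⟩
             c * δ′ * fromℕ (suc J)                 ≡⟨ eq₃ c δ′ (fromℕ (suc J)) ⟩
             c * fromℕ (suc J) * δ′                 ∎) ⟩
        c * δ                         ∎))
    where
    open ≤-Reasoning
    eq₃ : ∀ a b d → a * b * d ≡ a * d * b
    eq₃ = solve-∀ ring
    tail : ∀ {m n} → m ℕ.≤ n → ∣ psum v m - psum v n ∣ ≤ psum v n - psum v m
    tail {m} {n} m≤n =
      subst (λ t → ∣ psum v m - psum v t ∣ ≤ psum v t - psum v m) (ℕₚ.m∸n+n≡m m≤n)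
        (∣psum-psum∣ v v (λ k → ≤-reflexive (0≤p⇒∣p∣≡p (0≤v k))) m (n ℕ.∸ m))
    step : ∀ k → K ℕ.≤ k → v (suc k) ≤ v k
    step k K≤k = 0≤-⇒≤ (≤-trans (0≤* (<⇒≤ 0<c) (0≤v k)) (ratio k K≤k))
    decreasing′ : ∀ m j → K ℕ.≤ m → v (j ℕ.+ m) ≤ v m
    decreasing′ m zero    K≤m = ≤-refl
    decreasing′ m (suc j) K≤m =
      ≤-trans (step (j ℕ.+ m) (ℕₚ.≤-trans K≤m (ℕₚ.m≤n+m m j))) (decreasing′ m j K≤m)
    decreasing : ∀ m n → K ℕ.≤ m → m ℕ.≤ n → v n ≤ v m
    decreasing m n K≤m m≤n =
      subst (λ t → v t ≤ v m) (ℕₚ.m∸n+n≡m m≤n) (decreasing′ m (n ℕ.∸ m) K≤m)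
    telescope′ : ∀ m j → K ℕ.≤ m →
      c * (psum v (j ℕ.+ m) - psum v m) ≤ v m - v (j ℕ.+ m)
    telescope′ m zero K≤m = ≤-reflexive (eq c (psum v m) (v m))
      where
      eq : ∀ c s t → c * (s - s) ≡ t - t
      eq = solve-∀ ring
    telescope′ m (suc j) K≤m = begin
      c * ((V + a) - Vm)            ≡⟨ eq c V a Vm ⟩
      c * (V - Vm) + c * a          ≤⟨ +-mono-≤ (telescope′ m j K≤m)
          (ratio (j ℕ.+ m) (ℕₚ.≤-trans K≤m (ℕₚ.m≤n+m m j))) ⟩
      (v m - a) + (a - b)           ≡⟨ eq₂ (v m) a b ⟩
      v m - b                       ∎
      where
      V = psum v (j ℕ.+ m) ; Vm = psum v m ; a = v (j ℕ.+ m) ; b = v (suc j ℕ.+ m)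
      eq : ∀ c x y z → c * ((x + y) - z) ≡ c * (x - z) + c * y
      eq = solve-∀ ring
      eq₂ : ∀ x y z → (x - y) + (y - z) ≡ x - z
      eq₂ = solve-∀ ring
    telescope : ∀ m n → K ℕ.≤ m → m ℕ.≤ n → c * (psum v n - psum v m) ≤ v m
    telescope m n K≤m m≤n = ≤-trans
      (subst (λ t → c * (psum v t - psum v m) ≤ v m - v t) (ℕₚ.m∸n+n≡m m≤n)
        (telescope′ m (n ℕ.∸ m) K≤m))
      (0≤-⇒≤ (subst (0ℚ ≤_) (eq (v m) (v n)) (0≤v n)))
      where
      eq : ∀ x y → y ≡ x - (x - y)
      eq = solve-∀ ring
    slow : ∀ j → fromℕ j * v (j ℕ.+ K) ≤ psum v (j ℕ.+ K) - psum v K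
    slow zero = ≤-reflexive (trans (*-zeroˡ (v K)) (sym (+-inverseʳ (psum v K))))
    slow (suc j) = begin
      fromℕ (suc j) * v (suc j ℕ.+ K)              ≤⟨ *-mono (fromℕ-nonNeg (suc j)) (step (j ℕ.+ K) (ℕₚ.m≤n+m K j)) ⟩
      fromℕ (suc j) * v (j ℕ.+ K)                  ≡⟨ cong (_* v (j ℕ.+ K)) (fromℕ-suc j) ⟩
      (1ℚ + fromℕ j) * v (j ℕ.+ K)                 ≡⟨ eq (fromℕ j) (v (j ℕ.+ K)) ⟩
      fromℕ j * v (j ℕ.+ K) + v (j ℕ.+ K)          ≤⟨ +-monoˡ-≤ (v (j ℕ.+ K)) (slow j) ⟩
      (psum v (j ℕ.+ K) - psum v K) + v (j ℕ.+ K)  ≡⟨ eq₂ (psum v (j ℕ.+ K)) (psum v K) (v (j ℕ.+ K)) ⟩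
      (psum v (j ℕ.+ K) + v (j ℕ.+ K)) - psum v K  ∎
      where
      eq : ∀ x y → (1ℚ + x) * y ≡ x * y + y
      eq = solve-∀ ring
      eq₂ : ∀ x y z → (x - y) + z ≡ (x + z) - y
      eq₂ = solve-∀ ring

private
  ^-nonNeg : ∀ {b} → 0ℚ ≤ b → ∀ k → 0ℚ ≤ b ^ k
  ^-nonNeg 0≤b zero    = 0≤1
  ^-nonNeg 0≤b (suc k) = 0≤* 0≤b (^-nonNeg 0≤b k)

  ∣^∣≤ : ∀ {q b} → 0ℚ ≤ b → ∣ q ∣ ≤ b → ∀ k → ∣ q ^ k ∣ ≤ b ^ k
  ∣^∣≤ 0≤b h zero = ≤-refl
  ∣^∣≤ {q} {b} 0≤b h (suc k) = begin
    ∣ q * q ^ k ∣      ≡⟨ ∣p*q∣≡∣p∣*∣q∣ q (q ^ k) ⟩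
    ∣ q ∣ * ∣ q ^ k ∣  ≤⟨ *-mono (0≤∣p∣ q) (∣^∣≤ 0≤b h k) ⟩
    ∣ q ∣ * b ^ k      ≤⟨ *-mono′ (^-nonNeg 0≤b k) h ⟩
    b * b ^ k          ∎
    where open ≤-Reasoning

  ∣^-^∣≤ : ∀ {q r b} → 0ℚ ≤ b → ∣ q ∣ ≤ b → ∣ r ∣ ≤ b → ∀ k →
    ∣ q ^ suc k - r ^ suc k ∣ ≤ fromℕ (suc k) * b ^ k * ∣ q - r ∣
  ∣^-^∣≤ {q} {r} 0≤b hq hr zero = ≤-reflexive
    (trans (cong₂ (λ s t → ∣ s - t ∣) (*-identityʳ q) (*-identityʳ r)) (sym (*-identityˡ ∣ q - r ∣)))
  ∣^-^∣≤ {q} {r} {b} 0≤b hq hr (suc k) = begin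
    ∣ q * q ^ suc k - r * r ^ suc k ∣                                   ≤⟨ ∣*-*∣ q (q ^ suc k) r (r ^ suc k) ⟩
    ∣ q ∣ * ∣ q ^ suc k - r ^ suc k ∣ + ∣ r ^ suc k ∣ * ∣ q - r ∣       ≤⟨ +-mono-≤
        (≤-trans (*-mono (0≤∣p∣ q) (∣^-^∣≤ 0≤b hq hr k))
                 (*-mono′ (0≤* (0≤* (fromℕ-nonNeg (suc k)) (^-nonNeg 0≤b k)) (0≤∣p∣ (q - r))) hq))
        (*-mono′ (0≤∣p∣ (q - r)) (∣^∣≤ 0≤b hr (suc k))) ⟩
    b * (fromℕ (suc k) * b ^ k * ∣ q - r ∣) + b * b ^ k * ∣ q - r ∣     ≡⟨ eq b (fromℕ (suc k)) (b ^ k) ∣ q - r ∣ ⟩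
    (1ℚ + fromℕ (suc k)) * (b * b ^ k) * ∣ q - r ∣                      ≡⟨ cong (λ t → t * b ^ suc k * ∣ q - r ∣) (fromℕ-suc (suc k)) ⟨
    fromℕ (suc (suc k)) * b ^ suc k * ∣ q - r ∣                         ∎
    where
    open ≤-Reasoning
    eq : ∀ b n p d → b * (n * p * d) + b * p * d ≡ (1ℚ + n) * (b * p) * d
    eq = solve-∀ ring

  ∣*-*∣ʳ : ∀ a b {c} → 0ℚ ≤ c → ∣ a * c - b * c ∣ ≡ ∣ a - b ∣ * c
  ∣*-*∣ʳ a b {c} 0≤c = trans (cong ∣_∣ (eq a b c))
    (trans (∣p*q∣≡∣p∣*∣q∣ (a - b) c) (cong (∣ a - b ∣ *_) (0≤p⇒∣p∣≡p 0≤c)))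
    where
    eq : ∀ a b c → a * c - b * c ≡ (a - b) * c
    eq = solve-∀ ring

  ∣*∣ʳ : ∀ a {c} → 0ℚ ≤ c → ∣ a * c ∣ ≡ ∣ a ∣ * c
  ∣*∣ʳ a {c} 0≤c = trans (∣p*q∣≡∣p∣*∣q∣ a c) (cong (∣ a ∣ *_) (0≤p⇒∣p∣≡p 0≤c))

  1/! : ℕ → ℚ
  1/! k = (+ 1 / (k !)) {{k ℕₚ.!≢0}}

  1/* : ∀ m n .{{_ : ℕ.NonZero m}} .{{_ : ℕ.NonZero n}} .{{_ : ℕ.NonZero (m ℕ.* n)}} →
    + 1 / (m ℕ.* n) ≡ (+ 1 / m) * (+ 1 / n)
  1/* (suc m) (suc n) = toℚᵘ-injective (begin
    toℚᵘ (+ 1 / (suc m ℕ.* suc n))                ≈⟨ toℚᵘ-fromℚᵘ (ℚᵘ.mkℚᵘ (+ 1) (n ℕ.+ m ℕ.* suc n)) ⟩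
    ℚᵘ.mkℚᵘ (+ 1) m ℚᵘ.* ℚᵘ.mkℚᵘ (+ 1) n          ≈⟨ ℚᵘₚ.*-cong (toℚᵘ-fromℚᵘ (ℚᵘ.mkℚᵘ (+ 1) m)) (toℚᵘ-fromℚᵘ (ℚᵘ.mkℚᵘ (+ 1) n)) ⟨
    toℚᵘ (+ 1 / suc m) ℚᵘ.* toℚᵘ (+ 1 / suc n)    ≈⟨ toℚᵘ-homo-* (+ 1 / suc m) (+ 1 / suc n) ⟨
    toℚᵘ ((+ 1 / suc m) * (+ 1 / suc n))          ∎)
    where open ℚᵘₚ.≃-Reasoning

  1/!-suc : ∀ k → 1/! (suc k) ≡ unit k * 1/! k
  1/!-suc k = 1/* (suc k) (k !) {{_}} {{k ℕₚ.!≢0}} {{suc k ℕₚ.!≢0}}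

  1/!-pos : ∀ k → 0ℚ < 1/! k
  1/!-pos zero    = 0<1
  1/!-pos (suc k) = subst (0ℚ <_) (sym (1/!-suc k)) (0<* (unit-pos k) (1/!-pos k))

expTerm : ℕ → ℚ → ℚ
expTerm k q = q ^ k * (+ 1 / (k !)) {{k ℕₚ.!≢0}}

private
  module ExpMajorant (b : ℚ) (0≤b : 0ℚ ≤ b) where
    E : ℕ → ℚ
    E k = expTerm k b

    v : ℕ → ℚ
    v zero    = 1ℚ
    v (suc k) = E (suc k) + E k

    0≤E : ∀ k → 0ℚ ≤ E k
    0≤E k = 0≤* (^-nonNeg 0≤b k) (<⇒≤ (1/!-pos k))

    0≤v : ∀ k → 0ℚ ≤ v k
    0≤v zero    = 0≤1
    0≤v (suc k) = 0≤+ (0≤E (suc k)) (0≤E k)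

    E≤v : ∀ k → E k ≤ v k
    E≤v zero    = ≤-refl
    E≤v (suc k) = p≤p+q (0≤E k)

    D : ℚ → Set
    D q = ∣ q ∣ ≤ b

    size : ∀ k q → D q → ∣ expTerm k q ∣ ≤ v k
    size k q h = begin
      ∣ q ^ k * 1/! k ∣   ≡⟨ ∣*∣ʳ (q ^ k) (<⇒≤ (1/!-pos k)) ⟩
      ∣ q ^ k ∣ * 1/! k   ≤⟨ *-mono′ (<⇒≤ (1/!-pos k)) (∣^∣≤ 0≤b h k) ⟩
      E k                 ≤⟨ E≤v k ⟩
      v k                 ∎
      where open ≤-Reasoning

    lip : ∀ k q r → D q → D r → ∣ expTerm k q - expTerm k r ∣ ≤ v k * ∣ q - r ∣
    lip zero q r hq hr = subst (0ℚ ≤_) (sym (*-identityˡ ∣ q - r ∣)) (0≤∣p∣ (q - r))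
    lip (suc k) q r hq hr = begin
      ∣ q ^ suc k * 1/! (suc k) - r ^ suc k * 1/! (suc k) ∣             ≡⟨ ∣*-*∣ʳ (q ^ suc k) (r ^ suc k) (<⇒≤ (1/!-pos (suc k))) ⟩
      ∣ q ^ suc k - r ^ suc k ∣ * 1/! (suc k)                           ≤⟨ *-mono′ (<⇒≤ (1/!-pos (suc k))) (∣^-^∣≤ 0≤b hq hr k) ⟩
      fromℕ (suc k) * b ^ k * ∣ q - r ∣ * 1/! (suc k)                   ≡⟨ cong (fromℕ (suc k) * b ^ k * ∣ q - r ∣ *_) (1/!-suc k) ⟩
      fromℕ (suc k) * b ^ k * ∣ q - r ∣ * (unit k * 1/! k)              ≡⟨ eq (fromℕ (suc k)) (b ^ k) ∣ q - r ∣ (unit k) (1/! k) ⟩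
      (fromℕ (suc k) * unit k) * (E k * ∣ q - r ∣)                      ≡⟨ cong (_* (E k * ∣ q - r ∣)) (fromℕ*unit k) ⟩
      1ℚ * (E k * ∣ q - r ∣)                                            ≡⟨ *-identityˡ (E k * ∣ q - r ∣) ⟩
      E k * ∣ q - r ∣                                                   ≤⟨ *-mono′ (0≤∣p∣ (q - r)) (q≤p+q (0≤E (suc k))) ⟩
      v (suc k) * ∣ q - r ∣                                             ∎
      where
      open ≤-Reasoning
      eq : ∀ n p d u i → n * p * d * (u * i) ≡ (n * u) * ((p * i) * d)
      eq = solve-∀ ring

    K : ℕ
    K = proj₁ (archimedean ((1ℚ + 1ℚ) * b))

    halving : ∀ k → K ℕ.≤ k → E (suc k) ≤ ½ * E k
    halving k K≤k = begin
      b * b ^ k * 1/! (suc k)                          ≡⟨ cong (b * b ^ k *_) (1/!-suc k) ⟩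
      b * b ^ k * (unit k * 1/! k)                     ≡⟨ eq b (b ^ k) (unit k) (1/! k) ⟩
      ½ * (((1ℚ + 1ℚ) * b) * unit k) * E k             ≤⟨ *-mono′ (0≤E k) (*-mono (nonNegative⁻¹ ½)
          (*-mono′ (<⇒≤ (unit-pos k)) (≤-trans (proj₂ (archimedean ((1ℚ + 1ℚ) * b))) (fromℕ-mono (ℕₚ.m≤n⇒m≤1+n K≤k))))) ⟩
      ½ * (fromℕ (suc k) * unit k) * E k               ≡⟨ cong (λ t → ½ * t * E k) (fromℕ*unit k) ⟩
      ½ * 1ℚ * E k                                     ≡⟨ cong (_* E k) (*-identityʳ ½) ⟩
      ½ * E k                                          ∎
      where
      open ≤-Reasoning
      eq : ∀ b p u i → b * p * (u * i) ≡ ½ * (((1ℚ + 1ℚ) * b) * u) * (p * i)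
      eq = solve-∀ ring

    ratio : ∀ k → suc K ℕ.≤ k → ½ * v k ≤ v k - v (suc k)
    ratio (suc k) (s≤s K≤k) = 0≤-⇒≤ (subst (0ℚ ≤_) (eq (E k) (E (suc k)) (E (suc (suc k))))
      (0≤+ (≤⇒0≤- (halving k K≤k)) (≤⇒0≤- (halving (suc k) (ℕₚ.m≤n⇒m≤1+n K≤k)))))
      where
      eq : ∀ x y z → (½ * x - y) + (½ * y - z) ≡ ((y + x) - (z + y)) - ½ * (y + x)
      eq = solve-∀ ring

    v-cauchy : Cauchy (psum v)
    v-cauchy = ratio-cauchy v (suc K) (positive⁻¹ ½) 0≤v ratio

-- The n-th approximation is the n-th partial sum of ∑ xᵏ / k! at the n-th
-- approximation of x.
exp : ℝ → ℝ
exp x = mkℝ (λ n → psum (λ k → expTerm k (seq x n)) n)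
  (let b , 0<b , h = bounded (seq x) (cauchy x)
       open ExpMajorant b (<⇒≤ 0<b)
   in majorant-cauchy (seq x) expTerm v D (cauchy x) v-cauchy h size lip)

artanhTerm : ℕ → ℚ → ℚ
artanhTerm k q = q ^ suc (2 ℕ.* k) * (+ 1 / suc (2 ℕ.* k))

private
  module ArtanhMajorant (ρ : ℚ) (0≤ρ : 0ℚ ≤ ρ) (ρ<1 : ρ < 1ℚ) where
    v : ℕ → ℚ
    v k = ρ ^ (2 ℕ.* k)

    0≤v : ∀ k → 0ℚ ≤ v k
    0≤v k = ^-nonNeg 0≤ρ (2 ℕ.* k)

    D : ℚ → Set
    D q = ∣ q ∣ ≤ ρ

    ρ*≤ : ∀ {q} → 0ℚ ≤ q → ρ * q ≤ q
    ρ*≤ {q} 0≤q = subst (ρ * q ≤_) (*-identityˡ q) (*-mono′ 0≤q (<⇒≤ ρ<1))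

    size : ∀ k q → D q → ∣ artanhTerm k q ∣ ≤ v k
    size k q h = begin
      ∣ q ^ suc (2 ℕ.* k) * unit (2 ℕ.* k) ∣   ≡⟨ ∣*∣ʳ (q ^ suc (2 ℕ.* k)) (<⇒≤ (unit-pos (2 ℕ.* k))) ⟩
      ∣ q ^ suc (2 ℕ.* k) ∣ * unit (2 ℕ.* k)   ≤⟨ *-mono (0≤∣p∣ (q ^ suc (2 ℕ.* k))) (unit≤1 (2 ℕ.* k)) ⟩
      ∣ q ^ suc (2 ℕ.* k) ∣ * 1ℚ               ≡⟨ *-identityʳ ∣ q ^ suc (2 ℕ.* k) ∣ ⟩
      ∣ q ^ suc (2 ℕ.* k) ∣                    ≤⟨ ∣^∣≤ 0≤ρ h (suc (2 ℕ.* k)) ⟩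
      ρ * v k                                  ≤⟨ ρ*≤ (0≤v k) ⟩
      v k                                      ∎
      where open ≤-Reasoning

    lip : ∀ k q r → D q → D r → ∣ artanhTerm k q - artanhTerm k r ∣ ≤ v k * ∣ q - r ∣
    lip k q r hq hr = begin
      ∣ q ^ suc l * unit l - r ^ suc l * unit l ∣    ≡⟨ ∣*-*∣ʳ (q ^ suc l) (r ^ suc l) (<⇒≤ (unit-pos l)) ⟩
      ∣ q ^ suc l - r ^ suc l ∣ * unit l             ≤⟨ *-mono′ (<⇒≤ (unit-pos l)) (∣^-^∣≤ 0≤ρ hq hr l) ⟩
      fromℕ (suc l) * v k * ∣ q - r ∣ * unit l       ≡⟨ eq (fromℕ (suc l)) (v k) ∣ q - r ∣ (unit l) ⟩
      (fromℕ (suc l) * unit l) * (v k * ∣ q - r ∣)   ≡⟨ cong (_* (v k * ∣ q - r ∣)) (fromℕ*unit l) ⟩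
      1ℚ * (v k * ∣ q - r ∣)                         ≡⟨ *-identityˡ (v k * ∣ q - r ∣) ⟩
      v k * ∣ q - r ∣                                ∎
      where
      open ≤-Reasoning
      l = 2 ℕ.* k
      eq : ∀ n p d u → n * p * d * u ≡ (n * u) * (p * d)
      eq = solve-∀ ring

    v-suc : ∀ k → v (suc k) ≡ ρ * (ρ * v k)
    v-suc k = cong (ρ ^_) (ℕₚ.*-suc 2 k)

    ratio : ∀ k → 0 ℕ.≤ k → (1ℚ - ρ) * v k ≤ v k - v (suc k)
    ratio k _ = 0≤-⇒≤ (subst (0ℚ ≤_) (eq ρ (v k) (v (suc k)))
      (≤⇒0≤- (subst (_≤ ρ * v k) (sym (v-suc k)) (*-mono 0≤ρ (ρ*≤ (0≤v k))))))
      where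
      eq : ∀ r a b → r * a - b ≡ (a - b) - (1ℚ - r) * a
      eq = solve-∀ ring

    v-cauchy : Cauchy (psum v)
    v-cauchy = ratio-cauchy v 0
      (subst (_< 1ℚ - ρ) (+-inverseʳ ρ) (+-monoˡ-< (- ρ) ρ<1)) 0≤v ratio

  common-lower : ∀ {a b} → 0ℚ < a → 0ℚ < b → ∃[ δ ] (0ℚ < δ × δ ≤ a × δ ≤ b)
  common-lower {a} {b} 0<a 0<b with ≤-total a b
  ... | inj₁ a≤b = a , 0<a , ≤-refl , a≤b
  ... | inj₂ b≤a = b , 0<b , b≤a , ≤-refl

  within : ∀ z → -ᴿ 1ᴿ <ᴿ z → z <ᴿ 1ᴿ →
    ∃[ ρ ] (0ℚ ≤ ρ × ρ < 1ℚ × ∃[ N ] (∀ n → N ℕ.≤ n → ∣ seq z n ∣ ≤ ρ))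
  within z (δ₁ , 0<δ₁ , N₁ , h₁) (δ₂ , 0<δ₂ , N₂ , h₂) =
    ρ , ≤-trans (0≤∣p∣ (seq z N)) (bd N ℕₚ.≤-refl) , ρ<1 , N , bd
    where
    open ≤-Reasoning
    low = common-lower 0<δ₁ 0<δ₂
    δ   = proj₁ low
    ρ   = 1ℚ - δ
    N   = N₁ ℕ.⊔ N₂
    eq₁ : ∀ z d → (z - (- 1ℚ + d)) ≡ (1ℚ - d) - - z
    eq₁ = solve-∀ ring
    eq₂ : ∀ z d → 1ℚ - (z + d) ≡ (1ℚ - d) - z
    eq₂ = solve-∀ ring
    bd : ∀ n → N ℕ.≤ n → ∣ seq z n ∣ ≤ ρ
    bd n N≤n = ≤∧-≤⇒∣∣≤
      (0≤-⇒≤ (subst (0ℚ ≤_) (eq₂ (seq z n) δ) (≤⇒0≤-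
        (≤-trans (+-monoʳ-≤ (seq z n) (proj₂ (proj₂ (proj₂ low)))) (h₂ n (⊔ʳ {N₁} N≤n))))))
      (0≤-⇒≤ (subst (0ℚ ≤_) (eq₁ (seq z n) δ) (≤⇒0≤-
        (≤-trans (+-monoʳ-≤ (- 1ℚ) (proj₁ (proj₂ (proj₂ low)))) (h₁ n (⊔ˡ N≤n))))))
    eq₃ : ∀ d → 1ℚ - d ≡ - d + 1ℚ
    eq₃ = solve-∀ ring
    ρ<1 : ρ < 1ℚ
    ρ<1 = subst₂ _<_ (sym (eq₃ δ)) (+-identityˡ 1ℚ) (+-monoˡ-< 1ℚ (neg-antimono-< (proj₁ (proj₂ low))))

artanh : (z : ℝ) → -ᴿ 1ᴿ <ᴿ z → z <ᴿ 1ᴿ → ℝ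
artanh z -1<z z<1 = mkℝ (λ n → psum (λ k → artanhTerm k (seq z n)) n)
  (let ρ , 0≤ρ , ρ<1 , h = within z -1<z z<1
       open ArtanhMajorant ρ 0≤ρ ρ<1
   in majorant-cauchy (seq z) artanhTerm v D (cauchy z) v-cauchy h size lip)

private
  module LogArgument (x : ℝ) (0<x : 0ᴿ <ᴿ x) where
    below = positive-below x 0<x
    δ     = proj₁ below
    0<δ   = proj₁ (proj₂ below)
    N₁    = proj₁ (proj₂ (proj₂ below))
    δ≤x   = proj₂ (proj₂ (proj₂ below))
    above = bounded (seq x) (cauchy x)
    B     = proj₁ above
    0<B   = proj₁ (proj₂ above)
    N₂    = proj₁ (proj₂ (proj₂ above))
    ∣x∣≤B = proj₂ (proj₂ (proj₂ above))
    N     = N₁ ℕ.⊔ N₂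

    0<x+1 : 0ᴿ <ᴿ x +ᴿ 1ᴿ
    0<x+1 = 1ℚ , 0<1 , N₁ , λ n N₁≤n →
      +-monoˡ-≤ 1ℚ (≤-trans (<⇒≤ 0<δ) (δ≤x n N₁≤n))

    z : ℝ
    z = (x -ᴿ 1ᴿ) *ᴿ recip (x +ᴿ 1ᴿ) 0<x+1

    0<B+1 : 0ℚ < B + 1ℚ
    0<B+1 = 0<+ 0<B 0≤1

    I : ℚ
    I = inv (B + 1ℚ)

    module At (n : ℕ) (N≤n : N ℕ.≤ n) where
      a i : ℚ
      a = seq x n
      i = inv (a + 1ℚ)

      δ≤a : δ ≤ a
      δ≤a = δ≤x n (⊔ˡ N≤n)

      0<a : 0ℚ < a
      0<a = <-≤-trans 0<δ δ≤a

      0<a+1 : 0ℚ < a + 1ℚ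
      0<a+1 = 0<+ 0<a 0≤1

      I≤i : I ≤ i
      I≤i = inv-antitone 0<a+1 (+-monoˡ-≤ 1ℚ (≤-trans (p≤∣p∣ a) (∣x∣≤B n (⊔ʳ {N₁} N≤n))))

    z<1 : z <ᴿ 1ᴿ
    z<1 = I , inv-pos 0<B+1 , N , λ n N≤n →
      let open At n N≤n in
      ≤-trans (+-monoʳ-≤ ((a - 1ℚ) * i) I≤i)
        (0≤-⇒≤ (subst (0ℚ ≤_) (trans (eq a i) (cong (_- ((a - 1ℚ) * i + i)) (*inv 0<a+1)))
          (<⇒≤ (inv-pos 0<a+1))))
      where
      eq : ∀ a i → i ≡ (a + 1ℚ) * i - ((a - 1ℚ) * i + i)
      eq = solve-∀ ring

    -1<z : -ᴿ 1ᴿ <ᴿ z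
    -1<z = δ * I , 0<* 0<δ (inv-pos 0<B+1) , N , λ n N≤n →
      let open At n N≤n
          0≤i = <⇒≤ (inv-pos 0<a+1)
      in ≤-trans
        (+-monoʳ-≤ (- 1ℚ) (≤-trans (*-mono (<⇒≤ 0<δ) I≤i) (*-mono′ 0≤i δ≤a)))
        (0≤-⇒≤ (subst (0ℚ ≤_)
          (trans (eq a i) (cong (λ t → (a - 1ℚ) * i - (- t + a * i)) (*inv 0<a+1)))
          (0≤* (<⇒≤ 0<a) 0≤i)))
      where
      eq : ∀ a i → a * i ≡ (a - 1ℚ) * i - (- ((a + 1ℚ) * i) + a * i)
      eq = solve-∀ ring

-- log x = 2 artanh ((x - 1) / (x + 1)) for every x > 0.
log : (x : ℝ) → 0ᴿ <ᴿ x → ℝ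
log x 0<x = fromℚ (fromℕ 2) *ᴿ artanh z -1<z z<1
  where open LogArgument x 0<x

rpow : (x : ℝ) → 0ᴿ <ᴿ x → ℝ → ℝ
rpow x 0<x y = exp (y *ᴿ log x 0<x)

fromℕᴿ : ℕ → ℝ
fromℕᴿ n = fromℚ (fromℕ n)

0<fromℕᴿ : ∀ s .{{_ : NonTrivial s}} → 0ᴿ <ᴿ fromℕᴿ s
0<fromℕᴿ (suc (suc s)) = fromℕ (suc (suc s)) , fromℕ-pos (suc s) , 0 , λ _ _ →
  ≤-reflexive (+-identityˡ (fromℕ (suc (suc s))))

private
  module LogPositive (s : ℕ) where
    S ζ : ℚ
    S = fromℕ (suc (suc s))
    ζ = (S - 1ℚ) * inv (S + 1ℚ)

    0<ζ : 0ℚ < ζ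
    0<ζ = 0<* (subst (0ℚ <_) (sym (trans (cong (_- 1ℚ) (fromℕ-suc (suc s))) (eq (fromℕ (suc s))))) (fromℕ-pos s))
              (inv-pos (0<+ (fromℕ-pos (suc s)) 0≤1))
      where
      eq : ∀ a → (1ℚ + a) - 1ℚ ≡ a
      eq = solve-∀ ring

    P : ℕ → ℚ
    P = psum (λ k → artanhTerm k ζ)

    ζ≤P : ∀ n → ζ ≤ P (suc n)
    ζ≤P zero = ≤-reflexive (eq ζ)
      where
      eq : ∀ a → a ≡ 0ℚ + a * 1ℚ * 1ℚ
      eq = solve-∀ ring
    ζ≤P (suc n) = ≤-trans (ζ≤P n) (p≤p+q
      (0≤* (^-nonNeg (<⇒≤ 0<ζ) (suc (2 ℕ.* suc n))) (<⇒≤ (unit-pos (2 ℕ.* suc n)))))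

    ζ≤2P : ∀ n → 1 ℕ.≤ n → 0ℚ + ζ ≤ fromℕ 2 * P n
    ζ≤2P (suc n) _ = begin
      0ℚ + ζ                    ≡⟨ +-identityˡ ζ ⟩
      ζ                         ≤⟨ ζ≤P n ⟩
      P (suc n)                 ≤⟨ p≤p+q (≤-trans (<⇒≤ 0<ζ) (ζ≤P n)) ⟩
      P (suc n) + P (suc n)     ≡⟨ eq (P (suc n)) ⟩
      (1ℚ + 1ℚ) * P (suc n)     ∎
      where
      open ≤-Reasoning
      eq : ∀ a → a + a ≡ (1ℚ + 1ℚ) * a
      eq = solve-∀ ring

0<log : ∀ s .{{_ : NonTrivial s}} → 0ᴿ <ᴿ log (fromℕᴿ s) (0<fromℕᴿ s)
0<log (suc (suc s)) = ζ , 0<ζ , 1 , ζ≤2P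
  where open LogPositive s

-- exp ((4 - ε) s^(1/2) (log s)^(-1/2)); s ≥ 2 is what makes log s positive.
lowerBound : ℝ → (s : ℕ) → .{{NonTrivial s}} → ℝ
lowerBound ε s = exp ((fromℕᴿ 4 -ᴿ ε) *ᴿ
  (rpow (fromℕᴿ s) (0<fromℕᴿ s) (fromℚ ½) *ᴿ
   rpow (log (fromℕᴿ s) (0<fromℕᴿ s)) (0<log s) (fromℚ -½)))

infixl 7 _*ᶜ_
infixl 6 _+ᶜ_
infix  4 _≃ᶜ_

record ℂ : Set where
  constructor _+i_
  field
    re im : ℝ

open ℂ public

_≃ᶜ_ : ℂ → ℂ → Set
w ≃ᶜ z = re w ≃ᴿ re z × im w ≃ᴿ im z

fromℚᶜ : ℚ → ℂ
fromℚᶜ q = fromℚ q +i 0ᴿ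

0ᶜ 1ᶜ : ℂ
0ᶜ = fromℚᶜ 0ℚ
1ᶜ = fromℚᶜ 1ℚ

_+ᶜ_ : ℂ → ℂ → ℂ
w +ᶜ z = (re w +ᴿ re z) +i (im w +ᴿ im z)

_*ᶜ_ : ℂ → ℂ → ℂ
w *ᶜ z = (re w *ᴿ re z -ᴿ im w *ᴿ im z) +i (re w *ᴿ im z +ᴿ im w *ᴿ re z)

_^ᶜ_ : ℂ → ℕ → ℂ
z ^ᶜ zero  = 1ᶜ
z ^ᶜ suc k = z *ᶜ (z ^ᶜ k)

-- A formal finite sum of terms c · X₁^k₁ ⋯ Xₙ^kₙ. Exponent vectors may repeat,
-- so polynomials are compared through coeff.
Poly : ℕ → Set
Poly n = List (ℂ × Vec ℕ n)

coeff : ∀ {n} → Poly n → Vec ℕ n → ℂ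
coeff []            e = 0ᶜ
coeff ((c , k) ∷ P) e with Vecₚ.≡-dec ℕₚ._≟_ k e
... | yes _ = c +ᶜ coeff P e
... | no  _ = coeff P e

infix 4 _≈ᴾ_ _∣ᴾ_

_≈ᴾ_ : ∀ {n} → Poly n → Poly n → Set
P ≈ᴾ Q = ∀ e → coeff P e ≃ᶜ coeff Q e

_*ᴾ_ : ∀ {n} → Poly n → Poly n → Poly n
_*ᴾ_ = List.cartesianProductWith λ (c , k) (d , l) → c *ᶜ d , Vec.zipWith ℕ._+_ k l

_∣ᴾ_ : ∀ {n} → Poly n → Poly n → Set
P ∣ᴾ Q = ∃[ R ] Q ≈ᴾ (P *ᴾ R)

eval : ∀ {n} → Poly n → Vec ℂ n → ℂ
eval []            z = 0ᶜ
eval ((c , k) ∷ P) z =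
  c *ᶜ Vec.foldr′ _*ᶜ_ 1ᶜ (Vec.zipWith _^ᶜ_ z k) +ᶜ eval P z

Occurs : ∀ {n} → Vec ℕ n → Poly n → Set
Occurs e P = ¬ (coeff P e ≃ᶜ 0ᶜ)

-- The zero polynomial has no total degree.
HasTotalDegree : ∀ {n} → Poly n → ℕ → Set
HasTotalDegree P d =
  (∃[ e ] (Occurs e P × Vec.sum e ≡ d)) × (∀ e → Occurs e P → Vec.sum e ℕ.≤ d)

-- a₁X₁ + ⋯ + aₙXₙ - 1
linearMinusOne : ∀ {n} → Vec ℚ n → Poly n
linearMinusOne {n} a =
  (fromℚᶜ (- 1ℚ) , Vec.replicate n 0) ∷
  List.tabulate λ i → fromℚᶜ (Vec.lookup a i) , Vec.replicate n 0 Vec.[ i ]≔ 1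

record PrimeSet : Set where
  field
    primes   : List ℕ
    allPrime : ListAll.All Prime primes
    distinct : Unique primes

open PrimeSet public

cardinality : PrimeSet → ℕ
cardinality S = List.length (primes S)

record IsSUnit (S : PrimeSet) (x : ℚ) : Set where
  field
    x≢0         : x ≢ 0ℚ
    numerator   : ∀ p → Prime p → p ∣ ℤ.∣ ↥ x ∣ → p ∈ primes S
    denominator : ∀ p → Prime p → p ∣ ↧ₙ x → p ∈ primes S

IsSolution : ∀ {n} → Vec ℚ n → PrimeSet → Vec ℚ n → Set
IsSolution a S x =
  VecAll.All (IsSUnit S) x × Vec.foldr′ _+_ 0ℚ (Vec.zipWith _*_ a x) ≡ 1ℚ

DegreeAttained : ∀ {n} → Vec ℚ n → PrimeSet → ℕ → Set
DegreeAttained {n} a S d = ∃[ P ]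
  ( HasTotalDegree {n} P d
  × ¬ (linearMinusOne a ∣ᴾ P)
  × (∀ x → IsSolution a S x → eval P (Vec.map fromℚᶜ x) ≃ᶜ 0ᶜ))

-- g = g(a, S). A relation rather than a function, because whether a degree is
-- attained is not decidable by inspection; the least one is unique.
Is-g : ∀ {n} → Vec ℚ n → PrimeSet → ℕ → Set
Is-g a S g = DegreeAttained a S g × (∀ d → DegreeAttained a S d → g ℕ.≤ d)

{-# OPTIONS --safe #-}
-- If S-units u with 1 - u also an S-unit are given, splitting ρ = ρ u + ρ (1 - u)
-- repeatedly, starting from 1, produces a tree-shaped grid of solutions of
-- a₁x₁ + ⋯ + aₙxₙ = 1. When there are more than d such u, Vandermonde matrices show
-- that a polynomial of degree d vanishing on this grid is divisible by
-- a₁X₁ + ⋯ + aₙXₙ - 1, so g(a, S) is at least the number of the u.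
--
-- Many u are found by an argument of Konyagin and Soundararajan. Let A and Q consist
-- of products of primes from two disjoint sets. By Cauchy–Schwarz there are about
-- |Q| |A|² / max Q triples (q, a, c) with a ≡ c mod q and a ≠ c, so many of them share
-- the quotient k = |a - c| / q. For these u = a / c and 1 - u = ± k q / c are S-units
-- once the primes of k are added to S. This yields exp(s^β) values of u for some β > 1/2
-- (here β is about 8/15). Since that exceeds exp(4 s^½) by a wide margin, Chebyshev's
-- lower bound for π suffices, and so do crude bounds for the partial sums of exp and log.
module Submission where

-- Origin of the constants. Let B = 4 ^ f, let the primes lie in (B^15, B^16] in blocks of B^7, and
-- let elements of A and Q take one prime from each of α w and β w blocks. Residue classes modulo q
-- are crowded if |A| exceeds max Q: 7α > 16β. Triples outnumber quotients if 7β + 14α - 16β > 16α -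
-- 15β: α < 3β. Hence 16/7 < α/β < 3, and 5/2 is chosen. As s is B^15 up to a constant factor, a
-- block has fewer primes than √s, so that w = B^8 exceeds √s; the count of solutions is exponential
-- in w, whence 8/15.
--
-- The degree argument is shaped by the undecidable equality of complex numbers: a bound on the
-- total degree only refutes that a higher coefficient is nonzero. So polynomials are never
-- normalised. All algebra consists of exact identities between linear functionals of the rational
-- approximations of index i, and only the conclusions are limits in i. Likewise powers of s and log
-- s are bounded at every partial sum. The slack is so large that even (log s)^(-1/2) may be
-- replaced by a multiple of log s, and 4 - ε by any bound of its absolute value.

open import Defs

-- Arithmetic of the rational approximations.

module Rationals where

  import Algebra.Definitions.RawSemiring
  open import Data.Integer.Base as ℤ using (ℤ; +_)
  import Data.Integer.Properties as ℤₚ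
  import Data.Integer.Tactic.RingSolver as ℤSolver
  open import Data.Nat.Base as ℕ using (ℕ; suc; z≤n; s≤s)
  import Data.Nat.Properties as ℕₚ
  open import Data.Product.Base using (∃-syntax; _,_)
  open import Data.Rational.Base
  open import Data.Rational.Properties
  import Data.Rational.Unnormalised.Base as ℚᵘ
  import Data.Rational.Unnormalised.Properties as ℚᵘₚ
  open import Data.Sum.Base using (inj₁; inj₂)
  open import Level using (0ℓ)
  open import Relation.Binary.PropositionalEquality
  open import Relation.Nullary using (yes; no; contradiction)
  open import Relation.Nullary.Decidable using (dec⇒maybe)
  open import Tactic.RingSolver using (solve-∀)
  open import Tactic.RingSolver.Core.AlmostCommutativeRing
    using (AlmostCommutativeRing; fromCommutativeRing)
  open Algebra.Definitions.RawSemiring +-*-rawSemiring public using (_^_)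

  ℚ-ring : AlmostCommutativeRing 0ℓ 0ℓ
  ℚ-ring = fromCommutativeRing +-*-commutativeRing (λ x → dec⇒maybe (0ℚ ≟ x))

  *-swap : ∀ p q r → p * (q * r) ≡ q * (p * r)
  *-swap = solve-∀ ℚ-ring

  +-interchange : ∀ p q r s → (p + q) + (r + s) ≡ (p + r) + (q + s)
  +-interchange = solve-∀ ℚ-ring

  p≡p-q+q : ∀ p q → p ≡ (p - q) + q
  p≡p-q+q = solve-∀ ℚ-ring

  0≤1 : 0ℚ ≤ 1ℚ
  0≤1 = nonNegative⁻¹ 1ℚ

  0<1 : 0ℚ < 1ℚ
  0<1 = positive⁻¹ 1ℚ

  *-monoˡ : ∀ {r p q} → 0ℚ ≤ r → p ≤ q → r * p ≤ r * q
  *-monoˡ {r} 0≤r = *-monoˡ-≤-nonNeg r {{nonNegative 0≤r}}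

  *-monoʳ : ∀ {r p q} → 0ℚ ≤ r → p ≤ q → p * r ≤ q * r
  *-monoʳ {r} 0≤r = *-monoʳ-≤-nonNeg r {{nonNegative 0≤r}}

  *-mono : ∀ {p q r s} → 0ℚ ≤ r → 0ℚ ≤ q → p ≤ q → r ≤ s → p * r ≤ q * s
  *-mono 0≤r 0≤q p≤q r≤s = ≤-trans (*-monoʳ 0≤r p≤q) (*-monoˡ 0≤q r≤s)

  *-cancelˡ : ∀ {r p q} → 0ℚ < r → r * p ≤ r * q → p ≤ q
  *-cancelˡ {r} 0<r = *-cancelˡ-≤-pos r {{positive 0<r}}

  0≤* : ∀ {p q} → 0ℚ ≤ p → 0ℚ ≤ q → 0ℚ ≤ p * q
  0≤* {p} {q} 0≤p 0≤q = subst (_≤ p * q) (*-zeroʳ p) (*-monoˡ 0≤p 0≤q)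

  0≤+ : ∀ {p q} → 0ℚ ≤ p → 0ℚ ≤ q → 0ℚ ≤ p + q
  0≤+ = +-mono-≤

  p≤p+q : ∀ {p q} → 0ℚ ≤ q → p ≤ p + q
  p≤p+q {p} {q} 0≤q = subst (_≤ p + q) (+-identityʳ p) (+-monoʳ-≤ p 0≤q)

  0≤q-p⇒p≤q : ∀ {p q} → 0ℚ ≤ q - p → p ≤ q
  0≤q-p⇒p≤q {p} {q} h = subst (p ≤_) (eq p q) (p≤p+q h)
    where
    eq : ∀ p q → p + (q - p) ≡ q
    eq = solve-∀ ℚ-ring

  p≤q⇒0≤q-p : ∀ {p q} → p ≤ q → 0ℚ ≤ q - p
  p≤q⇒0≤q-p {p} {q} h = subst (_≤ q - p) (+-inverseʳ p) (+-monoˡ-≤ (- p) h)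

  p≤∣p∣ : ∀ p → p ≤ ∣ p ∣
  p≤∣p∣ p with ≤-total 0ℚ p
  ... | inj₁ 0≤p = ≤-reflexive (sym (0≤p⇒∣p∣≡p 0≤p))
  ... | inj₂ p≤0 = ≤-trans p≤0 (0≤∣p∣ p)

  ∣p∣≤q : ∀ {p q} → p ≤ q → - p ≤ q → ∣ p ∣ ≤ q
  ∣p∣≤q {p} {q} p≤q -p≤q with ∣p∣≡p∨∣p∣≡-p p
  ... | inj₁ e = subst (_≤ q) (sym e) p≤q
  ... | inj₂ e = subst (_≤ q) (sym e) -p≤q

  square-cancel-≤ : ∀ {p q} → 0ℚ ≤ q → p * p ≤ q * q → p ≤ q
  square-cancel-≤ {p} {q} 0≤q h with p ≤? q
  ... | yes p≤q = p≤q
  ... | no  p≰q = *-cancelˡ (≤-<-trans 0≤q q<p) (≤-trans h (*-monoʳ 0≤q (<⇒≤ q<p)))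
    where q<p = ≰⇒> p≰q

  inv-inverse : ∀ {q} → q ≢ 0ℚ → q * inv q ≡ 1ℚ
  inv-inverse {q} q≢0 with q ≟ 0ℚ
  ... | yes q≡0 = contradiction q≡0 q≢0
  ... | no  h   = *-inverseʳ q {{≢-nonZero h}}

  pos⇒≢0 : ∀ {q} → 0ℚ < q → q ≢ 0ℚ
  pos⇒≢0 0<q q≡0 = <-irrefl (sym q≡0) 0<q

  *-nonZero : ∀ {p q} → p ≢ 0ℚ → q ≢ 0ℚ → p * q ≢ 0ℚ
  *-nonZero {p} {q} p≢0 q≢0 pq≡0 = q≢0 (begin
    q  ≡⟨ eq (inv p) p q ⟩
    q * (1ℚ - p * inv p) + inv p * (p * q)  ≡⟨ cong₂ (λ s t → q * (1ℚ - s) + inv p * t) (inv-inverse p≢0) pq≡0 ⟩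
    q * (1ℚ - 1ℚ) + inv p * 0ℚ  ≡⟨ cong₂ _+_ (*-zeroʳ q) (*-zeroʳ (inv p)) ⟩
    0ℚ  ∎)
    where
    open ≡-Reasoning
    eq : ∀ i p q → q ≡ q * (1ℚ - p * i) + i * (p * q)
    eq = solve-∀ ℚ-ring

  inv-pos : ∀ {q} → 0ℚ < q → 0ℚ < inv q
  inv-pos {q} 0<q with q ≟ 0ℚ
  ... | yes q≡0 = contradiction q≡0 (pos⇒≢0 0<q)
  ... | no  h   = positive⁻¹ _ {{1/pos⇒pos q {{positive 0<q}}}}

  *-inv : ∀ {q} → 0ℚ < q → q * inv q ≡ 1ℚ
  *-inv 0<q = inv-inverse (pos⇒≢0 0<q)

  /1-+ : ∀ i j → (i ℤ.+ j) / 1 ≡ i / 1 + j / 1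
  /1-+ i j = toℚᵘ-injective (begin
    toℚᵘ ((i ℤ.+ j) / 1)               ≈⟨ toℚᵘ-fromℚᵘ (ℚᵘ.mkℚᵘ (i ℤ.+ j) 0) ⟩
    ℚᵘ.mkℚᵘ (i ℤ.+ j) 0                ≈⟨ ℚᵘ.*≡* (eq i j) ⟩
    ℚᵘ.mkℚᵘ i 0 ℚᵘ.+ ℚᵘ.mkℚᵘ j 0       ≈⟨ ℚᵘₚ.+-cong (toℚᵘ-fromℚᵘ (ℚᵘ.mkℚᵘ i 0)) (toℚᵘ-fromℚᵘ (ℚᵘ.mkℚᵘ j 0)) ⟨
    toℚᵘ (i / 1) ℚᵘ.+ toℚᵘ (j / 1)     ≈⟨ toℚᵘ-homo-+ (i / 1) (j / 1) ⟨
    toℚᵘ (i / 1 + j / 1)  ∎)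
    where
    open ℚᵘₚ.≃-Reasoning
    eq : ∀ i j → (i ℤ.+ j) ℤ.* + 1 ≡ (i ℤ.* + 1 ℤ.+ j ℤ.* + 1) ℤ.* + 1
    eq = ℤSolver.solve-∀

  /1-* : ∀ i j → (i ℤ.* j) / 1 ≡ (i / 1) * (j / 1)
  /1-* i j = toℚᵘ-injective (begin
    toℚᵘ ((i ℤ.* j) / 1)               ≈⟨ toℚᵘ-fromℚᵘ (ℚᵘ.mkℚᵘ (i ℤ.* j) 0) ⟩
    ℚᵘ.mkℚᵘ i 0 ℚᵘ.* ℚᵘ.mkℚᵘ j 0       ≈⟨ ℚᵘₚ.*-cong (toℚᵘ-fromℚᵘ (ℚᵘ.mkℚᵘ i 0)) (toℚᵘ-fromℚᵘ (ℚᵘ.mkℚᵘ j 0)) ⟨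
    toℚᵘ (i / 1) ℚᵘ.* toℚᵘ (j / 1)     ≈⟨ toℚᵘ-homo-* (i / 1) (j / 1) ⟨
    toℚᵘ ((i / 1) * (j / 1))  ∎)
    where open ℚᵘₚ.≃-Reasoning

  fromℕ-+ : ∀ m n → fromℕ (m ℕ.+ n) ≡ fromℕ m + fromℕ n
  fromℕ-+ m n = /1-+ (+ m) (+ n)

  fromℕ-suc : ∀ n → fromℕ (suc n) ≡ 1ℚ + fromℕ n
  fromℕ-suc = fromℕ-+ 1

  fromℕ-* : ∀ m n → fromℕ (m ℕ.* n) ≡ fromℕ m * fromℕ n
  fromℕ-* m n = trans (cong (_/ 1) (ℤₚ.pos-* m n)) (/1-* (+ m) (+ n))

  0≤fromℕ : ∀ n → 0ℚ ≤ fromℕ n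
  0≤fromℕ n = nonNegative⁻¹ (fromℕ n) {{normalize-nonNeg n 1}}

  0<fromℕ : ∀ n .{{_ : ℕ.NonZero n}} → 0ℚ < fromℕ n
  0<fromℕ (suc n) = positive⁻¹ (fromℕ (suc n)) {{normalize-pos (suc n) 1}}

  fromℕ-mono : ∀ {m n} → m ℕ.≤ n → fromℕ m ≤ fromℕ n
  fromℕ-mono {n = n} z≤n = 0≤fromℕ n
  fromℕ-mono (s≤s {m} {n} m≤n) =
    subst₂ _≤_ (sym (fromℕ-suc m)) (sym (fromℕ-suc n)) (+-monoʳ-≤ 1ℚ (fromℕ-mono m≤n))

  archimedean : ∀ q → ∃[ N ] q ≤ fromℕ N
  archimedean q = N , toℚᵘ-cancel-≤ (ℚᵘₚ.≤-respʳ-≃ (ℚᵘₚ.≃-sym (toℚᵘ-fromℚᵘ (ℚᵘ.mkℚᵘ (+ N) 0))) (le q))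
    where
    N = ℤ.∣ ↥ q ∣
    ≤abs : ∀ i → i ℤ.≤ + ℤ.∣ i ∣
    ≤abs (+ n)        = ℤₚ.≤-refl
    ≤abs (ℤ.-[1+ n ]) = ℤ.-≤+
    le : ∀ q → toℚᵘ q ℚᵘ.≤ ℚᵘ.mkℚᵘ (+ ℤ.∣ ↥ q ∣) 0
    le (mkℚ i d _) = ℚᵘ.*≤* (ℤₚ.≤-trans
      (ℤₚ.≤-reflexive (ℤₚ.*-identityʳ i))
      (ℤₚ.≤-trans (≤abs i) (subst (ℤ._≤ + ℤ.∣ i ∣ ℤ.* + suc d) (ℤₚ.*-identityʳ (+ ℤ.∣ i ∣))
        (ℤₚ.*-monoˡ-≤-nonNeg (+ ℤ.∣ i ∣) (ℤ.+≤+ (s≤s z≤n))))))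

  unit : ℕ → ℚ
  unit k = + 1 / suc k

  fromℕ*unit : ∀ k → fromℕ (suc k) * unit k ≡ 1ℚ
  fromℕ*unit k = toℚᵘ-injective (begin
    toℚᵘ (fromℕ (suc k) * unit k)               ≈⟨ toℚᵘ-homo-* (fromℕ (suc k)) (unit k) ⟩
    toℚᵘ (fromℕ (suc k)) ℚᵘ.* toℚᵘ (unit k)     ≈⟨ ℚᵘₚ.*-cong (toℚᵘ-fromℚᵘ (ℚᵘ.mkℚᵘ (+ suc k) 0)) (toℚᵘ-fromℚᵘ (ℚᵘ.mkℚᵘ (+ 1) k)) ⟩
    ℚᵘ.mkℚᵘ (+ suc k) 0 ℚᵘ.* ℚᵘ.mkℚᵘ (+ 1) k    ≈⟨ ℚᵘ.*≡* (eq k) ⟩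
    toℚᵘ 1ℚ  ∎)
    where
    open ℚᵘₚ.≃-Reasoning
    eq : ∀ k → (+ suc k ℤ.* + 1) ℤ.* + 1 ≡ + 1 ℤ.* (+ (1 ℕ.* suc k))
    eq k = trans (ℤₚ.*-identityʳ (+ suc k ℤ.* + 1)) (trans (ℤₚ.*-identityʳ (+ suc k))
      (trans (cong +_ (sym (ℕₚ.*-identityˡ (suc k)))) (sym (ℤₚ.*-identityˡ (+ (1 ℕ.* suc k))))))

  0<unit : ∀ k → 0ℚ < unit k
  0<unit k = positive⁻¹ (unit k) {{normalize-pos 1 (suc k)}}

  0≤unit : ∀ k → 0ℚ ≤ unit k
  0≤unit k = <⇒≤ (0<unit k)

  ∣p*q∣≤ : ∀ {p q r s} → ∣ p ∣ ≤ r → ∣ q ∣ ≤ s → ∣ p * q ∣ ≤ r * s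
  ∣p*q∣≤ {p} {q} {r} {s} hp hq = subst (_≤ r * s) (sym (∣p*q∣≡∣p∣*∣q∣ p q))
    (*-mono (0≤∣p∣ q) (≤-trans (0≤∣p∣ p) hp) hp hq)

-- Upper bounds for exp, log and real powers, uniform in the partial sums.

module LowerBounds where

  open Rationals
  import Data.Integer.Base as ℤ
  open import Data.Nat.Base as ℕ using (ℕ; zero; suc; z≤n; s≤s; _!; NonTrivial)
  import Data.Nat.Properties as ℕₚ
  import Data.Nat.Tactic.RingSolver as ℕSolver
  open import Data.Product.Base using (∃-syntax; _,_; proj₁; proj₂)
  open import Data.Rational.Base
  open import Data.Rational.Properties
  open import Data.Sum.Base using (inj₁; inj₂)
  open import Relation.Binary.PropositionalEquality
  open import Relation.Nullary using (yes; no; contradiction)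
  open import Tactic.RingSolver using (solve-∀)

  -- Exponential sums

  ^-nonNeg : ∀ {q} → 0ℚ ≤ q → ∀ k → 0ℚ ≤ q ^ k
  ^-nonNeg 0≤q zero    = 0≤1
  ^-nonNeg 0≤q (suc k) = 0≤* 0≤q (^-nonNeg 0≤q k)

  ∣^∣≤ : ∀ {q b} → ∣ q ∣ ≤ b → ∀ k → ∣ q ^ k ∣ ≤ b ^ k
  ∣^∣≤ h zero    = ≤-refl
  ∣^∣≤ h (suc k) = ∣p*q∣≤ h (∣^∣≤ h k)

  ∣psum∣≤ : ∀ {u v} → (∀ k → ∣ u k ∣ ≤ v k) → ∀ n → ∣ psum u n ∣ ≤ psum v n
  ∣psum∣≤ h zero    = ≤-refl
  ∣psum∣≤ {u} {v} h (suc n) = ≤-trans (∣p+q∣≤∣p∣+∣q∣ (psum u n) (u n)) (+-mono-≤ (∣psum∣≤ h n) (h n))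

  psum-nonNeg : ∀ {u} → (∀ k → 0ℚ ≤ u k) → ∀ n → 0ℚ ≤ psum u n
  psum-nonNeg h zero    = ≤-refl
  psum-nonNeg h (suc n) = 0≤+ (psum-nonNeg h n) (h n)

  psum-mono-length : ∀ {u} → (∀ k → 0ℚ ≤ u k) → ∀ {m n} → m ℕ.≤ n → psum u m ≤ psum u n
  psum-mono-length h {n = zero} z≤n = ≤-refl
  psum-mono-length {u} h {m} {suc n} m≤1+n with ℕₚ.m≤n⇒m<n∨m≡n m≤1+n
  ... | inj₁ (s≤s m≤n) = ≤-trans (psum-mono-length h m≤n) (p≤p+q (h n))
  ... | inj₂ refl      = ≤-refl

  expSum : ℚ → ℕ → ℚ
  expSum q = psum (λ k → expTerm k q)

  1/! : ℕ → ℚ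
  1/! k = (ℤ.+ 1 / (k !)) {{k ℕₚ.!≢0}}

  0≤1/! : ∀ k → 0ℚ ≤ 1/! k
  0≤1/! k = nonNegative⁻¹ (1/! k) {{normalize-nonNeg 1 (k !) {{k ℕₚ.!≢0}}}}

  fromℕ*1/ : ∀ n .{{_ : ℕ.NonZero n}} → fromℕ n * (ℤ.+ 1 / n) ≡ 1ℚ
  fromℕ*1/ (suc n) = fromℕ*unit n

  fromℕ*1/!-suc : ∀ k → fromℕ (suc k) * 1/! (suc k) ≡ 1/! k
  fromℕ*1/!-suc k = begin
    fromℕ (suc k) * 1/! (suc k)  ≡⟨ *-identityʳ _ ⟨
    fromℕ (suc k) * 1/! (suc k) * 1ℚ  ≡⟨ cong (fromℕ (suc k) * 1/! (suc k) *_) (fromℕ*1/ (k !) {{k ℕₚ.!≢0}}) ⟨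
    fromℕ (suc k) * 1/! (suc k) * (fromℕ (k !) * 1/! k)  ≡⟨ eq (fromℕ (suc k)) (1/! (suc k)) (fromℕ (k !)) (1/! k) ⟩
    (fromℕ (suc k) * fromℕ (k !)) * 1/! (suc k) * 1/! k  ≡⟨ cong (λ t → t * 1/! (suc k) * 1/! k) (fromℕ-* (suc k) (k !)) ⟨
    fromℕ (suc k !) * 1/! (suc k) * 1/! k  ≡⟨ cong (_* 1/! k) (fromℕ*1/ (suc k !) {{suc k ℕₚ.!≢0}}) ⟩
    1ℚ * 1/! k  ≡⟨ *-identityˡ (1/! k) ⟩
    1/! k  ∎
    where
    open ≡-Reasoning
    eq : ∀ a b c d → a * b * (c * d) ≡ (a * c) * b * d
    eq = solve-∀ ℚ-ring

  expTerm-nonNeg : ∀ {q} → 0ℚ ≤ q → ∀ k → 0ℚ ≤ expTerm k q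
  expTerm-nonNeg 0≤q k = 0≤* (^-nonNeg 0≤q k) (0≤1/! k)

  expSum-nonNeg : ∀ {q} → 0ℚ ≤ q → ∀ n → 0ℚ ≤ expSum q n
  expSum-nonNeg 0≤q = psum-nonNeg (expTerm-nonNeg 0≤q)

  ∣expSum∣≤ : ∀ {q b} → ∣ q ∣ ≤ b → ∀ n → ∣ expSum q n ∣ ≤ expSum b n
  ∣expSum∣≤ {q} {b} h = ∣psum∣≤ λ k → ∣p*q∣≤ (∣^∣≤ h k) (≤-reflexive (0≤p⇒∣p∣≡p (0≤1/! k)))

  expSum-0 : ∀ n → expSum 0ℚ n ≤ 1ℚ
  expSum-0 zero          = 0≤1
  expSum-0 (suc zero)    = ≤-refl
  expSum-0 (suc (suc n)) = subst (_≤ 1ℚ) (sym (trans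
    (cong (expSum 0ℚ (suc n) +_) (trans (cong (_* 1/! (suc n)) (*-zeroˡ (0ℚ ^ n))) (*-zeroˡ (1/! (suc n)))))
    (+-identityʳ (expSum 0ℚ (suc n))))) (expSum-0 (suc n))

  -- Bernoulli: p ^ k ≥ (p + x) ^ k - k x (p + x) ^ (k - 1).
  bernoulli : ∀ {p x} → 0ℚ ≤ p → 0ℚ ≤ x → ∀ k →
    (p + x) ^ suc k ≤ p ^ suc k + fromℕ (suc k) * (x * (p + x) ^ k)
  bernoulli {p} {x} 0≤p 0≤x zero = ≤-reflexive (eq p x)
    where
    eq : ∀ p x → (p + x) * 1ℚ ≡ p * 1ℚ + 1ℚ * (x * 1ℚ)
    eq = solve-∀ ℚ-ring
  bernoulli {p} {x} 0≤p 0≤x (suc k) = begin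
    (p + x) * Pₖ₊₁  ≡⟨ eq₁ p x Pₖ₊₁ ⟩
    p * Pₖ₊₁ + x * Pₖ₊₁  ≤⟨ +-monoˡ-≤ (x * Pₖ₊₁) (*-monoˡ 0≤p (bernoulli 0≤p 0≤x k)) ⟩
    p * (p ^ suc k + N * (x * Pₖ)) + x * Pₖ₊₁  ≡⟨ eq₂ p x N (p ^ suc k) Pₖ Pₖ₊₁ ⟩
    p * p ^ suc k + (N * (x * (p * Pₖ)) + x * Pₖ₊₁)  ≤⟨ +-monoʳ-≤ (p * p ^ suc k) (+-monoˡ-≤ (x * Pₖ₊₁)
        (*-monoˡ (0≤fromℕ (suc k)) (*-monoˡ 0≤x (*-monoʳ {Pₖ} {p} (^-nonNeg (0≤+ 0≤p 0≤x) k) (p≤p+q 0≤x))))) ⟩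
    p * p ^ suc k + (N * (x * Pₖ₊₁) + x * Pₖ₊₁)  ≡⟨ eq₃ (p * p ^ suc k) N (x * Pₖ₊₁) ⟩
    p * p ^ suc k + (1ℚ + N) * (x * Pₖ₊₁)  ≡⟨ cong (λ t → p * p ^ suc k + t * (x * Pₖ₊₁)) (fromℕ-suc (suc k)) ⟨
    p * p ^ suc k + fromℕ (suc (suc k)) * (x * Pₖ₊₁)  ∎
    where
    open ≤-Reasoning
    Pₖ = (p + x) ^ k ; Pₖ₊₁ = (p + x) ^ suc k ; N = fromℕ (suc k)
    eq₁ : ∀ p x P → (p + x) * P ≡ p * P + x * P
    eq₁ = solve-∀ ℚ-ring
    eq₂ : ∀ p x N q P Q → p * (q + N * (x * P)) + x * Q ≡ p * q + (N * (x * (p * P)) + x * Q)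
    eq₂ = solve-∀ ℚ-ring
    eq₃ : ∀ a N b → a + (N * b + b) ≡ a + (1ℚ + N) * b
    eq₃ = solve-∀ ℚ-ring

  -- `bernoulli` divided by `(k + 1)!`, where `(k + 1) / (k + 1)!` cancels to `1 / k!`.
  expTerm-+ : ∀ {p x} → 0ℚ ≤ p → 0ℚ ≤ x → ∀ k →
    expTerm (suc k) (p + x) ≤ expTerm (suc k) p + x * expTerm k (p + x)
  expTerm-+ {p} {x} 0≤p 0≤x k = begin
    (p + x) ^ suc k * 1/! (suc k)  ≤⟨ *-monoʳ (0≤1/! (suc k)) (bernoulli 0≤p 0≤x k) ⟩
    (p ^ suc k + fromℕ (suc k) * (x * (p + x) ^ k)) * 1/! (suc k)  ≡⟨ eq (p ^ suc k) (fromℕ (suc k)) x ((p + x) ^ k) (1/! (suc k)) ⟩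
    expTerm (suc k) p + x * ((p + x) ^ k * (fromℕ (suc k) * 1/! (suc k)))  ≡⟨ cong (λ t → expTerm (suc k) p + x * ((p + x) ^ k * t)) (fromℕ*1/!-suc k) ⟩
    expTerm (suc k) p + x * expTerm k (p + x)  ∎
    where
    open ≤-Reasoning
    eq : ∀ a n x b i → (a + n * (x * b)) * i ≡ a * i + x * (b * (n * i))
    eq = solve-∀ ℚ-ring

  -- The mean value estimate `exp (p + x) - exp p ≤ x exp (p + x)` for partial sums. Since
  -- `expTerm-+` links consecutive terms, the induction in `shifted` gives one term fewer on the
  -- right; the missing term is nonnegative.
  expSum-step : ∀ {p x} → 0ℚ ≤ p → 0ℚ ≤ x → ∀ n → expSum (p + x) n ≤ expSum p n + x * expSum (p + x) n
  expSum-step {p} {x} 0≤p 0≤x zero = ≤-reflexive (eq x)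
    where
    eq : ∀ x → 0ℚ ≡ 0ℚ + x * 0ℚ
    eq = solve-∀ ℚ-ring
  expSum-step {p} {x} 0≤p 0≤x (suc n) = ≤-trans (shifted n)
    (+-monoʳ-≤ (expSum p (suc n)) (*-monoˡ 0≤x (p≤p+q (expTerm-nonNeg (0≤+ 0≤p 0≤x) n))))
    where
    open ≤-Reasoning
    eq₀ : ∀ x → 0ℚ + 1ℚ * 1ℚ ≡ 0ℚ + 1ℚ * 1ℚ + x * 0ℚ
    eq₀ = solve-∀ ℚ-ring
    eq : ∀ a x b c d → (a + x * b) + (c + x * d) ≡ (a + c) + x * (b + d)
    eq = solve-∀ ℚ-ring
    shifted : ∀ n → expSum (p + x) (suc n) ≤ expSum p (suc n) + x * expSum (p + x) n
    shifted zero    = ≤-reflexive (eq₀ x)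
    shifted (suc n) = begin
      expSum (p + x) (suc n) + expTerm (suc n) (p + x)  ≤⟨ +-mono-≤ (shifted n) (expTerm-+ 0≤p 0≤x n) ⟩
      (expSum p (suc n) + x * expSum (p + x) n) + (expTerm (suc n) p + x * expTerm n (p + x))
        ≡⟨ eq (expSum p (suc n)) x (expSum (p + x) n) (expTerm (suc n) p) (expTerm n (p + x)) ⟩
      expSum p (suc (suc n)) + x * expSum (p + x) (suc n)  ∎

  -- exp (p + x) ≤ exp p / (1 - x), which replaces the functional equation.
  expSum-+ : ∀ {p x r} → 0ℚ ≤ p → 0ℚ ≤ x → 0ℚ ≤ r → 1ℚ ≤ r * (1ℚ - x) → ∀ n →
    expSum (p + x) n ≤ r * expSum p n
  expSum-+ {p} {x} {r} 0≤p 0≤x 0≤r h n = begin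
    P  ≡⟨ *-identityˡ P ⟨
    1ℚ * P  ≤⟨ *-monoʳ (expSum-nonNeg (0≤+ 0≤p 0≤x) n) h ⟩
    r * (1ℚ - x) * P  ≡⟨ eq₁ r x P ⟩
    r * (P - x * P)  ≤⟨ *-monoˡ 0≤r (+-monoˡ-≤ (- (x * P)) (expSum-step 0≤p 0≤x n)) ⟩
    r * (Q + x * P - x * P)  ≡⟨ eq₂ r Q (x * P) ⟩
    r * Q  ∎
    where
    open ≤-Reasoning
    P = expSum (p + x) n ; Q = expSum p n
    eq₁ : ∀ r x P → r * (1ℚ - x) * P ≡ r * (P - x * P)
    eq₁ = solve-∀ ℚ-ring
    eq₂ : ∀ r Q t → r * (Q + t - t) ≡ r * Q
    eq₂ = solve-∀ ℚ-ring

  expSum-½ : ∀ {p} → 0ℚ ≤ p → ∀ n → expSum (p + ½) n ≤ fromℕ 2 * expSum p n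
  expSum-½ 0≤p = expSum-+ 0≤p (nonNegative⁻¹ ½) (0≤fromℕ 2) ≤-refl

  -- `expSum-+` requires `x < 1`, so the step of length 1 is split into two of length ½, each
  -- costing a factor 2. This is where the base 4 in place of e comes from.
  expSum-1+ : ∀ {p} → 0ℚ ≤ p → ∀ n → expSum (1ℚ + p) n ≤ fromℕ 4 * expSum p n
  expSum-1+ {p} 0≤p n = begin
    expSum (1ℚ + p) n  ≡⟨ cong (λ t → expSum t n) (eq p) ⟩
    expSum (p + ½ + ½) n  ≤⟨ expSum-½ (0≤+ 0≤p (nonNegative⁻¹ ½)) n ⟩
    fromℕ 2 * expSum (p + ½) n  ≤⟨ *-monoˡ (0≤fromℕ 2) (expSum-½ 0≤p n) ⟩
    fromℕ 2 * (fromℕ 2 * expSum p n)  ≡⟨ *-assoc (fromℕ 2) (fromℕ 2) (expSum p n) ⟨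
    fromℕ 4 * expSum p n  ∎
    where
    open ≤-Reasoning
    eq : ∀ p → 1ℚ + p ≡ p + ½ + ½
    eq p = trans (+-comm 1ℚ p) (sym (+-assoc p ½ ½))

  expSum-fromℕ : ∀ K n → expSum (fromℕ K) n ≤ fromℕ (4 ℕ.^ K)
  expSum-fromℕ zero    n = expSum-0 n
  expSum-fromℕ (suc K) n = begin
    expSum (fromℕ (suc K)) n  ≡⟨ cong (λ t → expSum t n) (fromℕ-suc K) ⟩
    expSum (1ℚ + fromℕ K) n  ≤⟨ expSum-1+ (0≤fromℕ K) n ⟩
    fromℕ 4 * expSum (fromℕ K) n  ≤⟨ *-monoˡ (0≤fromℕ 4) (expSum-fromℕ K n) ⟩
    fromℕ 4 * fromℕ (4 ℕ.^ K)  ≡⟨ fromℕ-* 4 (4 ℕ.^ K) ⟨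
    fromℕ (4 ℕ.^ suc K)  ∎
    where open ≤-Reasoning

  -- Logarithm sums

  artanhSum : ℚ → ℕ → ℚ
  artanhSum z = psum (λ k → artanhTerm k z)

  ∣artanhSum∣≤ : ∀ {z b} → ∣ z ∣ ≤ b → ∀ n → ∣ artanhSum z n ∣ ≤ artanhSum b n
  ∣artanhSum∣≤ h = ∣psum∣≤ λ k →
    ∣p*q∣≤ (∣^∣≤ h (suc (2 ℕ.* k))) (≤-reflexive (0≤p⇒∣p∣≡p (0≤unit (2 ℕ.* k))))

  unit-antitone : ∀ {m n} → m ℕ.≤ n → unit n ≤ unit m
  unit-antitone {m} {n} m≤n = *-cancelˡ (0<fromℕ (suc n)) (*-cancelˡ (0<fromℕ (suc m)) (begin
    M * (N * unit n)  ≡⟨ cong (M *_) (fromℕ*unit n) ⟩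
    M * 1ℚ  ≤⟨ *-monoʳ 0≤1 (fromℕ-mono (s≤s m≤n)) ⟩
    N * 1ℚ  ≡⟨ cong (N *_) (fromℕ*unit m) ⟨
    N * (M * unit m)  ≡⟨ *-swap N M (unit m) ⟩
    M * (N * unit m)  ∎))
    where
    open ≤-Reasoning
    M = fromℕ (suc m) ; N = fromℕ (suc n)

  -- ½ log s up to a bounded error.
  oddHarmonic : ℕ → ℚ
  oddHarmonic = psum (λ k → unit (2 ℕ.* k))

  0≤oddHarmonic : ∀ s → 0ℚ ≤ oddHarmonic s
  0≤oddHarmonic = psum-nonNeg (λ k → 0≤unit (2 ℕ.* k))

  -- Each of the `m` new terms is at most `1 / (2 m + 1)`, and together they stay below ½. So
  -- doubling `s` adds at most 1 to `2 * oddHarmonic s`, in the role of `log 2 ≤ 1`.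
  oddHarmonic-double : ∀ m → oddHarmonic (m ℕ.+ m) ≤ oddHarmonic m + ½
  oddHarmonic-double m = ≤-trans (partial m) (+-monoʳ-≤ (oddHarmonic m) (begin
    fromℕ m * unit (2 ℕ.* m)  ≡⟨ eq (fromℕ m * unit (2 ℕ.* m)) ⟩
    ½ * (fromℕ 2 * (fromℕ m * unit (2 ℕ.* m))) ≡⟨ cong (½ *_) (trans (sym (*-assoc (fromℕ 2) (fromℕ m) (unit (2 ℕ.* m)))) (cong (_* unit (2 ℕ.* m)) (sym (fromℕ-* 2 m)))) ⟩
    ½ * (fromℕ (2 ℕ.* m) * unit (2 ℕ.* m))  ≤⟨ *-monoˡ (nonNegative⁻¹ ½) (*-monoʳ (0≤unit (2 ℕ.* m)) (fromℕ-mono (ℕₚ.n≤1+n (2 ℕ.* m)))) ⟩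
    ½ * (fromℕ (suc (2 ℕ.* m)) * unit (2 ℕ.* m)) ≡⟨ cong (½ *_) (fromℕ*unit (2 ℕ.* m)) ⟩
    ½ * 1ℚ  ≡⟨ *-identityʳ ½ ⟩
    ½  ∎))
    where
    open ≤-Reasoning
    eq : ∀ a → a ≡ ½ * (fromℕ 2 * a)
    eq a = trans (sym (*-identityˡ a)) (*-assoc ½ (fromℕ 2) a)
    partial : ∀ j → oddHarmonic (j ℕ.+ m) ≤ oddHarmonic m + fromℕ j * unit (2 ℕ.* m)
    partial zero    = ≤-reflexive (eq₀ (oddHarmonic m) (unit (2 ℕ.* m)))
      where
      eq₀ : ∀ a b → a ≡ a + 0ℚ * b
      eq₀ = solve-∀ ℚ-ring
    partial (suc j) = begin
      oddHarmonic (j ℕ.+ m) + unit (2 ℕ.* (j ℕ.+ m))  ≤⟨ +-mono-≤ (partial j) (unit-antitone (ℕₚ.*-monoʳ-≤ 2 (ℕₚ.m≤n+m m j))) ⟩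
      oddHarmonic m + fromℕ j * unit (2 ℕ.* m) + unit (2 ℕ.* m)  ≡⟨ eq₁ (oddHarmonic m) (fromℕ j) (unit (2 ℕ.* m)) ⟩
      oddHarmonic m + (1ℚ + fromℕ j) * unit (2 ℕ.* m)  ≡⟨ cong (λ t → oddHarmonic m + t * unit (2 ℕ.* m)) (fromℕ-suc j) ⟨
      oddHarmonic m + fromℕ (suc j) * unit (2 ℕ.* m)  ∎
      where
      eq₁ : ∀ a j u → a + j * u + u ≡ a + (1ℚ + j) * u
      eq₁ = solve-∀ ℚ-ring

  oddHarmonic-2^ : ∀ L → fromℕ 2 * oddHarmonic (2 ℕ.^ L) ≤ fromℕ (2 ℕ.+ L)
  oddHarmonic-2^ zero    = ≤-refl
  oddHarmonic-2^ (suc L) = begin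
    fromℕ 2 * oddHarmonic (2 ℕ.^ suc L)  ≡⟨ cong (λ t → fromℕ 2 * oddHarmonic (2 ℕ.^ L ℕ.+ t)) (ℕₚ.+-identityʳ (2 ℕ.^ L)) ⟩
    fromℕ 2 * oddHarmonic (2 ℕ.^ L ℕ.+ 2 ℕ.^ L)  ≤⟨ *-monoˡ (0≤fromℕ 2) (oddHarmonic-double (2 ℕ.^ L)) ⟩
    fromℕ 2 * (oddHarmonic (2 ℕ.^ L) + ½)  ≡⟨ *-distribˡ-+ (fromℕ 2) (oddHarmonic (2 ℕ.^ L)) ½ ⟩
    fromℕ 2 * oddHarmonic (2 ℕ.^ L) + 1ℚ  ≤⟨ +-monoˡ-≤ 1ℚ (oddHarmonic-2^ L) ⟩
    fromℕ (2 ℕ.+ L) + 1ℚ  ≡⟨ +-comm (fromℕ (2 ℕ.+ L)) 1ℚ ⟩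
    1ℚ + fromℕ (2 ℕ.+ L)  ≡⟨ fromℕ-suc (2 ℕ.+ L) ⟨
    fromℕ (3 ℕ.+ L)  ≡⟨ cong fromℕ (ℕₚ.+-suc 2 L) ⟨
    fromℕ (2 ℕ.+ suc L)  ∎
    where open ≤-Reasoning

  -- From `z ^ (2 k + 2) ≤ z ^ (2 k + 1)` one has `z ^ (2 k) (1 - z) ≤ z ^ (2 k) - z ^ (2 k +
  -- 2)`, which telescopes to `1 - z ^ (2 n)`.
  evenPowers-geometric : ∀ {z} → 0ℚ ≤ z → z ≤ 1ℚ → ∀ n →
    psum (λ k → z ^ (2 ℕ.* k)) n * (1ℚ - z) ≤ 1ℚ
  evenPowers-geometric {z} 0≤z z≤1 n = ≤-trans (bound n)
    (0≤q-p⇒p≤q (subst (0ℚ ≤_) (eq (z ^ (2 ℕ.* n))) (^-nonNeg 0≤z (2 ℕ.* n))))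
    where
    open ≤-Reasoning
    G = psum (λ k → z ^ (2 ℕ.* k))
    eq : ∀ a → a ≡ 1ℚ - (1ℚ - a)
    eq = solve-∀ ℚ-ring
    eq₀ : ∀ z → 0ℚ * (1ℚ - z) ≡ 1ℚ - 1ℚ
    eq₀ = solve-∀ ℚ-ring
    eq₁ : ∀ g a z → (g + a) * (1ℚ - z) ≡ g * (1ℚ - z) + (a - z * a)
    eq₁ = solve-∀ ℚ-ring
    eq₂ : ∀ a z → (1ℚ - a) + (a - z * (z * a)) ≡ 1ℚ - z * (z * a)
    eq₂ = solve-∀ ℚ-ring
    z*≤ : ∀ {a} → 0ℚ ≤ a → z * a ≤ a
    z*≤ {a} 0≤a = subst (z * a ≤_) (*-identityˡ a) (*-monoʳ 0≤a z≤1)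
    bound : ∀ n → G n * (1ℚ - z) ≤ 1ℚ - z ^ (2 ℕ.* n)
    bound zero    = ≤-reflexive (eq₀ z)
    bound (suc n) = begin
      (G n + a) * (1ℚ - z)  ≡⟨ eq₁ (G n) a z ⟩
      G n * (1ℚ - z) + (a - z * a)  ≤⟨ +-mono-≤ (bound n) (+-monoʳ-≤ a (neg-antimono-≤ (z*≤ (0≤* 0≤z 0≤a)))) ⟩
      (1ℚ - a) + (a - z * (z * a))  ≡⟨ eq₂ a z ⟩
      1ℚ - z ^ suc (suc (2 ℕ.* n))  ≡⟨ cong (λ t → 1ℚ - z ^ t) (ℕₚ.*-suc 2 n) ⟨
      1ℚ - z ^ (2 ℕ.* suc n)  ∎
      where
      a = z ^ (2 ℕ.* n)
      0≤a = ^-nonNeg 0≤z (2 ℕ.* n)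

  -- The series is cut at `X`. For `k < X` the powers of `z` are at most 1, which gives
  -- `oddHarmonic X`. For `k ≥ X` the factor `1 / (2 k + 1)` is at most `1 / (2 X + 1)`, and the
  -- geometric sum is at most `1 / (1 - z) ≤ (X + 1) / 2`, so the tail is below ½ however many terms
  -- are taken.
  artanhSum≤oddHarmonic : ∀ X {z} → 0ℚ ≤ z → z ≤ 1ℚ - fromℕ 2 * unit X → ∀ n →
    artanhSum z n ≤ oddHarmonic X + ½
  artanhSum≤oddHarmonic X {z} 0≤z z≤ n = begin
    artanhSum z n  ≤⟨ split n ⟩
    psum c n + unit (2 ℕ.* X) * G n  ≤⟨ +-mono-≤ (truncated n) (begin
        unit (2 ℕ.* X) * G n  ≤⟨ *-monoˡ (0≤unit (2 ℕ.* X)) G≤ ⟩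
        unit (2 ℕ.* X) * (½ * fromℕ (suc X))  ≤⟨ *-monoˡ (0≤unit (2 ℕ.* X)) (*-monoˡ (nonNegative⁻¹ ½) (fromℕ-mono (s≤s (ℕₚ.m≤n*m X 2)))) ⟩
        unit (2 ℕ.* X) * (½ * fromℕ (suc (2 ℕ.* X))) ≡⟨ eq₂ (unit (2 ℕ.* X)) ½ (fromℕ (suc (2 ℕ.* X))) ⟩
        ½ * (fromℕ (suc (2 ℕ.* X)) * unit (2 ℕ.* X)) ≡⟨ cong (½ *_) (fromℕ*unit (2 ℕ.* X)) ⟩
        ½ * 1ℚ  ≡⟨ *-identityʳ ½ ⟩
        ½  ∎) ⟩
    oddHarmonic X + ½  ∎
    where
    open ≤-Reasoning
    eq₂ : ∀ a b c → a * (b * c) ≡ b * (c * a)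
    eq₂ = solve-∀ ℚ-ring
    G = psum (λ k → z ^ (2 ℕ.* k))
    c : ℕ → ℚ
    c k with k ℕₚ.<? X
    ... | yes _ = unit (2 ℕ.* k)
    ... | no  _ = 0ℚ
    z≤1 : z ≤ 1ℚ
    z≤1 = ≤-trans z≤ (0≤q-p⇒p≤q (subst (0ℚ ≤_) (eq (fromℕ 2 * unit X)) (0≤* (0≤fromℕ 2) (0≤unit X))))
      where
      eq : ∀ a → a ≡ 1ℚ - (1ℚ - a)
      eq = solve-∀ ℚ-ring
    0≤power : ∀ k → 0ℚ ≤ z ^ k
    0≤power = ^-nonNeg 0≤z
    power≤1 : ∀ k → z ^ k ≤ 1ℚ
    power≤1 zero    = ≤-refl
    power≤1 (suc k) = *-mono (0≤power k) 0≤1 z≤1 (power≤1 k)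
    term : ∀ k → artanhTerm k z ≤ c k + unit (2 ℕ.* X) * z ^ (2 ℕ.* k)
    term k with k ℕₚ.<? X
    ... | yes _ = begin
      z ^ suc (2 ℕ.* k) * unit (2 ℕ.* k)  ≤⟨ *-monoʳ (0≤unit (2 ℕ.* k)) (power≤1 (suc (2 ℕ.* k))) ⟩
      1ℚ * unit (2 ℕ.* k)  ≡⟨ *-identityˡ (unit (2 ℕ.* k)) ⟩
      unit (2 ℕ.* k)  ≤⟨ p≤p+q (0≤* (0≤unit (2 ℕ.* X)) (0≤power (2 ℕ.* k))) ⟩
      unit (2 ℕ.* k) + unit (2 ℕ.* X) * z ^ (2 ℕ.* k) ∎
    ... | no k≮X = begin
      z * z ^ (2 ℕ.* k) * unit (2 ℕ.* k)  ≤⟨ *-mono (0≤unit (2 ℕ.* k)) (0≤power (2 ℕ.* k))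
          (subst (z * z ^ (2 ℕ.* k) ≤_) (*-identityˡ (z ^ (2 ℕ.* k))) (*-monoʳ (0≤power (2 ℕ.* k)) z≤1))
          (unit-antitone (ℕₚ.*-monoʳ-≤ 2 (ℕₚ.≮⇒≥ k≮X))) ⟩
      z ^ (2 ℕ.* k) * unit (2 ℕ.* X)  ≡⟨ eq (z ^ (2 ℕ.* k)) (unit (2 ℕ.* X)) ⟩
      0ℚ + unit (2 ℕ.* X) * z ^ (2 ℕ.* k)  ∎
      where
      eq : ∀ a b → a * b ≡ 0ℚ + b * a
      eq = solve-∀ ℚ-ring
    split : ∀ n → artanhSum z n ≤ psum c n + unit (2 ℕ.* X) * G n
    split zero    = ≤-reflexive (eq (unit (2 ℕ.* X)))
      where
      eq : ∀ a → 0ℚ ≡ 0ℚ + a * 0ℚ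
      eq = solve-∀ ℚ-ring
    split (suc n) = ≤-trans (+-mono-≤ (split n) (term n))
      (≤-reflexive (eq (psum c n) (unit (2 ℕ.* X)) (G n) (c n) (z ^ (2 ℕ.* n))))
      where
      eq : ∀ a u g b t → (a + u * g) + (b + u * t) ≡ (a + b) + u * (g + t)
      eq = solve-∀ ℚ-ring
    truncated : ∀ n → psum c n ≤ oddHarmonic X
    truncated zero = 0≤oddHarmonic X
    truncated (suc n) with n ℕₚ.<? X
    ... | yes n<X = ≤-trans (+-monoˡ-≤ (unit (2 ℕ.* n)) (prefix n (ℕₚ.<⇒≤ n<X)))
        (psum-mono-length (λ k → 0≤unit (2 ℕ.* k)) n<X)
      where
      prefix : ∀ n → n ℕ.≤ X → psum c n ≤ oddHarmonic n
      prefix zero    _   = ≤-refl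
      prefix (suc n) n<X with n ℕₚ.<? X
      ... | yes _   = +-monoˡ-≤ (unit (2 ℕ.* n)) (prefix n (ℕₚ.<⇒≤ n<X))
      ... | no  n≮X = contradiction n<X n≮X
    ... | no  _ = subst (_≤ oddHarmonic X) (sym (+-identityʳ (psum c n))) (truncated n)
    r = ½ * fromℕ (suc X)
    1≤r : 1ℚ ≤ r * (1ℚ - z)
    1≤r = begin
      1ℚ  ≡⟨ fromℕ*unit X ⟨
      fromℕ (suc X) * unit X  ≡⟨ eq (fromℕ (suc X)) (unit X) ⟩
      r * (fromℕ 2 * unit X)  ≤⟨ *-monoˡ 0≤r (0≤q-p⇒p≤q (subst (0ℚ ≤_) (eq′ z (fromℕ 2 * unit X)) (p≤q⇒0≤q-p z≤))) ⟩
      r * (1ℚ - z)  ∎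
      where
      0≤r = 0≤* (nonNegative⁻¹ ½) (0≤fromℕ (suc X))
      eq : ∀ a b → a * b ≡ ½ * a * (fromℕ 2 * b)
      eq a b = trans (sym (*-identityˡ (a * b))) (eq″ ½ (fromℕ 2) a b)
        where
        eq″ : ∀ h t a b → h * t * (a * b) ≡ h * a * (t * b)
        eq″ = solve-∀ ℚ-ring
      eq′ : ∀ z t → (1ℚ - t) - z ≡ (1ℚ - z) - t
      eq′ = solve-∀ ℚ-ring
    G≤ : G n ≤ r
    G≤ = begin
      G n  ≡⟨ *-identityʳ (G n) ⟨
      G n * 1ℚ  ≤⟨ *-monoˡ (psum-nonNeg (λ k → 0≤power (2 ℕ.* k)) n) 1≤r ⟩
      G n * (r * (1ℚ - z))  ≡⟨ eq (G n) r (1ℚ - z) ⟩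
      r * (G n * (1ℚ - z))  ≤⟨ *-monoˡ (0≤* (nonNegative⁻¹ ½) (0≤fromℕ (suc X))) (evenPowers-geometric 0≤z z≤1 n) ⟩
      r * 1ℚ  ≡⟨ *-identityʳ r ⟩
      r  ∎
      where
      eq : ∀ g r t → g * (r * t) ≡ r * (g * t)
      eq = solve-∀ ℚ-ring

  -- The lower bound

  -- ∏ (2 k + 1) / (2 k) over 0 < k < s, of the order of √ s by Wallis' product.
  wallis : ℕ → ℚ
  wallis zero          = 1ℚ
  wallis (suc zero)    = 1ℚ
  wallis (suc (suc k)) = fromℕ (suc (2 ℕ.* suc k)) * unit (suc (2 ℕ.* k)) * wallis (suc k)

  -- The new factor satisfies `(2 k + 5)² / (2 k + 4)² ≤ (k + 2) / (k + 1)`; cleared of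
  -- denominators, the two sides differ by `3 k + 7`. So the square grows at most linearly.
  wallis² : ∀ k → wallis (2 ℕ.+ k) * wallis (2 ℕ.+ k) ≤ fromℕ 4 * fromℕ (1 ℕ.+ k)
  wallis² zero    = ≤ᵇ⇒≤ _
  wallis² (suc k) = begin
    N * u * w * (N * u * w)  ≡⟨ eq₁ N u w ⟩
    N * N * (u * u) * (w * w)  ≤⟨ *-monoˡ (0≤* (0≤* 0≤N 0≤N) (0≤* 0≤u 0≤u)) (wallis² k) ⟩
    N * N * (u * u) * (fromℕ 4 * fromℕ (1 ℕ.+ k))  ≡⟨ eq₂ (N * N) (u * u) (fromℕ 4) (fromℕ (1 ℕ.+ k)) ⟩
    fromℕ 4 * (N * N * fromℕ (1 ℕ.+ k)) * (u * u)  ≡⟨ cong (λ t → fromℕ 4 * t * (u * u)) (hom³ (suc (2 ℕ.* suc (suc k))) (1 ℕ.+ k)) ⟨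
    fromℕ 4 * fromℕ (suc (2 ℕ.* suc (suc k)) ℕ.* suc (2 ℕ.* suc (suc k)) ℕ.* (1 ℕ.+ k)) * (u * u)
      ≤⟨ *-monoʳ (0≤* 0≤u 0≤u) (*-monoˡ (0≤fromℕ 4) (fromℕ-mono nat)) ⟩
    fromℕ 4 * fromℕ (suc (suc (2 ℕ.* suc k)) ℕ.* suc (suc (2 ℕ.* suc k)) ℕ.* (2 ℕ.+ k)) * (u * u)
      ≡⟨ cong (λ t → fromℕ 4 * t * (u * u)) (hom³ (suc (suc (2 ℕ.* suc k))) (2 ℕ.+ k)) ⟩
    fromℕ 4 * (D * D * fromℕ (2 ℕ.+ k)) * (u * u)  ≡⟨ eq₃ (fromℕ 4) D (fromℕ (2 ℕ.+ k)) u ⟩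
    fromℕ 4 * fromℕ (2 ℕ.+ k) * (D * u * (D * u))  ≡⟨ cong (λ t → fromℕ 4 * fromℕ (2 ℕ.+ k) * (t * t)) (fromℕ*unit (suc (2 ℕ.* suc k))) ⟩
    fromℕ 4 * fromℕ (2 ℕ.+ k) * 1ℚ  ≡⟨ *-identityʳ _ ⟩
    fromℕ 4 * fromℕ (2 ℕ.+ k)  ∎
    where
    open ≤-Reasoning
    N = fromℕ (suc (2 ℕ.* suc (suc k))) ; u = unit (suc (2 ℕ.* suc k)) ; w = wallis (2 ℕ.+ k)
    D = fromℕ (suc (suc (2 ℕ.* suc k)))
    0≤N = 0≤fromℕ (suc (2 ℕ.* suc (suc k)))
    0≤u = 0≤unit (suc (2 ℕ.* suc k))
    hom³ : ∀ m n → fromℕ (m ℕ.* m ℕ.* n) ≡ fromℕ m * fromℕ m * fromℕ n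
    hom³ m n = trans (fromℕ-* (m ℕ.* m) n) (cong (_* fromℕ n) (fromℕ-* m m))
    eq₁ : ∀ n u w → n * u * w * (n * u * w) ≡ n * n * (u * u) * (w * w)
    eq₁ = solve-∀ ℚ-ring
    eq₂ : ∀ n u f k → n * u * (f * k) ≡ f * (n * k) * u
    eq₂ = solve-∀ ℚ-ring
    eq₃ : ∀ f d k u → f * (d * d * k) * (u * u) ≡ f * k * (d * u * (d * u))
    eq₃ = solve-∀ ℚ-ring
    natEq : ∀ k → suc (suc (2 ℕ.* suc k)) ℕ.* suc (suc (2 ℕ.* suc k)) ℕ.* (2 ℕ.+ k) ≡
      suc (2 ℕ.* suc (suc k)) ℕ.* suc (2 ℕ.* suc (suc k)) ℕ.* (1 ℕ.+ k) ℕ.+ (3 ℕ.* k ℕ.+ 7)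
    natEq = ℕSolver.solve-∀
    nat : suc (2 ℕ.* suc (suc k)) ℕ.* suc (2 ℕ.* suc (suc k)) ℕ.* (1 ℕ.+ k) ℕ.≤
      suc (suc (2 ℕ.* suc k)) ℕ.* suc (suc (2 ℕ.* suc k)) ℕ.* (2 ℕ.+ k)
    nat = subst (suc (2 ℕ.* suc (suc k)) ℕ.* suc (2 ℕ.* suc (suc k)) ℕ.* (1 ℕ.+ k) ℕ.≤_)
      (sym (natEq k)) (ℕₚ.m≤m+n _ (3 ℕ.* k ℕ.+ 7))

  wallis≤ : ∀ s R → 0 ℕ.< s → s ℕ.≤ R ℕ.* R → wallis s ≤ fromℕ (2 ℕ.* R)
  wallis≤ s R 0<s s≤R² = square-cancel-≤ (0≤fromℕ (2 ℕ.* R)) (begin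
    wallis s * wallis s  ≤⟨ square s 0<s ⟩
    fromℕ 4 * fromℕ s  ≤⟨ *-monoˡ (0≤fromℕ 4) (fromℕ-mono s≤R²) ⟩
    fromℕ 4 * fromℕ (R ℕ.* R)  ≡⟨ fromℕ-* 4 (R ℕ.* R) ⟨
    fromℕ (4 ℕ.* (R ℕ.* R))  ≡⟨ cong fromℕ (eq R) ⟩
    fromℕ (2 ℕ.* R ℕ.* (2 ℕ.* R))  ≡⟨ fromℕ-* (2 ℕ.* R) (2 ℕ.* R) ⟩
    fromℕ (2 ℕ.* R) * fromℕ (2 ℕ.* R)  ∎)
    where
    open ≤-Reasoning
    eq : ∀ R → 4 ℕ.* (R ℕ.* R) ≡ 2 ℕ.* R ℕ.* (2 ℕ.* R)
    eq = ℕSolver.solve-∀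
    square : ∀ s → 0 ℕ.< s → wallis s * wallis s ≤ fromℕ 4 * fromℕ s
    square (suc zero)    _ = ≤ᵇ⇒≤ _
    square (suc (suc k)) _ = ≤-trans (wallis² k) (*-monoˡ (0≤fromℕ 4) (fromℕ-mono (ℕₚ.n≤1+n (suc k))))

  -- The next summand `x = 1 / (2 k + 3)` costs the factor `1 / (1 - x) = (2 k + 3) / (2 k + 2)` in
  -- `expSum-+`, which is exactly the next factor of `wallis`. The initial 4 bounds `exp 1`.
  expSum-oddHarmonic : ∀ k n → expSum (oddHarmonic (suc k)) n ≤ fromℕ 4 * wallis (suc k)
  expSum-oddHarmonic zero    n = expSum-fromℕ 1 n
  expSum-oddHarmonic (suc k) n = begin
    expSum (oddHarmonic (suc k) + x) n  ≤⟨ expSum-+ (0≤oddHarmonic (suc k)) (0≤unit (2 ℕ.* suc k)) 0≤r (≤-reflexive (sym r[1-x]≡1)) n ⟩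
    r * expSum (oddHarmonic (suc k)) n  ≤⟨ *-monoˡ 0≤r (expSum-oddHarmonic k n) ⟩
    r * (fromℕ 4 * wallis (suc k))  ≡⟨ *-swap r (fromℕ 4) (wallis (suc k)) ⟩
    fromℕ 4 * (r * wallis (suc k))  ∎
    where
    x = unit (2 ℕ.* suc k)
    N = fromℕ (suc (2 ℕ.* suc k)) ; u = unit (suc (2 ℕ.* k))
    r = N * u
    0≤r = 0≤* (0≤fromℕ (suc (2 ℕ.* suc k))) (0≤unit (suc (2 ℕ.* k)))
    r[1-x]≡1 : r * (1ℚ - x) ≡ 1ℚ
    r[1-x]≡1 = begin
      N * u * (1ℚ - x)  ≡⟨ eq₁ N u x ⟩
      u * (N - N * x)  ≡⟨ cong₂ (λ s t → u * (s - t)) N≡ (fromℕ*unit (2 ℕ.* suc k)) ⟩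
      u * (1ℚ + M - 1ℚ)  ≡⟨ eq₂ u M ⟩
      M * u  ≡⟨ fromℕ*unit (suc (2 ℕ.* k)) ⟩
      1ℚ  ∎
      where
      open ≡-Reasoning
      M = fromℕ (suc (suc (2 ℕ.* k)))
      N≡ : N ≡ 1ℚ + M
      N≡ = trans (fromℕ-suc (2 ℕ.* suc k)) (cong (λ t → 1ℚ + fromℕ t) (ℕₚ.*-suc 2 k))
      eq₁ : ∀ n u x → n * u * (1ℚ - x) ≡ u * (n - n * x)
      eq₁ = solve-∀ ℚ-ring
      eq₂ : ∀ u m → u * (1ℚ + m - 1ℚ) ≡ m * u
      eq₂ = solve-∀ ℚ-ring
    open ≤-Reasoning

  -- This plays the role of `exp (½ log X) = √X`: the argument bounds ½ log X from above, and `R` is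
  -- an integer above the root. The constant 16 is the product of 2 for the extra ½, 4 from
  -- `expSum-oddHarmonic`, and 2 from `wallis≤`.
  ∣expSum∣≤√ : ∀ {q} X R → 0 ℕ.< X → X ℕ.≤ R ℕ.* R → ∣ q ∣ ≤ oddHarmonic X + ½ → ∀ n →
    ∣ expSum q n ∣ ≤ fromℕ (16 ℕ.* R)
  ∣expSum∣≤√ {q} X@(suc k) R 0<X X≤R² h n = begin
    ∣ expSum q n ∣  ≤⟨ ∣expSum∣≤ h n ⟩
    expSum (oddHarmonic X + ½) n  ≤⟨ expSum-½ (0≤oddHarmonic X) n ⟩
    fromℕ 2 * expSum (oddHarmonic X) n  ≤⟨ *-monoˡ (0≤fromℕ 2) (expSum-oddHarmonic k n) ⟩
    fromℕ 2 * (fromℕ 4 * wallis X)  ≤⟨ *-monoˡ (0≤fromℕ 2) (*-monoˡ (0≤fromℕ 4) (wallis≤ X R 0<X X≤R²)) ⟩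
    fromℕ 2 * (fromℕ 4 * fromℕ (2 ℕ.* R))  ≡⟨ cong (fromℕ 2 *_) (fromℕ-* 4 (2 ℕ.* R)) ⟨
    fromℕ 2 * fromℕ (4 ℕ.* (2 ℕ.* R))  ≡⟨ fromℕ-* 2 (4 ℕ.* (2 ℕ.* R)) ⟨
    fromℕ (2 ℕ.* (4 ℕ.* (2 ℕ.* R)))  ≡⟨ cong fromℕ (eq R) ⟩
    fromℕ (16 ℕ.* R)  ∎
    where
    open ≤-Reasoning
    eq : ∀ R → 2 ℕ.* (4 ℕ.* (2 ℕ.* R)) ≡ 16 ℕ.* R
    eq = ℕSolver.solve-∀

  logRatio : ℚ → ℚ
  logRatio x = (x - 1ℚ) * inv (x + 1ℚ)

  -- The map `x ↦ (x - 1) / (x + 1)` is increasing and changes sign under `x ↦ 1 / x`, so on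
  -- `[1 / X , X]` it is extremal at the endpoints, where its absolute value is `1 - 2 / (X + 1)`.
  -- Both inequalities are checked after multiplying by `x + 1`.
  ∣logRatio∣≤ : ∀ {x} X → 0ℚ ≤ x → 1ℚ ≤ x * fromℕ X → x ≤ fromℕ X → ∣ logRatio x ∣ ≤ 1ℚ - fromℕ 2 * unit X
  ∣logRatio∣≤ {x} X 0≤x 1≤xX x≤X = ∣p∣≤q
    (0≤q-p⇒p≤q (*-cancelˡ 0<x+1 (begin
      (x + 1ℚ) * 0ℚ  ≡⟨ *-zeroʳ (x + 1ℚ) ⟩
      0ℚ  ≤⟨ 0≤* (0≤fromℕ 2) (0≤* (0≤unit X) (p≤q⇒0≤q-p x≤X)) ⟩
      fromℕ 2 * (u * (fromℕ X - x))  ≡⟨ eq₁ (fromℕ X) u x ⟩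
      fromℕ 2 * ((1ℚ + fromℕ X) * u) - fromℕ 2 * (x + 1ℚ) * u  ≡⟨ cong (λ t → fromℕ 2 * (t * u) - fromℕ 2 * (x + 1ℚ) * u) (fromℕ-suc X) ⟨
      fromℕ 2 * (fromℕ (suc X) * u) - fromℕ 2 * (x + 1ℚ) * u  ≡⟨ cong (λ s → fromℕ 2 * s - fromℕ 2 * (x + 1ℚ) * u) (fromℕ*unit X) ⟩
      fromℕ 2 * 1ℚ - fromℕ 2 * (x + 1ℚ) * u  ≡⟨ eq₂ x u ⟩
      (x + 1ℚ) * (1ℚ - fromℕ 2 * u) - (x - 1ℚ) * 1ℚ  ≡⟨ cong (λ t → (x + 1ℚ) * (1ℚ - fromℕ 2 * u) - (x - 1ℚ) * t) (*-inv 0<x+1) ⟨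
      (x + 1ℚ) * (1ℚ - fromℕ 2 * u) - (x - 1ℚ) * ((x + 1ℚ) * i)  ≡⟨ eq₃ x i (1ℚ - fromℕ 2 * u) ⟩
      (x + 1ℚ) * (1ℚ - fromℕ 2 * u - logRatio x) ∎)))
    (0≤q-p⇒p≤q (*-cancelˡ 0<x+1 (begin
      (x + 1ℚ) * 0ℚ  ≡⟨ *-zeroʳ (x + 1ℚ) ⟩
      0ℚ  ≤⟨ 0≤* (0≤fromℕ 2) (0≤* (0≤unit X) (p≤q⇒0≤q-p 1≤xX)) ⟩
      fromℕ 2 * (u * (x * fromℕ X - 1ℚ))  ≡⟨ eq₄ (fromℕ X) u x ⟩
      fromℕ 2 * x * ((1ℚ + fromℕ X) * u) - fromℕ 2 * (x + 1ℚ) * u  ≡⟨ cong (λ t → fromℕ 2 * x * (t * u) - fromℕ 2 * (x + 1ℚ) * u) (fromℕ-suc X) ⟨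
      fromℕ 2 * x * (fromℕ (suc X) * u) - fromℕ 2 * (x + 1ℚ) * u  ≡⟨ cong (λ s → fromℕ 2 * x * s - fromℕ 2 * (x + 1ℚ) * u) (fromℕ*unit X) ⟩
      fromℕ 2 * x * 1ℚ - fromℕ 2 * (x + 1ℚ) * u  ≡⟨ eq₅ x u ⟩
      (x + 1ℚ) * (1ℚ - fromℕ 2 * u) + (x - 1ℚ) * 1ℚ  ≡⟨ cong (λ t → (x + 1ℚ) * (1ℚ - fromℕ 2 * u) + (x - 1ℚ) * t) (*-inv 0<x+1) ⟨
      (x + 1ℚ) * (1ℚ - fromℕ 2 * u) + (x - 1ℚ) * ((x + 1ℚ) * i)  ≡⟨ eq₆ x i (1ℚ - fromℕ 2 * u) ⟩
      (x + 1ℚ) * (1ℚ - fromℕ 2 * u - - logRatio x) ∎)))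
    where
    open ≤-Reasoning
    u = unit X ; i = inv (x + 1ℚ)
    0<x+1 : 0ℚ < x + 1ℚ
    0<x+1 = +-mono-≤-< 0≤x 0<1
    eq₁ : ∀ a u x → (1ℚ + 1ℚ) * (u * (a - x)) ≡ (1ℚ + 1ℚ) * ((1ℚ + a) * u) - (1ℚ + 1ℚ) * (x + 1ℚ) * u
    eq₁ = solve-∀ ℚ-ring
    eq₂ : ∀ x u → (1ℚ + 1ℚ) * 1ℚ - (1ℚ + 1ℚ) * (x + 1ℚ) * u ≡ (x + 1ℚ) * (1ℚ - (1ℚ + 1ℚ) * u) - (x - 1ℚ) * 1ℚ
    eq₂ = solve-∀ ℚ-ring
    eq₃ : ∀ x i t → (x + 1ℚ) * t - (x - 1ℚ) * ((x + 1ℚ) * i) ≡ (x + 1ℚ) * (t - (x - 1ℚ) * i)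
    eq₃ = solve-∀ ℚ-ring
    eq₄ : ∀ a u x → (1ℚ + 1ℚ) * (u * (x * a - 1ℚ)) ≡ (1ℚ + 1ℚ) * x * ((1ℚ + a) * u) - (1ℚ + 1ℚ) * (x + 1ℚ) * u
    eq₄ = solve-∀ ℚ-ring
    eq₅ : ∀ x u → (1ℚ + 1ℚ) * x * 1ℚ - (1ℚ + 1ℚ) * (x + 1ℚ) * u ≡ (x + 1ℚ) * (1ℚ - (1ℚ + 1ℚ) * u) + (x - 1ℚ) * 1ℚ
    eq₅ = solve-∀ ℚ-ring
    eq₆ : ∀ x i t → (x + 1ℚ) * t + (x - 1ℚ) * ((x + 1ℚ) * i) ≡ (x + 1ℚ) * (t - - ((x - 1ℚ) * i))
    eq₆ = solve-∀ ℚ-ring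

  ∣artanhSum-logRatio∣≤ : ∀ {x} X → 0 ℕ.< X → 0ℚ ≤ x → 1ℚ ≤ x * fromℕ X → x ≤ fromℕ X → ∀ n →
    ∣ artanhSum (logRatio x) n ∣ ≤ oddHarmonic X + ½
  ∣artanhSum-logRatio∣≤ {x} X 0<X 0≤x 1≤xX x≤X n = begin
    ∣ artanhSum (logRatio x) n ∣  ≤⟨ ∣artanhSum∣≤ ∣z∣≤ n ⟩
    artanhSum b n  ≤⟨ artanhSum≤oddHarmonic X (≤-trans (0≤∣p∣ (logRatio x)) ∣z∣≤) ≤-refl n ⟩
    oddHarmonic X + ½  ∎
    where
    open ≤-Reasoning
    b = 1ℚ - fromℕ 2 * unit X
    ∣z∣≤ = ∣logRatio∣≤ X 0≤x 1≤xX x≤X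

  logSum : ℕ → ℕ → ℚ
  logSum s n = fromℕ 2 * artanhSum (logRatio (fromℕ s)) n

  module _ (s : ℕ) (1<s : 1 ℕ.< s) where

    private
      0<s = ℕₚ.<-trans (ℕₚ.n<1+n 0) 1<s

    ∣artanhSum-logRatio-fromℕ∣≤ : ∀ n → ∣ artanhSum (logRatio (fromℕ s)) n ∣ ≤ oddHarmonic s + ½
    ∣artanhSum-logRatio-fromℕ∣≤ = ∣artanhSum-logRatio∣≤ s 0<s (0≤fromℕ s)
      (subst (1ℚ ≤_) (fromℕ-* s s) (fromℕ-mono (ℕₚ.*-mono-≤ 0<s 0<s))) ≤-refl

    logSum≤ : ∀ L → s ℕ.≤ 2 ℕ.^ L → ∀ n → logSum s n ≤ fromℕ (3 ℕ.+ L)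
    logSum≤ L s≤2^L n = begin
      fromℕ 2 * artanhSum z n  ≤⟨ *-monoˡ (0≤fromℕ 2) (p≤∣p∣ (artanhSum z n)) ⟩
      fromℕ 2 * ∣ artanhSum z n ∣  ≤⟨ *-monoˡ (0≤fromℕ 2) (∣artanhSum-logRatio-fromℕ∣≤ n) ⟩
      fromℕ 2 * (oddHarmonic s + ½)  ≤⟨ *-monoˡ (0≤fromℕ 2) (+-monoˡ-≤ ½ (psum-mono-length (λ k → 0≤unit (2 ℕ.* k)) s≤2^L)) ⟩
      fromℕ 2 * (oddHarmonic (2 ℕ.^ L) + ½)  ≡⟨ *-distribˡ-+ (fromℕ 2) (oddHarmonic (2 ℕ.^ L)) ½ ⟩
      fromℕ 2 * oddHarmonic (2 ℕ.^ L) + 1ℚ  ≤⟨ +-monoˡ-≤ 1ℚ (oddHarmonic-2^ L) ⟩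
      fromℕ (2 ℕ.+ L) + 1ℚ  ≡⟨ +-comm (fromℕ (2 ℕ.+ L)) 1ℚ ⟩
      1ℚ + fromℕ (2 ℕ.+ L)  ≡⟨ fromℕ-suc (2 ℕ.+ L) ⟨
      fromℕ (3 ℕ.+ L)  ∎
      where
      open ≤-Reasoning
      z = logRatio (fromℕ s)

    -- Equality holds at `s = 2`. It keeps log s away from 0, so that the power with exponent `-½`
    -- stays bounded.
    1≤3*logRatio : 1ℚ ≤ fromℕ 3 * logRatio (fromℕ s)
    1≤3*logRatio = 0≤q-p⇒p≤q (*-cancelˡ 0<S+1 (begin
      (S + 1ℚ) * 0ℚ  ≡⟨ *-zeroʳ (S + 1ℚ) ⟩
      0ℚ  ≤⟨ 0≤* (0≤fromℕ 2) (p≤q⇒0≤q-p (fromℕ-mono 1<s)) ⟩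
      fromℕ 2 * (S - fromℕ 2)  ≡⟨ eq₁ S ⟩
      fromℕ 3 * (S - 1ℚ) * 1ℚ - (S + 1ℚ)  ≡⟨ cong (λ t → fromℕ 3 * (S - 1ℚ) * t - (S + 1ℚ)) (*-inv 0<S+1) ⟨
      fromℕ 3 * (S - 1ℚ) * ((S + 1ℚ) * i) - (S + 1ℚ)  ≡⟨ eq₂ (fromℕ 3) S i ⟩
      (S + 1ℚ) * (fromℕ 3 * ((S - 1ℚ) * i) - 1ℚ)  ∎))
      where
      open ≤-Reasoning
      S = fromℕ s ; i = inv (S + 1ℚ)
      0<S+1 : 0ℚ < S + 1ℚ
      0<S+1 = +-mono-≤-< (0≤fromℕ s) 0<1
      eq₁ : ∀ a → (1ℚ + 1ℚ) * (a - (1ℚ + 1ℚ)) ≡ (1ℚ + (1ℚ + 1ℚ)) * (a - 1ℚ) * 1ℚ - (a + 1ℚ)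
      eq₁ = solve-∀ ℚ-ring
      eq₂ : ∀ t a i → t * (a - 1ℚ) * ((a + 1ℚ) * i) - (a + 1ℚ) ≡ (a + 1ℚ) * (t * ((a - 1ℚ) * i) - 1ℚ)
      eq₂ = solve-∀ ℚ-ring

    0≤logRatio : 0ℚ ≤ logRatio (fromℕ s)
    0≤logRatio = *-cancelˡ (0<fromℕ 3) (≤-trans 0≤1 1≤3*logRatio)

    logRatio≤artanhSum : ∀ n → logRatio (fromℕ s) ≤ artanhSum (logRatio (fromℕ s)) (suc n)
    logRatio≤artanhSum n = ≤-trans (≤-reflexive (eq (logRatio (fromℕ s))))
      (psum-mono-length {λ k → artanhTerm k (logRatio (fromℕ s))}
        (λ k → 0≤* (^-nonNeg 0≤logRatio (suc (2 ℕ.* k))) (0≤unit (2 ℕ.* k))) {1} {suc n} (s≤s z≤n))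
      where
      eq : ∀ a → a ≡ 0ℚ + a * 1ℚ * 1ℚ
      eq = solve-∀ ℚ-ring

    1≤logSum*3 : ∀ n → 1ℚ ≤ logSum s (suc n) * fromℕ 3
    1≤logSum*3 n = begin
      1ℚ  ≤⟨ 1≤3*logRatio ⟩
      fromℕ 3 * z  ≤⟨ *-monoˡ (0≤fromℕ 3) (logRatio≤artanhSum n) ⟩
      fromℕ 3 * A  ≤⟨ p≤p+q (0≤* (0≤fromℕ 3) (≤-trans 0≤logRatio (logRatio≤artanhSum n))) ⟩
      fromℕ 3 * A + fromℕ 3 * A  ≡⟨ eq (fromℕ 3) A ⟩
      fromℕ 2 * A * fromℕ 3  ∎
      where
      open ≤-Reasoning
      z = logRatio (fromℕ s) ; A = artanhSum z (suc n)
      eq : ∀ t a → t * a + t * a ≡ (1ℚ + 1ℚ) * a * t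
      eq = solve-∀ ℚ-ring

    0≤logSum : ∀ n → 0ℚ ≤ logSum s (suc n)
    0≤logSum n = 0≤* (0≤fromℕ 2) (≤-trans 0≤logRatio (logRatio≤artanhSum n))

    -- With `X = 3 + L` one has `1 / X ≤ log s ≤ X`, hence `|log log s| ≤ log X`. That bounds
    -- `(log s)^(-1/2)` by a multiple of `√X`, and then of `X` by taking `X` itself as the integer
    -- above its root. The decay of this factor is given away.
    ∣expArgument∣≤ : ∀ {t} C L R → ∣ t ∣ ≤ fromℕ C → s ℕ.≤ 2 ℕ.^ L → s ℕ.≤ R ℕ.* R → ∀ n →
      ∣ t * (expSum (½ * logSum s (suc n)) (suc n) *
             expSum (-½ * (fromℕ 2 * artanhSum (logRatio (logSum s (suc n))) (suc n))) (suc n)) ∣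
      ≤ fromℕ (C ℕ.* (16 ℕ.* R ℕ.* (16 ℕ.* (3 ℕ.+ L))))
    ∣expArgument∣≤ {t} C L R ∣t∣≤C s≤2^L s≤R² n =
      subst (∣ t * (expSum a N * expSum b N) ∣ ≤_)
        (trans (cong (fromℕ C *_) (sym (fromℕ-* (16 ℕ.* R) (16 ℕ.* X)))) (sym (fromℕ-* C (16 ℕ.* R ℕ.* (16 ℕ.* X)))))
        (∣p*q∣≤ ∣t∣≤C (∣p*q∣≤
          (∣expSum∣≤√ s R 0<s s≤R² (subst (λ q → ∣ q ∣ ≤ oddHarmonic s + ½) (sym (eq₁ A)) (∣artanhSum-logRatio-fromℕ∣≤ N)) N)
          (∣expSum∣≤√ X X (s≤s z≤n) (ℕₚ.m≤m*n X X) ∣b∣≤ N)))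
      where
      N = suc n ; X = 3 ℕ.+ L
      A = artanhSum (logRatio (fromℕ s)) N
      B = artanhSum (logRatio (logSum s N)) N
      a = ½ * logSum s N
      b = -½ * (fromℕ 2 * B)
      eq₁ : ∀ p → ½ * (fromℕ 2 * p) ≡ p
      eq₁ p = trans (sym (*-assoc ½ (fromℕ 2) p)) (*-identityˡ p)
      eq₂ : ∀ p → -½ * (fromℕ 2 * p) ≡ - p
      eq₂ p = trans (sym (*-assoc -½ (fromℕ 2) p)) (eq p)
        where
        eq : ∀ p → - 1ℚ * p ≡ - p
        eq = solve-∀ ℚ-ring
      ∣b∣≤ : ∣ b ∣ ≤ oddHarmonic X + ½
      ∣b∣≤ = subst (_≤ oddHarmonic X + ½) (sym (trans (cong ∣_∣ (eq₂ B)) (∣-p∣≡∣p∣ B)))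
        (∣artanhSum-logRatio∣≤ X (s≤s z≤n) (0≤logSum n)
          (≤-trans (1≤logSum*3 n) (*-monoˡ (0≤logSum n) (fromℕ-mono (ℕₚ.m≤m+n 3 L))))
          (logSum≤ L s≤2^L N) N)

  eventually-bounded : ∀ x → ∃[ C ] ∃[ N ] (∀ n → N ℕ.≤ n → ∣ seq x n ∣ ≤ fromℕ C)
  eventually-bounded x = C , N , λ n N≤n → begin
      ∣ seq x n ∣  ≡⟨ cong ∣_∣ (p≡p-q+q (seq x n) (seq x N)) ⟩
      ∣ (seq x n - seq x N) + seq x N ∣  ≤⟨ ∣p+q∣≤∣p∣+∣q∣ (seq x n - seq x N) (seq x N) ⟩
      ∣ seq x n - seq x N ∣ + ∣ seq x N ∣  ≤⟨ +-monoˡ-≤ ∣ seq x N ∣ (proj₂ (cauchy x 1ℚ 0<1) n N N≤n ℕₚ.≤-refl) ⟩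
      1ℚ + ∣ seq x N ∣  ≤⟨ proj₂ (archimedean (1ℚ + ∣ seq x N ∣)) ⟩
      fromℕ C  ∎
    where
    N = proj₁ (cauchy x 1ℚ 0<1)
    C = proj₁ (archimedean (1ℚ + ∣ seq x N ∣))
    open ≤-Reasoning

  seq-exp : ∀ x n → seq (exp x) n ≡ expSum (seq x n) n
  seq-exp x n = refl

  seq-log : ∀ x (0<x : 0ᴿ <ᴿ x) n → seq (log x 0<x) n ≡ fromℕ 2 * artanhSum (logRatio (seq x n)) n
  seq-log x 0<x n = refl

  seq-rpow : ∀ x (0<x : 0ᴿ <ᴿ x) q n →
    seq (rpow x 0<x (fromℚ q)) n ≡ expSum (q * (fromℕ 2 * artanhSum (logRatio (seq x n)) n)) n
  seq-rpow x 0<x q n = trans (seq-exp (fromℚ q *ᴿ log x 0<x) n)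
    (cong (λ t → expSum (q * t) n) (seq-log x 0<x n))

  seq-lowerBound : ∀ ε s .{{_ : NonTrivial s}} n → seq (lowerBound ε s) n ≡
    expSum (seq (fromℕᴿ 4 -ᴿ ε) n *
      (expSum (½ * logSum s n) n *
       expSum (-½ * (fromℕ 2 * artanhSum (logRatio (logSum s n)) n)) n)) n
  seq-lowerBound ε s n = trans (seq-exp ((fromℕᴿ 4 -ᴿ ε) *ᴿ (rpow (fromℕᴿ s) (0<fromℕᴿ s) (fromℚ ½) *ᴿ
      rpow (log (fromℕᴿ s) (0<fromℕᴿ s)) (0<log s) (fromℚ -½))) n) (cong (λ t → expSum (seq (fromℕᴿ 4 -ᴿ ε) n * t) n)
    (cong₂ _*_ (seq-rpow (fromℕᴿ s) (0<fromℕᴿ s) ½ n)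
      (trans (seq-rpow (log (fromℕᴿ s) (0<fromℕᴿ s)) (0<log s) -½ n)
        (cong (λ t → expSum (-½ * (fromℕ 2 * artanhSum (logRatio t) n)) n) (seq-log (fromℕᴿ s) (0<fromℕᴿ s) n)))))

  -- Here `L` and `R` stand for integers above log₂ s and √s, so the bound is exponential in
  -- `√s log s`. The constant `C` bounds `|4 - ε|` and is chosen before `s`, so the threshold for
  -- `s` may depend on it.
  lowerBound≤ : ∀ ε → ∃[ C ] (∀ s .{{_ : NonTrivial s}} L R → s ℕ.≤ 2 ℕ.^ L → s ℕ.≤ R ℕ.* R →
    ∀ g → 4 ℕ.^ (C ℕ.* (16 ℕ.* R ℕ.* (16 ℕ.* (3 ℕ.+ L)))) ℕ.≤ g → lowerBound ε s ≤ᴿ fromℕᴿ g)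
  -- Index 0 is excluded: there the sum for log s is empty, and the lower bound for log s needs its
  -- first term.
  lowerBound≤ ε = C , λ s L R s≤2^L s≤R² g 4^K≤g δ 0<δ → suc N₀ , bound s L R s≤2^L s≤R² g 4^K≤g δ 0<δ
    where
    C = proj₁ (eventually-bounded (fromℕᴿ 4 -ᴿ ε))
    N₀ = proj₁ (proj₂ (eventually-bounded (fromℕᴿ 4 -ᴿ ε)))
    ∣4-ε∣≤C : ∀ n → N₀ ℕ.≤ n → ∣ seq (fromℕᴿ 4 -ᴿ ε) n ∣ ≤ fromℕ C
    ∣4-ε∣≤C = proj₂ (proj₂ (eventually-bounded (fromℕᴿ 4 -ᴿ ε)))
    bound : ∀ s .{{_ : NonTrivial s}} L R → s ℕ.≤ 2 ℕ.^ L → s ℕ.≤ R ℕ.* R →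
      ∀ g → 4 ℕ.^ (C ℕ.* (16 ℕ.* R ℕ.* (16 ℕ.* (3 ℕ.+ L)))) ℕ.≤ g → ∀ δ → 0ℚ < δ →
      ∀ n → suc N₀ ℕ.≤ n → seq (lowerBound ε s) n ≤ seq (fromℕᴿ g) n + δ
    bound s L R s≤2^L s≤R² g 4^K≤g δ 0<δ (suc n) (s≤s N₀≤n) = begin
      seq (lowerBound ε s) (suc n) ≡⟨ seq-lowerBound ε s (suc n) ⟩
      expSum A (suc n)  ≤⟨ p≤∣p∣ (expSum A (suc n)) ⟩
      ∣ expSum A (suc n) ∣  ≤⟨ ∣expSum∣≤ (∣expArgument∣≤ s (ℕ.nonTrivial⇒n>1 s) C L R
                                       (∣4-ε∣≤C (suc n) (ℕₚ.m≤n⇒m≤1+n N₀≤n)) s≤2^L s≤R² n) (suc n) ⟩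
      expSum (fromℕ K) (suc n)  ≤⟨ expSum-fromℕ K (suc n) ⟩
      fromℕ (4 ℕ.^ K)  ≤⟨ fromℕ-mono 4^K≤g ⟩
      fromℕ g  ≤⟨ p≤p+q (<⇒≤ 0<δ) ⟩
      fromℕ g + δ  ∎
      where
      open ≤-Reasoning
      K = C ℕ.* (16 ℕ.* R ℕ.* (16 ℕ.* (3 ℕ.+ L)))
      A = seq (fromℕᴿ 4 -ᴿ ε) (suc n) * (expSum (½ * logSum s (suc n)) (suc n) *
             expSum (-½ * (fromℕ 2 * artanhSum (logRatio (logSum s (suc n))) (suc n))) (suc n))

-- The group of S-units.

module SUnits where

  open Rationals
  open import Data.Integer.Base as ℤ using (+_; -[1+_]; +[1+_])
  import Data.Integer.GCD as ℤ
  import Data.Integer.Properties as ℤₚ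
  open import Data.List.Membership.Propositional using (_∈_)
  open import Data.Nat.Base as ℕ using (ℕ)
  open import Data.Nat.Divisibility using (_∣_; divides; ∣-trans; ∣1⇒≡1)
  open import Data.Nat.Primality using (Prime; ¬prime[1]; euclidsLemma)
  import Data.Nat.Properties as ℕₚ
  open import Data.Rational.Base
  open import Data.Rational.Properties
  open import Data.Sum.Base using ([_,_]′)
  open import Relation.Binary.PropositionalEquality
  open import Relation.Nullary using (yes; no; contradiction)

  PrimeDivisorsIn : PrimeSet → ℕ → Set
  PrimeDivisorsIn S n = ∀ p → Prime p → p ∣ n → p ∈ primes S

  primeDivisors-* : ∀ {S} m n → PrimeDivisorsIn S m → PrimeDivisorsIn S n → PrimeDivisorsIn S (m ℕ.* n)
  primeDivisors-* m n hm hn p pp p∣mn = [ hm p pp , hn p pp ]′ (euclidsLemma m n pp p∣mn)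

  -- Reduction to lowest terms divides `i` and `n` by their gcd, so it can only remove primes.
  sUnit-/ : ∀ {S} i n .{{_ : ℕ.NonZero n}} → i ≢ ℤ.0ℤ → PrimeDivisorsIn S ℤ.∣ i ∣ → PrimeDivisorsIn S n →
    IsSUnit S (i / n)
  sUnit-/ {S} i n i≢0 hi hn = record
    { x≢0         = λ e → i≢0 (trans (sym (↥-/ i n)) (trans (cong (λ t → ↥ t ℤ.* ℤ.gcd i (+ n)) e) (ℤₚ.*-zeroˡ (ℤ.gcd i (+ n)))))
    ; numerator   = λ p pp p∣ → hi p pp (∣-trans p∣ (divides ℤ.∣ ℤ.gcd i (+ n) ∣ (begin
        ℤ.∣ i ∣                                             ≡⟨ cong ℤ.∣_∣ (↥-/ i n) ⟨
        ℤ.∣ ↥ (i / n) ℤ.* ℤ.gcd i (+ n) ∣                   ≡⟨ ℤₚ.abs-* (↥ (i / n)) (ℤ.gcd i (+ n)) ⟩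
        ℤ.∣ ↥ (i / n) ∣ ℕ.* ℤ.∣ ℤ.gcd i (+ n) ∣             ≡⟨ ℕₚ.*-comm ℤ.∣ ↥ (i / n) ∣ ℤ.∣ ℤ.gcd i (+ n) ∣ ⟩
        ℤ.∣ ℤ.gcd i (+ n) ∣ ℕ.* ℤ.∣ ↥ (i / n) ∣             ∎)))
    ; denominator = λ p pp p∣ → hn p pp (∣-trans p∣ (divides ℤ.∣ ℤ.gcd i (+ n) ∣ (begin
        n                                                   ≡⟨ cong ℤ.∣_∣ (↧-/ i n) ⟨
        ℤ.∣ ↧ (i / n) ℤ.* ℤ.gcd i (+ n) ∣                   ≡⟨ ℤₚ.abs-* (↧ (i / n)) (ℤ.gcd i (+ n)) ⟩
        ↧ₙ (i / n) ℕ.* ℤ.∣ ℤ.gcd i (+ n) ∣                  ≡⟨ ℕₚ.*-comm (↧ₙ (i / n)) ℤ.∣ ℤ.gcd i (+ n) ∣ ⟩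
        ℤ.∣ ℤ.gcd i (+ n) ∣ ℕ.* ↧ₙ (i / n)                  ∎)))
    }
    where open ≡-Reasoning

  sUnit-1 : ∀ {S} → IsSUnit S 1ℚ
  sUnit-1 {S} = record { x≢0 = λ () ; numerator = none ; denominator = none }
    where
    none : PrimeDivisorsIn S 1
    none p pp p∣1 = contradiction (subst Prime (∣1⇒≡1 p∣1) pp) ¬prime[1]

  ↥≢0 : ∀ {x} → x ≢ 0ℚ → ↥ x ≢ ℤ.0ℤ
  ↥≢0 {x} x≢0 e = x≢0 (↥p≡0⇒p≡0 x e)

  sUnit-* : ∀ {S x y} → IsSUnit S x → IsSUnit S y → IsSUnit S (x * y)
  sUnit-* {S} {x@record{}} {y@record{}} hx hy =
    sUnit-/ (↥ x ℤ.* ↥ y) (↧ₙ x ℕ.* ↧ₙ y)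
      (λ e → [ ↥≢0 (IsSUnit.x≢0 hx) , ↥≢0 (IsSUnit.x≢0 hy) ]′ (ℤₚ.i*j≡0⇒i≡0∨j≡0 (↥ x) e))
      (subst (PrimeDivisorsIn S) (sym (ℤₚ.abs-* (↥ x) (↥ y)))
        (primeDivisors-* {S} ℤ.∣ ↥ x ∣ ℤ.∣ ↥ y ∣ (IsSUnit.numerator hx) (IsSUnit.numerator hy)))
      (primeDivisors-* {S} (↧ₙ x) (↧ₙ y) (IsSUnit.denominator hx) (IsSUnit.denominator hy))

  sUnit-inv : ∀ {S x} → IsSUnit S x → IsSUnit S (inv x)
  sUnit-inv {S} {x} hx with x ≟ 0ℚ
  ... | yes x≡0 = contradiction x≡0 (IsSUnit.x≢0 hx)
  ... | no  x≢0 = reciprocal x {{≢-nonZero x≢0}} hx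
    where
    reciprocal : ∀ x .{{_ : NonZero x}} → IsSUnit S x → IsSUnit S (1/ x)
    reciprocal (mkℚ +[1+ n ] d _) h = record
      { x≢0 = λ () ; numerator = IsSUnit.denominator h ; denominator = IsSUnit.numerator h }
    reciprocal (mkℚ -[1+ n ] d _) h = record
      { x≢0 = λ () ; numerator = IsSUnit.denominator h ; denominator = IsSUnit.numerator h }

-- Polynomials vanishing on the solutions, and a lower bound for their degree.

module Polynomials where

  open Rationals
  open SUnits
  open import Data.Fin.Base using (Fin; zero; suc)
  open import Data.List.Base as List using (List; []; _∷_; _++_; length)
  open import Data.List.Membership.Propositional using (_∈_)
  open import Data.List.Membership.Propositional.Properties using (∈-deduplicate⁺; ∈-map⁺; ∈-map⁻)
  open import Data.List.Properties using (length-map)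
  open import Data.List.Relation.Unary.All as All using (All; []; _∷_)
  import Data.List.Relation.Unary.All.Properties as Allₚ
  open import Data.List.Relation.Unary.AllPairs using ([]; _∷_)
  open import Data.List.Relation.Unary.Any using (here; there)
  open import Data.List.Relation.Unary.Unique.DecPropositional.Properties using (deduplicate-!)
  open import Data.List.Relation.Unary.Unique.Propositional using (Unique)
  import Data.List.Relation.Unary.Unique.Propositional.Properties as Uniqueₚ
  open import Data.Nat.Base as ℕ using (ℕ; zero; suc; s≤s)
  import Data.Nat.Properties as ℕₚ
  open import Data.Product.Base using (∃-syntax; Σ-syntax; _×_; _,_; proj₁; proj₂)
  open import Data.Rational.Base
  open import Data.Rational.Properties
  open import Data.Sum.Base using (_⊎_; inj₁; inj₂)
  open import Data.Vec.Base as Vec using (Vec; []; _∷_)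
  import Data.Vec.Properties as Vecₚ
  import Data.Vec.Relation.Unary.All as VecAll
  open import Function.Base using (_∘_)
  open import Relation.Binary.PropositionalEquality
  open import Relation.Nullary using (Dec; ¬_; yes; no; contradiction)
  open import Tactic.RingSolver using (solve-∀)

  -- Coefficients and evaluations as linear functionals

  -- A property of bare rational sequences, so that finite sums of approximations need no Cauchy
  -- proofs. By definition `x ≃ᴿ y` is `Null` of the difference of the two sequences.
  Null : (ℕ → ℚ) → Set
  Null f = ∀ δ → 0ℚ < δ → ∃[ N ] (∀ i → N ℕ.≤ i → ∣ f i ∣ ≤ δ)

  null-≗ : ∀ {f g} → (∀ i → f i ≡ g i) → Null f → Null g
  null-≗ e h δ 0<δ = proj₁ (h δ 0<δ) , λ i N≤i →
    subst (λ t → ∣ t ∣ ≤ δ) (e i) (proj₂ (h δ 0<δ) i N≤i)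

  null-0 : Null (λ _ → 0ℚ)
  null-0 δ 0<δ = 0 , λ _ _ → <⇒≤ 0<δ

  half : ∀ {δ} → 0ℚ < δ → 0ℚ < δ * ½
  half {δ} 0<δ = subst (_< δ * ½) (*-zeroˡ ½) (*-monoˡ-<-pos ½ 0<δ)

  half+half : ∀ δ → δ * ½ + δ * ½ ≡ δ
  half+half δ = trans (sym (*-distribˡ-+ δ ½ ½)) (*-identityʳ δ)

  null-+ : ∀ {f g} → Null f → Null g → Null (λ i → f i + g i)
  null-+ {f} {g} hf hg δ 0<δ =
    proj₁ (hf _ (half 0<δ)) ℕ.⊔ proj₁ (hg _ (half 0<δ)) , λ i N≤i → begin
      ∣ f i + g i ∣  ≤⟨ ∣p+q∣≤∣p∣+∣q∣ (f i) (g i) ⟩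
      ∣ f i ∣ + ∣ g i ∣  ≤⟨ +-mono-≤ (proj₂ (hf _ (half 0<δ)) i (ℕₚ.m⊔n≤o⇒m≤o _ _ N≤i))
                                       (proj₂ (hg _ (half 0<δ)) i (ℕₚ.m⊔n≤o⇒n≤o _ _ N≤i)) ⟩
      δ * ½ + δ * ½  ≡⟨ half+half δ ⟩
      δ  ∎
    where open ≤-Reasoning

  null-* : ∀ q {f} → Null f → Null (λ i → q * f i)
  null-* q {f} h δ 0<δ = proj₁ (h η 0<η) , λ i N≤i → begin
      ∣ q * f i ∣  ≡⟨ ∣p*q∣≡∣p∣*∣q∣ q (f i) ⟩
      ∣ q ∣ * ∣ f i ∣  ≤⟨ *-monoʳ {∣ f i ∣} {∣ q ∣} (0≤∣p∣ (f i)) (p≤p+q 0≤1) ⟩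
      b * ∣ f i ∣  ≤⟨ *-monoˡ (<⇒≤ 0<b) (proj₂ (h η 0<η) i N≤i) ⟩
      b * (δ * inv b)  ≡⟨ *-swap b δ (inv b) ⟩
      δ * (b * inv b)  ≡⟨ cong (δ *_) (*-inv 0<b) ⟩
      δ * 1ℚ  ≡⟨ *-identityʳ δ ⟩
      δ  ∎
    where
    open ≤-Reasoning
    b = ∣ q ∣ + 1ℚ
    0<b : 0ℚ < b
    0<b = +-mono-≤-< (0≤∣p∣ q) 0<1
    η = δ * inv b
    0<η : 0ℚ < η
    0<η = subst (_< η) (*-zeroˡ (inv b)) (*-monoˡ-<-pos (inv b) {{positive (inv-pos 0<b)}} 0<δ)

  -- Equality with 0 is undecidable but stable. At an index `N` from the modulus of convergence, the
  -- rational comparison of `|x_N|` with `δ / 2` is decidable. If it succeeds, all later terms are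
  -- within `δ`; if it fails, `x ≃ᴿ 0ᴿ` is refuted.
  null-stable : ∀ x → ¬ ¬ (x ≃ᴿ 0ᴿ) → Null (seq x)
  null-stable x ¬¬x≃0 δ 0<δ = N , by-cases (∣ seq x N ∣ ≤? δ * ½)
    where
    open ≤-Reasoning
    η = δ * ½ * ½
    0<η = half (half 0<δ)
    N = proj₁ (cauchy x η 0<η)
    near : ∀ m n → N ℕ.≤ m → N ℕ.≤ n → ∣ seq x m - seq x n ∣ ≤ η
    near = proj₂ (cauchy x η 0<η)
    eq₂ : ∀ p q → p ≡ (p - q) + (q - 0ℚ)
    eq₂ = solve-∀ ℚ-ring
    bound : x ≃ᴿ 0ᴿ → ∣ seq x N ∣ ≤ δ * ½
    bound x≃0 = begin
      ∣ seq x N ∣  ≡⟨ cong ∣_∣ (eq₂ (seq x N) (seq x i)) ⟩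
      ∣ (seq x N - seq x i) + (seq x i - 0ℚ) ∣  ≤⟨ ∣p+q∣≤∣p∣+∣q∣ (seq x N - seq x i) (seq x i - 0ℚ) ⟩
      ∣ seq x N - seq x i ∣ + ∣ seq x i - 0ℚ ∣  ≤⟨ +-mono-≤ (near N i ℕₚ.≤-refl (ℕₚ.m≤m⊔n N M)) (proj₂ (x≃0 η 0<η) i (ℕₚ.m≤n⊔m N M)) ⟩
      η + η  ≡⟨ half+half (δ * ½) ⟩
      δ * ½  ∎
      where
      M = proj₁ (x≃0 η 0<η)
      i = N ℕ.⊔ M
    by-cases : Dec (∣ seq x N ∣ ≤ δ * ½) → ∀ i → N ℕ.≤ i → ∣ seq x i ∣ ≤ δ
    by-cases (yes small) i N≤i = begin
      ∣ seq x i ∣  ≡⟨ cong ∣_∣ (p≡p-q+q (seq x i) (seq x N)) ⟩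
      ∣ (seq x i - seq x N) + seq x N ∣  ≤⟨ ∣p+q∣≤∣p∣+∣q∣ (seq x i - seq x N) (seq x N) ⟩
      ∣ seq x i - seq x N ∣ + ∣ seq x N ∣  ≤⟨ +-mono-≤ (≤-trans (near i N N≤i ℕₚ.≤-refl)
          (subst (η ≤_) (half+half (δ * ½)) (p≤p+q (<⇒≤ 0<η)))) small ⟩
      δ * ½ + δ * ½  ≡⟨ half+half δ ⟩
      δ  ∎
    by-cases (no large) = contradiction (λ x≃0 → large (bound x≃0)) ¬¬x≃0

  -- The solutions and the linear form are rational, so every operation used acts on real and
  -- imaginary parts separately and one argument serves both.
  data Part : Set where
    real imaginary : Part

  part : Part → ℂ → ℝ
  part real      = re
  part imaginary = im

  approx : Part → ℕ → ℂ → ℚ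
  approx p i c = seq (part p c) i

  approx-scale : ∀ p i q c → approx p i (fromℚᶜ q *ᶜ c) ≡ q * approx p i c
  approx-scale real i q c = eq q (seq (re c) i) (seq (im c) i)
    where
    eq : ∀ q a b → q * a + - (0ℚ * b) ≡ q * a
    eq = solve-∀ ℚ-ring
  approx-scale imaginary i q c = eq q (seq (re c) i) (seq (im c) i)
    where
    eq : ∀ q a b → q * b + 0ℚ * a ≡ q * b
    eq = solve-∀ ℚ-ring

  approx-+ : ∀ p i c d → approx p i (c +ᶜ d) ≡ approx p i c + approx p i d
  approx-+ real      i c d = refl
  approx-+ imaginary i c d = refl

  approx-0 : ∀ p i → approx p i 0ᶜ ≡ 0ℚ
  approx-0 real      i = refl
  approx-0 imaginary i = refl

  ≃ᶜ-parts : ∀ {w z} → (∀ p → Null (λ i → approx p i w - approx p i z)) → w ≃ᶜ z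
  ≃ᶜ-parts h = h real , h imaginary

  ≃ᶜ0⇒null : ∀ {z} → z ≃ᶜ 0ᶜ → ∀ p → Null (λ i → approx p i z)
  ≃ᶜ0⇒null {z} h p = null-≗ (λ i → eq (approx p i z)) (select p h)
    where
    eq : ∀ a → a - 0ℚ ≡ a
    eq = solve-∀ ℚ-ring
    select : ∀ p → z ≃ᶜ 0ᶜ → Null (λ i → approx p i z - 0ℚ)
    select real      = proj₁
    select imaginary = proj₂

  ¬occurs⇒null : ∀ {z} → ¬ ¬ (z ≃ᶜ 0ᶜ) → ∀ p → Null (λ i → approx p i z)
  ¬occurs⇒null {z} h real      = null-stable (re z) (λ ¬re → h (λ z≃0 → ¬re (proj₁ z≃0)))
  ¬occurs⇒null {z} h imaginary = null-stable (im z) (λ ¬im → h (λ z≃0 → ¬im (proj₂ z≃0)))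

  sumOver : ∀ {A : Set} → (A → ℚ) → List A → ℚ
  sumOver f []       = 0ℚ
  sumOver f (x ∷ xs) = f x + sumOver f xs

  sumOver-++ : ∀ {A : Set} (f : A → ℚ) xs ys → sumOver f (xs ++ ys) ≡ sumOver f xs + sumOver f ys
  sumOver-++ f []       ys = sym (+-identityˡ (sumOver f ys))
  sumOver-++ f (x ∷ xs) ys = trans (cong (f x +_) (sumOver-++ f xs ys))
    (sym (+-assoc (f x) (sumOver f xs) (sumOver f ys)))

  sumOver-map : ∀ {A B : Set} (f : B → ℚ) (g : A → B) xs → sumOver f (List.map g xs) ≡ sumOver (f ∘ g) xs
  sumOver-map f g []       = refl
  sumOver-map f g (x ∷ xs) = cong (f (g x) +_) (sumOver-map f g xs)

  sumOver-cong : ∀ {A : Set} {f g : A → ℚ} {xs} → All (λ x → f x ≡ g x) xs → sumOver f xs ≡ sumOver g xs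
  sumOver-cong []       = refl
  sumOver-cong (e ∷ es) = cong₂ _+_ e (sumOver-cong es)

  sumOver-cong′ : ∀ {A : Set} {f g : A → ℚ} → (∀ x → f x ≡ g x) → ∀ xs → sumOver f xs ≡ sumOver g xs
  sumOver-cong′ h xs = sumOver-cong (All.universal h xs)

  sumOver-0 : ∀ {A : Set} (xs : List A) → sumOver (λ _ → 0ℚ) xs ≡ 0ℚ
  sumOver-0 []       = refl
  sumOver-0 (x ∷ xs) = trans (+-identityˡ _) (sumOver-0 xs)

  sumOver-+ : ∀ {A : Set} (f g : A → ℚ) xs → sumOver (λ x → f x + g x) xs ≡ sumOver f xs + sumOver g xs
  sumOver-+ f g []       = refl
  sumOver-+ f g (x ∷ xs) = trans (cong (f x + g x +_) (sumOver-+ f g xs))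
    (+-interchange (f x) (g x) (sumOver f xs) (sumOver g xs))

  sumOver-* : ∀ {A : Set} q (f : A → ℚ) xs → sumOver (λ x → q * f x) xs ≡ q * sumOver f xs
  sumOver-* q f []       = sym (*-zeroʳ q)
  sumOver-* q f (x ∷ xs) = trans (cong (q * f x +_) (sumOver-* q f xs)) (sym (*-distribˡ-+ q (f x) _))

  sumOver-swap : ∀ {A B : Set} (f : A → B → ℚ) xs ys →
    sumOver (λ x → sumOver (f x) ys) xs ≡ sumOver (λ y → sumOver (λ x → f x y) xs) ys
  sumOver-swap f []       ys = sym (sumOver-0 ys)
  sumOver-swap f (x ∷ xs) ys = trans (cong (sumOver (f x) ys +_) (sumOver-swap f xs ys))
    (sym (sumOver-+ (f x) (λ y → sumOver (λ x → f x y) xs) ys))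

  null-sumOver : ∀ {A : Set} (f : A → ℕ → ℚ) xs → All (λ x → Null (f x)) xs → Null (λ i → sumOver (λ x → f x i) xs)
  null-sumOver f []       []       = null-0
  null-sumOver f (x ∷ xs) (h ∷ hs) = null-+ h (null-sumOver f xs hs)

  -- The i-th approximation to ∑ φ(k) c over the terms (c , k) of P; evaluations
  -- and coefficient extraction are instances.
  pairing : ∀ {K : Set} → Part → ℕ → (K → ℚ) → List (ℂ × K) → ℚ
  pairing p i φ = sumOver λ (c , k) → φ k * approx p i c

  Vanishes : ∀ {K : Set} → (K → ℚ) → List (ℂ × K) → Set
  Vanishes φ P = ∀ p → Null (λ i → pairing p i φ P)

  monomial : ∀ {n} → Vec ℚ n → Vec ℕ n → ℚ
  monomial x k = Vec.foldr′ _*_ 1ℚ (Vec.zipWith _^_ x k)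

  indicator : ∀ {n} → Vec ℕ n → Vec ℕ n → ℚ
  indicator e k with Vecₚ.≡-dec ℕₚ._≟_ k e
  ... | yes _ = 1ℚ
  ... | no  _ = 0ℚ

  pairing-indicator : ∀ {n} p i (e : Vec ℕ n) (P : Poly n) → approx p i (coeff P e) ≡ pairing p i (indicator e) P
  pairing-indicator p i e [] = approx-0 p i
  pairing-indicator p i e ((c , k) ∷ P) with Vecₚ.≡-dec ℕₚ._≟_ k e
  ... | yes _ = trans (approx-+ p i c (coeff P e))
    (cong₂ _+_ (sym (*-identityˡ (approx p i c))) (pairing-indicator p i e P))
  ... | no  _ = trans (pairing-indicator p i e P) (eq (approx p i c) (pairing p i (indicator e) P))
    where
    eq : ∀ a b → b ≡ 0ℚ * a + b
    eq = solve-∀ ℚ-ring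

  private
    power-parts : ∀ q k i → approx real i (fromℚᶜ q ^ᶜ k) ≡ q ^ k × approx imaginary i (fromℚᶜ q ^ᶜ k) ≡ 0ℚ
    power-parts q zero    i = refl , refl
    power-parts q (suc k) i =
      trans (approx-scale real i q (fromℚᶜ q ^ᶜ k)) (cong (q *_) (proj₁ (power-parts q k i))) ,
      trans (approx-scale imaginary i q (fromℚᶜ q ^ᶜ k)) (trans (cong (q *_) (proj₂ (power-parts q k i))) (*-zeroʳ q))

    monomial-parts : ∀ {n} (x : Vec ℚ n) k i →
      let z = Vec.foldr′ _*ᶜ_ 1ᶜ (Vec.zipWith _^ᶜ_ (Vec.map fromℚᶜ x) k)
      in approx real i z ≡ monomial x k × approx imaginary i z ≡ 0ℚ
    monomial-parts []      []      i = refl , refl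
    monomial-parts (q ∷ x) (k ∷ l) i =
      let a , b = power-parts q k i ; c , d = monomial-parts x l i in
      trans (cong₂ _-_ (cong₂ _*_ a c) (cong₂ _*_ b d)) (eq₁ (q ^ k * monomial x l)) ,
      trans (cong₂ _+_ (cong₂ _*_ a d) (cong₂ _*_ b c)) (eq₂ (q ^ k) (monomial x l))
      where
      eq₁ : ∀ a → a - 0ℚ * 0ℚ ≡ a
      eq₁ = solve-∀ ℚ-ring
      eq₂ : ∀ a b → a * 0ℚ + 0ℚ * b ≡ 0ℚ
      eq₂ = solve-∀ ℚ-ring

  pairing-monomial : ∀ {n} p i (x : Vec ℚ n) (P : Poly n) →
    approx p i (eval P (Vec.map fromℚᶜ x)) ≡ pairing p i (monomial x) P
  pairing-monomial p i x [] = approx-0 p i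
  pairing-monomial real i x ((c , k) ∷ P) = cong₂ _+_
    (trans (cong₂ (λ s t → seq (re c) i * s - seq (im c) i * t)
        (proj₁ (monomial-parts x k i)) (proj₂ (monomial-parts x k i)))
      (eq (seq (re c) i) (seq (im c) i) (monomial x k)))
    (pairing-monomial real i x P)
    where
    eq : ∀ a b m → a * m - b * 0ℚ ≡ m * a
    eq = solve-∀ ℚ-ring
  pairing-monomial imaginary i x ((c , k) ∷ P) = cong₂ _+_
    (trans (cong₂ (λ s t → seq (re c) i * t + seq (im c) i * s)
        (proj₁ (monomial-parts x k i)) (proj₂ (monomial-parts x k i)))
      (eq (seq (re c) i) (seq (im c) i) (monomial x k)))
    (pairing-monomial imaginary i x P)
    where
    eq : ∀ a b m → a * 0ℚ + b * m ≡ m * b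
    eq = solve-∀ ℚ-ring

  indicator-refl : ∀ {n} (e : Vec ℕ n) → indicator e e ≡ 1ℚ
  indicator-refl e with Vecₚ.≡-dec ℕₚ._≟_ e e
  ... | yes _   = refl
  ... | no  e≢e = contradiction refl e≢e

  indicator-≢ : ∀ {n} {e k : Vec ℕ n} → k ≢ e → indicator e k ≡ 0ℚ
  indicator-≢ {e = e} {k} k≢e with Vecₚ.≡-dec ℕₚ._≟_ k e
  ... | yes k≡e = contradiction k≡e k≢e
  ... | no  _   = refl

  sumOver-indicator : ∀ {n} (φ : Vec ℕ n → ℚ) {E} → Unique E → ∀ {k} → k ∈ E →
    sumOver (λ e → φ e * indicator e k) E ≡ φ k
  sumOver-indicator φ {e ∷ E} (e∉E ∷ _) {k} (here refl) = begin
    φ k * indicator k k + sumOver (λ e → φ e * indicator e k) E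
      ≡⟨ cong₂ _+_ (cong (φ k *_) (indicator-refl k))
          (sumOver-cong (All.map (λ {e} k≢e → trans (cong (φ e *_) (indicator-≢ k≢e)) (*-zeroʳ (φ e))) e∉E)) ⟩
    φ k * 1ℚ + sumOver (λ _ → 0ℚ) E  ≡⟨ cong₂ _+_ (*-identityʳ (φ k)) (sumOver-0 E) ⟩
    φ k + 0ℚ  ≡⟨ +-identityʳ (φ k) ⟩
    φ k  ∎
    where open ≡-Reasoning
  sumOver-indicator φ {e ∷ E} (e∉E ∷ uE) {k} (there k∈E) = begin
    φ e * indicator e k + sumOver (λ e → φ e * indicator e k) E
      ≡⟨ cong₂ _+_ (trans (cong (φ e *_) (indicator-≢ (λ k≡e → All.lookup e∉E k∈E (sym k≡e)))) (*-zeroʳ (φ e)))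
          (sumOver-indicator φ uE k∈E) ⟩
    0ℚ + φ k  ≡⟨ +-identityˡ (φ k) ⟩
    φ k  ∎
    where open ≡-Reasoning

  -- Exponents may repeat in the list of terms. Expanding `φ` in the indicators of the distinct
  -- exponents `E` collects equal ones, and each collected sum is a coefficient.
  pairing-by-coefficients : ∀ {n} p i (φ : Vec ℕ n → ℚ) {E} → Unique E → (P : Poly n) →
    All (λ t → proj₂ t ∈ E) P →
    sumOver (λ e → φ e * pairing p i (indicator e) P) E ≡ pairing p i φ P
  pairing-by-coefficients p i φ {E} uE P P⊆E = begin
    sumOver (λ e → φ e * pairing p i (indicator e) P) E
      ≡⟨ sumOver-cong′ (λ e → sym (sumOver-* (φ e) (λ (c , k) → indicator e k * approx p i c) P)) E ⟩
    sumOver (λ e → sumOver (λ (c , k) → φ e * (indicator e k * approx p i c)) P) E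
      ≡⟨ sumOver-swap (λ e (c , k) → φ e * (indicator e k * approx p i c)) E P ⟩
    sumOver (λ (c , k) → sumOver (λ e → φ e * (indicator e k * approx p i c)) E) P
      ≡⟨ sumOver-cong (All.map (λ {t} k∈E → term t k∈E) P⊆E) ⟩
    pairing p i φ P  ∎
    where
    open ≡-Reasoning
    eq : ∀ a b c → a * (b * c) ≡ c * (a * b)
    eq = solve-∀ ℚ-ring
    term : ∀ t → proj₂ t ∈ E →
      sumOver (λ e → φ e * (indicator e (proj₂ t) * approx p i (proj₁ t))) E ≡ φ (proj₂ t) * approx p i (proj₁ t)
    term (c , k) k∈E = begin
      sumOver (λ e → φ e * (indicator e k * approx p i c)) E  ≡⟨ sumOver-cong′ (λ e → eq (φ e) (indicator e k) (approx p i c)) E ⟩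
      sumOver (λ e → approx p i c * (φ e * indicator e k)) E  ≡⟨ sumOver-* (approx p i c) (λ e → φ e * indicator e k) E ⟩
      approx p i c * sumOver (λ e → φ e * indicator e k) E  ≡⟨ cong (approx p i c *_) (sumOver-indicator φ uE k∈E) ⟩
      approx p i c * φ k  ≡⟨ *-comm (approx p i c) (φ k) ⟩
      φ k * approx p i c  ∎

  vanishes-by-coefficients : ∀ {n} (φ : Vec ℕ n → ℚ) (P : Poly n) →
    (∀ e → φ e ≡ 0ℚ ⊎ Vanishes (indicator e) P) → Vanishes φ P
  vanishes-by-coefficients φ P h p = null-≗
    (λ i → pairing-by-coefficients p i φ (deduplicate-! _≟ᵛ_ exponents) P
      (All.tabulate λ t∈P → ∈-deduplicate⁺ _≟ᵛ_ (∈-map⁺ proj₂ t∈P)))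
    (null-sumOver (λ e i → φ e * pairing p i (indicator e) P) E (All.universal term E))
    where
    _≟ᵛ_ = Vecₚ.≡-dec ℕₚ._≟_
    exponents = List.map proj₂ P
    E = List.deduplicate _≟ᵛ_ exponents
    term : ∀ e → Null (λ i → φ e * pairing p i (indicator e) P)
    term e with h e
    ... | inj₁ φe≡0 = null-≗ (λ i → trans (sym (*-zeroˡ (pairing p i (indicator e) P)))
                        (cong (_* pairing p i (indicator e) P) (sym φe≡0))) null-0
    ... | inj₂ v    = null-* (φ e) (v p)

  -- A list may contain terms of degree above `d` whose coefficients cancel. Only after dropping
  -- them does the degree bound hold term by term, as the division below requires.
  lowDegree : ∀ {n} → ℕ → Poly n → Poly n
  lowDegree d []            = []
  lowDegree d ((c , k) ∷ P) with Vec.sum k ℕₚ.≤? d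
  ... | yes _ = (c , k) ∷ lowDegree d P
  ... | no  _ = lowDegree d P

  -- The difference is again a functional of `P`, namely `φ` cut off to degrees above `d`, and so
  -- involves only coefficients that vanish.
  pairing-lowDegree : ∀ {n} d (φ : Vec ℕ n → ℚ) (P : Poly n) →
    (∀ e → d ℕ.< Vec.sum e → Vanishes (indicator e) P) →
    ∀ p → Null (λ i → pairing p i φ P - pairing p i φ (lowDegree d P))
  pairing-lowDegree {n} d φ P h p = null-≗ (λ i → split p i P) (vanishes-by-coefficients high P cases p)
    where
    high : Vec ℕ n → ℚ
    high e with Vec.sum e ℕₚ.≤? d
    ... | yes _ = 0ℚ
    ... | no  _ = φ e
    cases : ∀ e → high e ≡ 0ℚ ⊎ Vanishes (indicator e) P
    cases e with Vec.sum e ℕₚ.≤? d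
    ... | yes _ = inj₁ refl
    ... | no  l = inj₂ (h e (ℕₚ.≰⇒> l))
    split : ∀ p i P → pairing p i high P ≡ pairing p i φ P - pairing p i φ (lowDegree d P)
    split p i [] = refl
    split p i ((c , k) ∷ P) with Vec.sum k ℕₚ.≤? d
    ... | yes _ = trans (cong (0ℚ * approx p i c +_) (split p i P))
      (eq (approx p i c) (φ k * approx p i c) (pairing p i φ P) (pairing p i φ (lowDegree d P)))
      where
      eq : ∀ z a b t → 0ℚ * z + (b - t) ≡ a + b - (a + t)
      eq = solve-∀ ℚ-ring
    ... | no  _ = trans (cong (φ k * approx p i c +_) (split p i P))
      (sym (+-assoc (φ k * approx p i c) (pairing p i φ P) (- pairing p i φ (lowDegree d P))))

  -- Division by a₁X₁ + ⋯ + aₙXₙ - 1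

  dot : ∀ {n} → (Fin n → ℚ) → (Fin n → ℚ) → ℚ
  dot {zero}  b f = 0ℚ
  dot {suc n} b f = b zero * f zero + dot (b ∘ suc) (f ∘ suc)

  raise : ∀ {n} → Fin n → Vec ℕ n → Vec ℕ n
  raise {n} j k = Vec.zipWith ℕ._+_ (Vec.replicate n 0 Vec.[ j ]≔ 1) k

  -- The transpose of multiplication by a₁X₁ + ⋯ + aₙXₙ - 1.
  transpose : ∀ {n} → Vec ℚ n → (Vec ℕ n → ℚ) → Vec ℕ n → ℚ
  transpose a φ k = - φ k + dot (Vec.lookup a) (λ j → φ (raise j k))

  zipWith-replicate-0 : ∀ {n} (k : Vec ℕ n) → Vec.zipWith ℕ._+_ (Vec.replicate n 0) k ≡ k
  zipWith-replicate-0 = Vecₚ.zipWith-identityˡ ℕₚ.+-identityˡ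

  raise-zero : ∀ {n} k (ks : Vec ℕ n) → raise zero (k ∷ ks) ≡ suc k ∷ ks
  raise-zero k ks = cong (suc k ∷_) (zipWith-replicate-0 ks)

  sum-raise : ∀ {n} (j : Fin n) k → Vec.sum (raise j k) ≡ suc (Vec.sum k)
  sum-raise zero    (k ∷ ks) = cong (Vec.sum) (raise-zero k ks)
  sum-raise (suc j) (k ∷ ks) = trans (cong (k ℕ.+_) (sum-raise j ks)) (ℕₚ.+-suc k (Vec.sum ks))

  -- Abstract, because comparing unfolded complex numbers compares the Cauchy
  -- proofs inside them.
  abstract
    _•_ : ℚ → ℂ → ℂ
    q • c = fromℚᶜ q *ᶜ c

    approx-• : ∀ p i q c → approx p i (q • c) ≡ q * approx p i c
    approx-• = approx-scale

  module _ (p : Part) (i : ℕ) where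

    pairing-+ : ∀ {K : Set} (φ ψ : K → ℚ) P → pairing p i (λ k → φ k + ψ k) P ≡ pairing p i φ P + pairing p i ψ P
    pairing-+ φ ψ P = trans
      (sumOver-cong′ (λ (c , k) → *-distribʳ-+ (approx p i c) (φ k) (ψ k)) P)
      (sumOver-+ (λ (c , k) → φ k * approx p i c) (λ (c , k) → ψ k * approx p i c) P)

    pairing-∷-*ᴾ : ∀ {n} φ q (l : Vec ℕ n) (L R : Poly n) →
      pairing p i φ (((fromℚᶜ q , l) ∷ L) *ᴾ R) ≡
      pairing p i (λ k → q * φ (Vec.zipWith ℕ._+_ l k)) R + pairing p i φ (L *ᴾ R)
    pairing-∷-*ᴾ φ q l L R = trans
      (sumOver-++ (λ (c , k) → φ k * approx p i c) (List.map (λ (d , k) → fromℚᶜ q *ᶜ d , Vec.zipWith ℕ._+_ l k) R) (L *ᴾ R))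
      (cong (_+ pairing p i φ (L *ᴾ R)) (trans
        (sumOver-map (λ (c , k) → φ k * approx p i c) (λ (d , k) → fromℚᶜ q *ᶜ d , Vec.zipWith ℕ._+_ l k) R)
        (sumOver-cong′ (λ (d , k) → trans (cong (φ (Vec.zipWith ℕ._+_ l k) *_) (approx-scale p i q d))
          (eq (φ (Vec.zipWith ℕ._+_ l k)) q (approx p i d))) R)))
      where
      eq : ∀ a b c → a * (b * c) ≡ b * a * c
      eq = solve-∀ ℚ-ring

    pairing-0 : ∀ {K : Set} (P : List (ℂ × K)) → pairing p i (λ _ → 0ℚ) P ≡ 0ℚ
    pairing-0 P = trans (sumOver-cong′ (λ (c , _) → *-zeroˡ (approx p i c)) P) (sumOver-0 P)

    pairing-tabulate-*ᴾ : ∀ {m n} φ (b : Fin m → ℚ) (e : Fin m → Vec ℕ n) (R : Poly n) →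
      pairing p i φ (List.tabulate (λ j → fromℚᶜ (b j) , e j) *ᴾ R) ≡
      pairing p i (λ k → dot b (λ j → φ (Vec.zipWith ℕ._+_ (e j) k))) R
    pairing-tabulate-*ᴾ {zero}  φ b e R = sym (pairing-0 R)
    pairing-tabulate-*ᴾ {suc m} φ b e R = trans
      (pairing-∷-*ᴾ φ (b zero) (e zero) (List.tabulate (λ j → fromℚᶜ (b (suc j)) , e (suc j))) R)
      (trans (cong (pairing p i (λ k → b zero * φ (Vec.zipWith ℕ._+_ (e zero) k)) R +_) (pairing-tabulate-*ᴾ φ (b ∘ suc) (e ∘ suc) R))
        (sym (pairing-+ (λ k → b zero * φ (Vec.zipWith ℕ._+_ (e zero) k)) (λ k → dot (b ∘ suc) (λ j → φ (Vec.zipWith ℕ._+_ (e (suc j)) k))) R)))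

    pairing-linearMinusOne-*ᴾ : ∀ {n} (a : Vec ℚ n) φ (R : Poly n) →
      pairing p i φ (linearMinusOne a *ᴾ R) ≡ pairing p i (transpose a φ) R
    pairing-linearMinusOne-*ᴾ {n} a φ R = begin
      pairing p i φ (linearMinusOne a *ᴾ R)
        ≡⟨ pairing-∷-*ᴾ φ (- 1ℚ) (Vec.replicate n 0) (List.tabulate λ j → fromℚᶜ (Vec.lookup a j) , Vec.replicate n 0 Vec.[ j ]≔ 1) R ⟩
      pairing p i (λ k → - 1ℚ * φ (Vec.zipWith ℕ._+_ (Vec.replicate n 0) k)) R + pairing p i φ ((List.tabulate λ j → fromℚᶜ (Vec.lookup a j) , Vec.replicate n 0 Vec.[ j ]≔ 1) *ᴾ R)
        ≡⟨ cong₂ _+_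
            (sumOver-cong′ (λ (c , k) → cong (_* approx p i c) (trans (eq (φ (Vec.zipWith ℕ._+_ (Vec.replicate n 0) k)))
              (cong (λ t → - φ t) (zipWith-replicate-0 k)))) R)
            (pairing-tabulate-*ᴾ φ (Vec.lookup a) (λ j → Vec.replicate n 0 Vec.[ j ]≔ 1) R) ⟩
      pairing p i (λ k → - φ k) R + pairing p i (λ k → dot (Vec.lookup a) (λ j → φ (raise j k))) R
        ≡⟨ pairing-+ (λ k → - φ k) (λ k → dot (Vec.lookup a) (λ j → φ (raise j k))) R ⟨
      pairing p i (transpose a φ) R ∎
      where
      open ≡-Reasoning
      eq : ∀ a → - 1ℚ * a ≡ - a
      eq = solve-∀ ℚ-ring

    pairing-negated-tabulate : ∀ {m} {K : Set} (φ : K → ℚ) (b : Fin m → ℚ) (e : Fin m → K) c →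
      pairing p i φ (List.tabulate (λ j → (- b j) • c , e j)) ≡ - dot b (λ j → φ (e j)) * approx p i c
    pairing-negated-tabulate {zero}  φ b e c = sym (*-zeroˡ (approx p i c))
    pairing-negated-tabulate {suc m} φ b e c = trans
      (cong₂ _+_ (cong (φ (e zero) *_) (approx-• p i (- b zero) c)) (pairing-negated-tabulate φ (b ∘ suc) (e ∘ suc) c))
      (eq (φ (e zero)) (b zero) (approx p i c) (dot (b ∘ suc) (λ j → φ (e (suc j)))))
      where
      eq : ∀ f b c d → f * (- b * c) + - d * c ≡ - (b * f + d) * c
      eq = solve-∀ ℚ-ring

  DegreeAtMost : ∀ {n} → ℕ → Poly n → Set
  DegreeAtMost d = All (λ t → Vec.sum (proj₂ t) ℕ.≤ d)

  lowDegree-degree : ∀ {n} d (P : Poly n) → DegreeAtMost d (lowDegree d P)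
  lowDegree-degree d []            = []
  lowDegree-degree d ((c , k) ∷ P) with Vec.sum k ℕₚ.≤? d
  ... | yes h = h ∷ lowDegree-degree d P
  ... | no  _ = lowDegree-degree d P

  private
    -- a₁X₁ · c X^k ≡ c X^k - a₂X₂ · c X^k - ⋯ modulo a₁X₁ + ⋯ + aₙXₙ - 1.
    replacement : ∀ {n} → Vec ℚ n → ℂ → Vec ℕ n → Poly n
    replacement as c ks = (c , ks) ∷ List.tabulate λ j → (- Vec.lookup as j) • c , raise j ks

    pairing-replacement : ∀ {n} (a : ℚ) (as : Vec ℚ n) → a ≢ 0ℚ → ∀ k p i φ c c′ ks →
      approx p i c′ ≡ inv a * approx p i c →
      φ (suc k ∷ ks) * approx p i c ≡
      pairing p i (φ ∘ (k ∷_)) (replacement as c′ ks) + transpose (a ∷ as) φ (k ∷ ks) * approx p i c′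
    pairing-replacement a as a≢0 k p i φ c c′ ks c′≡ = begin
      φ (suc k ∷ ks) * v  ≡⟨ *-identityʳ _ ⟨
      φ (suc k ∷ ks) * v * 1ℚ  ≡⟨ cong (φ (suc k ∷ ks) * v *_) (inv-inverse a≢0) ⟨
      φ (suc k ∷ ks) * v * (a * inv a)  ≡⟨ eq₁ (φ (suc k ∷ ks)) v a (inv a) ψ D ⟩
      (ψ * (inv a * v) + - D * (inv a * v)) + (- ψ + (a * φ (suc k ∷ ks) + D)) * (inv a * v)
        ≡⟨ cong (λ t → (ψ * t + - D * t) + (- ψ + (a * φ (suc k ∷ ks) + D)) * t) c′≡ ⟨
      (ψ * w + - D * w) + (- ψ + (a * φ (suc k ∷ ks) + D)) * w
        ≡⟨ cong₂ (λ s t → (ψ * w + s) + (- ψ + (a * φ t + D)) * w)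
            (sym (pairing-negated-tabulate p i (φ ∘ (k ∷_)) (Vec.lookup as) (λ j → raise j ks) c′))
            (sym (raise-zero k ks)) ⟩
      pairing p i (φ ∘ (k ∷_)) (replacement as c′ ks) + transpose (a ∷ as) φ (k ∷ ks) * w ∎
      where
      open ≡-Reasoning
      v = approx p i c
      w = approx p i c′
      ψ = φ (k ∷ ks)
      D = dot (Vec.lookup as) (λ j → φ (k ∷ raise j ks))
      eq₁ : ∀ f v a b s d → f * v * (a * b) ≡ (s * (b * v) + - d * (b * v)) + (- s + (a * f + d)) * (b * v)
      eq₁ = solve-∀ ℚ-ring

    -- Each step lowers the exponent of X₁ by one and raises the degree in the other variables by at
    -- most one, whence `k + d`. The multiples of the linear form split off on the way are collected
    -- in `R`. Both `F` and `R` are chosen before `p`, `i` and `φ`, so one quotient serves all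
    -- functionals.
    divide : ∀ {n} (a : ℚ) (as : Vec ℚ n) → a ≢ 0ℚ → ∀ k {d} (T : Poly n) → DegreeAtMost d T →
      ∃[ F ] ∃[ R ] (DegreeAtMost (k ℕ.+ d) F × (∀ p i φ →
        pairing p i (φ ∘ (k ∷_)) T ≡ pairing p i (φ ∘ (0 ∷_)) F + pairing p i (transpose (a ∷ as) φ) R))
    divide a as a≢0 zero    T deg = T , [] , deg , λ p i φ → sym (+-identityʳ (pairing p i (φ ∘ (0 ∷_)) T))
    divide {n} a as a≢0 (suc k) {d} T deg =
      F , R′ ++ R , subst (λ t → DegreeAtMost t F) (ℕₚ.+-suc k d) degF , λ p i φ → begin
        pairing p i (φ ∘ (suc k ∷_)) T
          ≡⟨ rewritten p i φ T ⟩
        pairing p i (φ ∘ (k ∷_)) (List.concatMap step T) + pairing p i (ℒ φ) (List.map scaled T)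
          ≡⟨ cong (_+ pairing p i (ℒ φ) R′) (eqF p i φ) ⟩
        pairing p i (φ ∘ (0 ∷_)) F + pairing p i (ℒ φ) R + pairing p i (ℒ φ) R′
          ≡⟨ eq (pairing p i (φ ∘ (0 ∷_)) F) (pairing p i (ℒ φ) R) (pairing p i (ℒ φ) R′) ⟩
        pairing p i (φ ∘ (0 ∷_)) F + (pairing p i (ℒ φ) R′ + pairing p i (ℒ φ) R)
          ≡⟨ cong (pairing p i (φ ∘ (0 ∷_)) F +_) (sumOver-++ (λ (c , l) → ℒ φ l * approx p i c) R′ R) ⟨
        pairing p i (φ ∘ (0 ∷_)) F + pairing p i (ℒ φ) (R′ ++ R) ∎
      where
      open ≡-Reasoning
      ℒ = transpose (a ∷ as)
      eq : ∀ a b c → a + b + c ≡ a + (c + b)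
      eq = solve-∀ ℚ-ring
      scaledCoefficient : ℂ → ℂ
      scaledCoefficient c = inv a • c
      scaled : ℂ × Vec ℕ n → ℂ × Vec ℕ (suc n)
      scaled t = scaledCoefficient (proj₁ t) , k ∷ proj₂ t
      step : ℂ × Vec ℕ n → Poly n
      step t = replacement as (scaledCoefficient (proj₁ t)) (proj₂ t)
      deg-step : ∀ {t} → Vec.sum (proj₂ t) ℕ.≤ d → DegreeAtMost (suc d) (step t)
      deg-step {t} h = ℕₚ.m≤n⇒m≤1+n h ∷
        Allₚ.tabulate⁺ λ j → subst (ℕ._≤ suc d) (sym (sum-raise j (proj₂ t))) (ℕ.s≤s h)
      rest = divide a as a≢0 k (List.concatMap step T) (Allₚ.concat⁺ (Allₚ.map⁺ (All.map deg-step deg)))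
      F = proj₁ rest
      R = proj₁ (proj₂ rest)
      degF = proj₁ (proj₂ (proj₂ rest))
      eqF = proj₂ (proj₂ (proj₂ rest))
      R′ = List.map scaled T
      rewritten : ∀ p i φ T → pairing p i (φ ∘ (suc k ∷_)) T ≡
        pairing p i (φ ∘ (k ∷_)) (List.concatMap step T) + pairing p i (ℒ φ) (List.map scaled T)
      rewritten p i φ []      = refl
      rewritten p i φ (t ∷ T) = begin
        φ (suc k ∷ proj₂ t) * approx p i (proj₁ t) + pairing p i (φ ∘ (suc k ∷_)) T
          ≡⟨ cong₂ _+_ (pairing-replacement a as a≢0 k p i φ (proj₁ t) (scaledCoefficient (proj₁ t)) (proj₂ t) (approx-• p i (inv a) (proj₁ t))) (rewritten p i φ T) ⟩
        (A + B) + (C + D)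
          ≡⟨ +-interchange A B C D ⟩
        (A + C) + (B + D)
          ≡⟨ cong (_+ (B + D)) (sumOver-++ (λ (c , l) → φ (k ∷ l) * approx p i c) (step t) (List.concatMap step T)) ⟨
        pairing p i (φ ∘ (k ∷_)) (List.concatMap step (t ∷ T)) + pairing p i (ℒ φ) (List.map scaled (t ∷ T)) ∎
        where
        A = pairing p i (φ ∘ (k ∷_)) (step t)
        B = ℒ φ (k ∷ proj₂ t) * approx p i (scaledCoefficient (proj₁ t))
        C = pairing p i (φ ∘ (k ∷_)) (List.concatMap step T)
        D = pairing p i (ℒ φ) (List.map scaled T)

  -- Substituting for X₁ an affine form in the other variables does not raise the total degree. Each
  -- term is divided on its own, with the degree of its remaining exponents as `d`.
  divideHead : ∀ {n} (a : ℚ) (as : Vec ℚ n) → a ≢ 0ℚ → ∀ {d} (P : Poly (suc n)) → DegreeAtMost d P →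
    ∃[ F ] ∃[ R ] (DegreeAtMost d F × (∀ p i φ →
      pairing p i φ P ≡ pairing p i (φ ∘ (0 ∷_)) F + pairing p i (transpose (a ∷ as) φ) R))
  divideHead a as a≢0 []                  []        = [] , [] , [] , λ p i φ → refl
  divideHead a as a≢0 {d} ((c , k ∷ ks) ∷ P) (h ∷ hs) =
    F₁ ++ F₂ , R₁ ++ R₂ ,
    Allₚ.++⁺ (All.map (λ h′ → ℕₚ.≤-trans h′ h) deg₁) deg₂ , λ p i φ → begin
      φ (k ∷ ks) * approx p i c + pairing p i φ P
        ≡⟨ cong₂ _+_ (trans (sym (+-identityʳ (φ (k ∷ ks) * approx p i c))) (eq₁ p i φ)) (eq₂ p i φ) ⟩
      (pairing p i (φ ∘ (0 ∷_)) F₁ + pairing p i (ℒ φ) R₁) + (pairing p i (φ ∘ (0 ∷_)) F₂ + pairing p i (ℒ φ) R₂)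
        ≡⟨ +-interchange (pairing p i (φ ∘ (0 ∷_)) F₁) (pairing p i (ℒ φ) R₁) (pairing p i (φ ∘ (0 ∷_)) F₂) (pairing p i (ℒ φ) R₂) ⟩
      (pairing p i (φ ∘ (0 ∷_)) F₁ + pairing p i (φ ∘ (0 ∷_)) F₂) + (pairing p i (ℒ φ) R₁ + pairing p i (ℒ φ) R₂)
        ≡⟨ cong₂ _+_ (sumOver-++ (λ (c , l) → φ (0 ∷ l) * approx p i c) F₁ F₂) (sumOver-++ (λ (c , l) → ℒ φ l * approx p i c) R₁ R₂) ⟨
      pairing p i (φ ∘ (0 ∷_)) (F₁ ++ F₂) + pairing p i (ℒ φ) (R₁ ++ R₂) ∎
    where
    open ≡-Reasoning
    ℒ = transpose (a ∷ as)
    first = divide a as a≢0 k ((c , ks) ∷ []) (ℕₚ.≤-refl ∷ [])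
    F₁ = proj₁ first
    R₁ = proj₁ (proj₂ first)
    deg₁ = proj₁ (proj₂ (proj₂ first))
    eq₁ = proj₂ (proj₂ (proj₂ first))
    others = divideHead a as a≢0 P hs
    F₂ = proj₁ others
    R₂ = proj₁ (proj₂ others)
    deg₂ = proj₁ (proj₂ (proj₂ others))
    eq₂ = proj₂ (proj₂ (proj₂ others))

  dot-monomial : ∀ {n} (b : Vec ℚ n) (x : Vec ℚ n) k → dot (Vec.lookup b) (λ j → monomial x (raise j k)) ≡
    Vec.foldr′ _+_ 0ℚ (Vec.zipWith _*_ b x) * monomial x k
  dot-monomial []      []      []       = refl
  dot-monomial (b ∷ v) (q ∷ x) (k ∷ ks) = begin
    b * monomial (q ∷ x) (raise zero (k ∷ ks)) + dot (Vec.lookup v) (λ j → q ^ k * monomial x (raise j ks))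
      ≡⟨ cong₂ _+_ (cong (λ t → b * monomial (q ∷ x) t) (raise-zero k ks)) (dot-* (q ^ k) (Vec.lookup v) (λ j → monomial x (raise j ks))) ⟩
    b * (q ^ suc k * monomial x ks) + q ^ k * dot (Vec.lookup v) (λ j → monomial x (raise j ks))
      ≡⟨ cong (λ t → b * (q ^ suc k * monomial x ks) + q ^ k * t) (dot-monomial v x ks) ⟩
    b * (q * q ^ k * monomial x ks) + q ^ k * (S * monomial x ks)
      ≡⟨ eq b q (q ^ k) (monomial x ks) S ⟩
    (b * q + S) * (q ^ k * monomial x ks) ∎
    where
    open ≡-Reasoning
    S = Vec.foldr′ _+_ 0ℚ (Vec.zipWith _*_ v x)
    eq : ∀ b q p m s → b * (q * p * m) + p * (s * m) ≡ (b * q + s) * (p * m)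
    eq = solve-∀ ℚ-ring
    dot-* : ∀ {n} q (b : Fin n → ℚ) f → dot b (λ j → q * f j) ≡ q * dot b f
    dot-* {zero}  q b f = sym (*-zeroʳ q)
    dot-* {suc n} q b f = trans (cong (b zero * (q * f zero) +_) (dot-* q (b ∘ suc) (f ∘ suc)))
      (eq′ (b zero) q (f zero) (dot (b ∘ suc) (f ∘ suc)))
      where
      eq′ : ∀ b q f d → b * (q * f) + q * d ≡ q * (b * f + d)
      eq′ = solve-∀ ℚ-ring

  -- Evaluation at a point of the hyperplane kills every multiple of the linear form; stated for the
  -- transpose, it kills the contribution of the quotient.
  transpose-monomial : ∀ {n} (a x : Vec ℚ n) → Vec.foldr′ _+_ 0ℚ (Vec.zipWith _*_ a x) ≡ 1ℚ →
    ∀ k → transpose a (monomial x) k ≡ 0ℚ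
  transpose-monomial a x ax≡1 k = begin
    - monomial x k + dot (Vec.lookup a) (λ j → monomial x (raise j k))  ≡⟨ cong (- monomial x k +_) (dot-monomial a x k) ⟩
    - monomial x k + Vec.foldr′ _+_ 0ℚ (Vec.zipWith _*_ a x) * monomial x k ≡⟨ cong (λ t → - monomial x k + t * monomial x k) ax≡1 ⟩
    - monomial x k + 1ℚ * monomial x k  ≡⟨ eq (monomial x k) ⟩
    0ℚ  ∎
    where
    open ≡-Reasoning
    eq : ∀ m → - m + 1ℚ * m ≡ 0ℚ
    eq = solve-∀ ℚ-ring

  -- Interpolation

  p-q≢0 : ∀ {p q} → p ≢ q → p - q ≢ 0ℚ
  p-q≢0 {p} {q} p≢q p-q≡0 = p≢q (trans (p≡p-q+q p q) (trans (cong (_+ q) p-q≡0) (+-identityˡ q)))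

  -- The Vandermonde matrix of distinct nodes is invertible: with x₀ removed, the
  -- weights w′ for φ (k + 1) - x₀ φ k give those for φ as w = w′ / (x - x₀).
  vandermonde : ∀ {K : Set} (xs : List ℚ) → Unique xs → (φ : ℕ → K → ℚ) →
    Σ[ W ∈ List (ℚ × (K → ℚ)) ] (All (λ w → proj₁ w ∈ xs) W ×
      (∀ k → k ℕ.< length xs → ∀ κ → φ k κ ≡ sumOver (λ (x , w) → x ^ k * w κ) W))
  vandermonde []        _          φ = [] , [] , λ _ ()
  vandermonde {K} (x₀ ∷ xs) (x₀∉xs ∷ u) φ =
    W , here refl ∷ Allₚ.map⁺ (All.map there nodes) , interpolates
    where
    rest = vandermonde xs u λ k κ → φ (suc k) κ - x₀ * φ k κ
    W′ = proj₁ rest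
    nodes = proj₁ (proj₂ rest)
    eqs = proj₂ (proj₂ rest)
    rescale : ℚ × (K → ℚ) → ℚ × (K → ℚ)
    rescale (x , w) = x , λ κ → w κ * inv (x - x₀)
    V = List.map rescale W′
    -- The weight of `x₀` is forced by the case `k = 0`. From there both sides obey the same
    -- recurrence in `k`.
    w₀ : K → ℚ
    w₀ κ = φ 0 κ - sumOver (λ (x , w) → w κ) V
    W = (x₀ , w₀) ∷ V
    ψ : ℕ → K → ℚ
    ψ k κ = sumOver (λ (x , w) → x ^ k * w κ) W
    initial : ∀ κ → φ 0 κ ≡ ψ 0 κ
    initial κ = trans (eq (φ 0 κ) (sumOver (λ (x , w) → w κ) V))
      (cong (1ℚ * w₀ κ +_) (sumOver-cong′ (λ (x , w) → sym (*-identityˡ (w κ))) V))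
      where
      eq : ∀ a b → a ≡ 1ℚ * (a - b) + b
      eq = solve-∀ ℚ-ring
    open ≡-Reasoning
    weight : ∀ k κ {x w} → x ∈ xs → x ^ suc k * (w κ * inv (x - x₀)) ≡
      x₀ * (x ^ k * (w κ * inv (x - x₀))) + x ^ k * w κ
    weight k κ {x} {w} x∈xs = begin
      x ^ suc k * (w κ * inv (x - x₀))
        ≡⟨ eq₁ x x₀ (x ^ k) (w κ) (inv (x - x₀)) ⟩
      x₀ * (x ^ k * (w κ * inv (x - x₀))) + x ^ k * w κ * ((x - x₀) * inv (x - x₀))
        ≡⟨ cong (λ t → x₀ * (x ^ k * (w κ * inv (x - x₀))) + x ^ k * w κ * t)
            (inv-inverse (p-q≢0 (λ x≡x₀ → All.lookup x₀∉xs x∈xs (sym x≡x₀)))) ⟩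
      x₀ * (x ^ k * (w κ * inv (x - x₀))) + x ^ k * w κ * 1ℚ
        ≡⟨ cong (x₀ * (x ^ k * (w κ * inv (x - x₀))) +_) (*-identityʳ (x ^ k * w κ)) ⟩
      x₀ * (x ^ k * (w κ * inv (x - x₀))) + x ^ k * w κ ∎
      where
      eq₁ : ∀ x y p w i → x * p * (w * i) ≡ y * (p * (w * i)) + p * w * ((x - y) * i)
      eq₁ = solve-∀ ℚ-ring
    recurrence : ∀ k κ → ψ (suc k) κ ≡ x₀ * ψ k κ + sumOver (λ (x , w) → x ^ k * w κ) W′
    recurrence k κ = begin
      x₀ ^ suc k * w₀ κ + sumOver (λ (x , w) → x ^ suc k * w κ) V
        ≡⟨ cong (x₀ ^ suc k * w₀ κ +_) (trans (sumOver-map (λ (x , w) → x ^ suc k * w κ) rescale W′)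
            (trans (sumOver-cong (All.map (λ {t} → weight k κ {w = proj₂ t}) nodes))
            (sumOver-+ (λ (x , w) → x₀ * (x ^ k * (w κ * inv (x - x₀)))) (λ (x , w) → x ^ k * w κ) W′))) ⟩
      x₀ ^ suc k * w₀ κ + (sumOver (λ (x , w) → x₀ * (x ^ k * (w κ * inv (x - x₀)))) W′ + S)
        ≡⟨ cong (λ t → x₀ ^ suc k * w₀ κ + (t + S)) (trans (sumOver-* x₀ (λ (x , w) → x ^ k * (w κ * inv (x - x₀))) W′)
            (cong (x₀ *_) (sym (sumOver-map (λ (x , w) → x ^ k * w κ) rescale W′)))) ⟩
      x₀ ^ suc k * w₀ κ + (x₀ * sumOver (λ (x , w) → x ^ k * w κ) V + S)
        ≡⟨ eq x₀ (x₀ ^ k) (w₀ κ) (sumOver (λ (x , w) → x ^ k * w κ) V) S ⟩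
      x₀ * ψ k κ + S ∎
      where
      S = sumOver (λ (x , w) → x ^ k * w κ) W′
      eq : ∀ x p w v s → x * p * w + (x * v + s) ≡ x * (p * w + v) + s
      eq = solve-∀ ℚ-ring
    interpolates : ∀ k → k ℕ.< suc (length xs) → ∀ κ → φ k κ ≡ ψ k κ
    interpolates zero    _         κ = initial κ
    interpolates (suc k) (s≤s k<) κ = begin
      φ (suc k) κ  ≡⟨ eq (φ (suc k) κ) (x₀ * φ k κ) ⟩
      x₀ * φ k κ + (φ (suc k) κ - x₀ * φ k κ)  ≡⟨ cong₂ (λ s t → x₀ * s + t) (interpolates k (ℕₚ.m≤n⇒m≤1+n k<) κ) (eqs k k< κ) ⟩
      x₀ * ψ k κ + sumOver (λ (x , w) → x ^ k * w κ) W′  ≡⟨ recurrence k κ ⟨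
      ψ (suc k) κ  ∎
      where
      eq : ∀ a b → a ≡ b + (a - b)
      eq = solve-∀ ℚ-ring

  infixr 5 _∷_

  -- Branch U a ρ x ρ′: the point x is built by splitting at each step the current
  -- remainder ρ as ρ u + ρ (1 - u) with u ∈ U, so that a · x = ρ - ρ′.
  data Branch (U : List ℚ) : ∀ {n} → Vec ℚ n → ℚ → Vec ℚ n → ℚ → Set where
    []  : ∀ {ρ} → Branch U [] ρ [] ρ
    _∷_ : ∀ {n} {a u ρ ρ′} {as xs : Vec ℚ n} → u ∈ U → Branch U as (ρ * (1ℚ - u)) xs ρ′ →
          Branch U (a ∷ as) ρ (ρ * u * inv a ∷ xs) ρ′

  BranchPoint : ∀ {n} → List ℚ → Vec ℚ n → ℚ → ℚ × Vec ℚ n → Set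
  BranchPoint U a ρ (_ , x) = ∃[ ρ′ ] Branch U a ρ x ρ′

  -- Induction on the number of variables. Vandermonde in the first coordinate leaves weights that
  -- are functions of the remaining exponents; these are interpolated in turn on the subtree below
  -- each node. The subtrees depend on the remainder at their node, so the points form no product
  -- grid. Since `u ≢ 1`, the remainder stays nonzero and the nodes of the next level stay distinct.
  interpolation : ∀ {n} U → Unique U → All (_≢ 1ℚ) U → (a : Vec ℚ n) → VecAll.All (_≢ 0ℚ) a →
    ∀ ρ → ρ ≢ 0ℚ → (φ : Vec ℕ n → ℚ) →
    ∃[ W ] (All (BranchPoint U a ρ) W ×
      (∀ k → Vec.sum k ℕ.< length U → φ k ≡ sumOver (λ (w , x) → w * monomial x k) W))
  interpolation U uU U≢1 []       VecAll.[]            ρ ρ≢0 φ =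
    (φ [] , []) ∷ [] , (ρ , []) ∷ [] , λ { [] _ → eq (φ []) }
    where
    eq : ∀ a → a ≡ a * 1ℚ + 0ℚ
    eq = solve-∀ ℚ-ring
  interpolation {suc n} U uU U≢1 (a ∷ as) (a≢0 VecAll.∷ as≢0) ρ ρ≢0 φ = proj₁ tree , proj₁ (proj₂ tree) , correct
    where
    open ≡-Reasoning
    node : ℚ → ℚ
    node u = ρ * u * inv a
    node-injective : ∀ {u v} → node u ≡ node v → u ≡ v
    node-injective {u} {v} e = trans (sym (undo u)) (trans (cong (λ t → inv ρ * (a * t)) e) (undo v))
      where
      eq : ∀ r a i j u → i * (a * (r * u * j)) ≡ u * (r * i) * (a * j)
      eq = solve-∀ ℚ-ring
      undo : ∀ u → inv ρ * (a * node u) ≡ u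
      undo u = trans (eq ρ a (inv ρ) (inv a) u) (trans
        (cong₂ (λ s t → u * s * t) (inv-inverse ρ≢0) (inv-inverse a≢0))
        (trans (*-identityʳ (u * 1ℚ)) (*-identityʳ u)))
    nodes = List.map node U
    first = vandermonde nodes (Uniqueₚ.map⁺ node-injective uU) λ k ks → φ (k ∷ ks)
    W₁ = proj₁ first
    Tree : List (ℚ × (Vec ℕ n → ℚ)) → Set
    Tree W = ∃[ W′ ] (All (BranchPoint U (a ∷ as) ρ) W′ ×
      (∀ k ks → Vec.sum ks ℕ.< length U →
        sumOver (λ (x , w) → x ^ k * w ks) W ≡ sumOver (λ (w , x) → w * monomial x (k ∷ ks)) W′))
    grow : ∀ W → All (λ w → proj₁ w ∈ nodes) W → Tree W
    grow []            []           = [] , [] , λ _ _ _ → refl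
    grow ((x , w) ∷ W) (x∈ ∷ rest) =
      List.map (λ (v , y) → v , x ∷ y) W₂ ++ proj₁ (grow W rest) ,
      Allₚ.++⁺ (Allₚ.map⁺ (All.map (λ {t} → extend {t}) (proj₁ (proj₂ below)))) (proj₁ (proj₂ (grow W rest))) ,
      λ k ks h → begin
        x ^ k * w ks + sumOver (λ (x , w) → x ^ k * w ks) W
          ≡⟨ cong₂ _+_ (trans (cong (x ^ k *_) (proj₂ (proj₂ below) ks h)) (sym (sumOver-* (x ^ k) (λ (v , y) → v * monomial y ks) W₂)))
              (proj₂ (proj₂ (grow W rest)) k ks h) ⟩
        sumOver (λ (v , y) → x ^ k * (v * monomial y ks)) W₂ + sumOver (λ (w , x) → w * monomial x (k ∷ ks)) (proj₁ (grow W rest))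
          ≡⟨ cong (_+ sumOver (λ (w , x) → w * monomial x (k ∷ ks)) (proj₁ (grow W rest)))
              (trans (sumOver-cong′ (λ (v , y) → eq (x ^ k) v (monomial y ks)) W₂)
                (sym (sumOver-map (λ (w , x) → w * monomial x (k ∷ ks)) (λ (v , y) → v , x ∷ y) W₂))) ⟩
        sumOver (λ (w , x) → w * monomial x (k ∷ ks)) (List.map (λ (v , y) → v , x ∷ y) W₂) + sumOver (λ (w , x) → w * monomial x (k ∷ ks)) (proj₁ (grow W rest))
          ≡⟨ sumOver-++ (λ (w , x) → w * monomial x (k ∷ ks)) (List.map (λ (v , y) → v , x ∷ y) W₂) (proj₁ (grow W rest)) ⟨
        sumOver (λ (w , x) → w * monomial x (k ∷ ks)) (List.map (λ (v , y) → v , x ∷ y) W₂ ++ proj₁ (grow W rest)) ∎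
      where
      u = proj₁ (∈-map⁻ node x∈)
      u∈U = proj₁ (proj₂ (∈-map⁻ node x∈))
      x≡ = proj₂ (proj₂ (∈-map⁻ node x∈))
      eq : ∀ p v m → p * (v * m) ≡ v * (p * m)
      eq = solve-∀ ℚ-ring
      -- The functional for the subtree is the Vandermonde weight `w` of this node.
      below = interpolation U uU U≢1 as as≢0 (ρ * (1ℚ - u))
        (*-nonZero ρ≢0 (p-q≢0 (λ 1≡u → All.lookup U≢1 u∈U (sym 1≡u)))) w
      W₂ = proj₁ below
      extend : ∀ {t} → BranchPoint U as (ρ * (1ℚ - u)) t → BranchPoint U (a ∷ as) ρ (proj₁ t , x ∷ proj₂ t)
      extend {_ , y} (ρ′ , b) = ρ′ , subst (λ z → Branch U (a ∷ as) ρ (z ∷ y) ρ′) (sym x≡) (u∈U ∷ b)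
    tree = grow W₁ (proj₁ (proj₂ first))
    correct : ∀ k → Vec.sum k ℕ.< length U → φ k ≡ sumOver (λ (w , x) → w * monomial x k) (proj₁ tree)
    correct (k ∷ ks) h = trans
      (proj₂ (proj₂ first) k (subst (k ℕ.<_) (sym (length-map node U)) (ℕₚ.≤-<-trans (ℕₚ.m≤m+n k (Vec.sum ks)) h)) ks)
      (proj₂ (proj₂ tree) k ks (ℕₚ.≤-<-trans (ℕₚ.m≤n+m (Vec.sum ks) k) h))

  -- The degree

  Splits : PrimeSet → ℚ → Set
  Splits S u = IsSUnit S u × IsSUnit S (1ℚ - u)

  branch-sUnits : ∀ {S U n} {a x : Vec ℚ n} {ρ ρ′} → All (Splits S) U → VecAll.All (IsSUnit S) a →
    IsSUnit S ρ → Branch U a ρ x ρ′ → VecAll.All (IsSUnit S) x × IsSUnit S ρ′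
  branch-sUnits hU ha hρ [] = VecAll.[] , hρ
  branch-sUnits hU (h VecAll.∷ ha) hρ (u∈U ∷ b) =
    sUnit-* (sUnit-* hρ (proj₁ (All.lookup hU u∈U))) (sUnit-inv h) VecAll.∷ proj₁ rest , proj₂ rest
    where rest = branch-sUnits hU ha (sUnit-* hρ (proj₂ (All.lookup hU u∈U))) b

  branch-sum : ∀ {U n} {a x : Vec ℚ n} {ρ ρ′} → VecAll.All (_≢ 0ℚ) a → Branch U a ρ x ρ′ →
    Vec.foldr′ _+_ 0ℚ (Vec.zipWith _*_ a x) ≡ ρ - ρ′
  branch-sum {ρ = ρ} VecAll.[] [] = sym (+-inverseʳ ρ)
  branch-sum {ρ = ρ} {ρ′} (a≢0 VecAll.∷ as≢0) (_∷_ {a = a} {u = u} _ b) = trans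
    (cong₂ _+_ (trans (eq₁ a ρ u (inv a)) (trans (cong (ρ * u *_) (inv-inverse a≢0)) (*-identityʳ (ρ * u)))) (branch-sum as≢0 b))
    (eq₂ ρ u ρ′)
    where
    eq₁ : ∀ a r u i → a * (r * u * i) ≡ r * u * (a * i)
    eq₁ = solve-∀ ℚ-ring
    eq₂ : ∀ r u s → r * u + (r * (1ℚ - u) - s) ≡ r - s
    eq₂ = solve-∀ ℚ-ring

  module _ {n} (a₁ : ℚ) (as : Vec ℚ n) (S : PrimeSet) (U : List ℚ) (uniqueU : Unique U)
    (splits : All (Splits S) U) (a₁-unit : IsSUnit S a₁) (as-units : VecAll.All (IsSUnit S) as) where

    private
      a₁≢0 : a₁ ≢ 0ℚ
      a₁≢0 = IsSUnit.x≢0 a₁-unit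
      as≢0 : VecAll.All (_≢ 0ℚ) as
      as≢0 = VecAll.map IsSUnit.x≢0 as-units
      U≢1 : All (_≢ 1ℚ) U
      U≢1 = All.map (λ { (_ , h) refl → IsSUnit.x≢0 h refl }) splits

    -- The tree runs over a₂, ..., aₙ only; the first coordinate `ρ′ / a₁` absorbs the final
    -- remainder and completes the sum to 1.
    branch-solution : ∀ {x ρ′} → Branch U as 1ℚ x ρ′ → IsSolution (a₁ ∷ as) S (ρ′ * inv a₁ ∷ x)
    branch-solution {x} {ρ′} b =
      (sUnit-* (proj₂ units) (sUnit-inv a₁-unit) VecAll.∷ proj₁ units) , (begin
        a₁ * (ρ′ * inv a₁) + Vec.foldr′ _+_ 0ℚ (Vec.zipWith _*_ as x)  ≡⟨ cong (a₁ * (ρ′ * inv a₁) +_) (branch-sum as≢0 b) ⟩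
        a₁ * (ρ′ * inv a₁) + (1ℚ - ρ′)  ≡⟨ eq₁ a₁ ρ′ (inv a₁) ⟩
        ρ′ * (a₁ * inv a₁) + (1ℚ - ρ′)  ≡⟨ cong (λ t → ρ′ * t + (1ℚ - ρ′)) (inv-inverse a₁≢0) ⟩
        ρ′ * 1ℚ + (1ℚ - ρ′)  ≡⟨ eq₂ ρ′ ⟩
        1ℚ  ∎)
      where
      open ≡-Reasoning
      units = branch-sUnits splits as-units sUnit-1 b
      eq₁ : ∀ a r i → a * (r * i) + (1ℚ - r) ≡ r * (a * i) + (1ℚ - r)
      eq₁ = solve-∀ ℚ-ring
      eq₂ : ∀ r → r * 1ℚ + (1ℚ - r) ≡ 1ℚ
      eq₂ = solve-∀ ℚ-ring

    -- Modulo a₁X₁ + ⋯ + aₙXₙ - 1 a polynomial of low degree is one in X₂, …, Xₙ,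
    -- whose values at the branch points vanish, hence so do all functionals of it.
    divisible : ∀ {d} → d ℕ.< length U → (P : Poly (suc n)) →
      (∀ e → d ℕ.< Vec.sum e → ∀ p → Null (λ i → approx p i (coeff P e))) →
      (∀ x → IsSolution (a₁ ∷ as) S x → ∀ p → Null (λ i → approx p i (eval P (Vec.map fromℚᶜ x)))) →
      linearMinusOne (a₁ ∷ as) ∣ᴾ P
    divisible {d} d<∣U∣ P high zeros = R , λ e → ≃ᶜ-parts (quotient e)
      where
      ℒ = transpose (a₁ ∷ as)
      reduce : ∀ φ p → Null (λ i → pairing p i φ P - pairing p i φ (lowDegree d P))
      reduce φ = pairing-lowDegree d φ P
        (λ e d<e p → null-≗ (λ i → pairing-indicator p i e P) (high e d<e p))
      division = divideHead a₁ as a₁≢0 (lowDegree d P) (lowDegree-degree d P)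
      F = proj₁ division
      R = proj₁ (proj₂ division)
      degF = proj₁ (proj₂ (proj₂ division))
      divided = proj₂ (proj₂ (proj₂ division))
      -- At the solution `z` the quotient `R` drops out, and `F`, being free of X₁, sees only the
      -- branch point `x`.
      zerosF : ∀ {x ρ′} → Branch U as 1ℚ x ρ′ → Vanishes (monomial x) F
      zerosF {x} {ρ′} b p = null-≗ (λ i → begin
          pairing p i (monomial z) P + - 1ℚ * (pairing p i (monomial z) P - pairing p i (monomial z) (lowDegree d P))
            ≡⟨ eq (pairing p i (monomial z) P) (pairing p i (monomial z) (lowDegree d P)) ⟩
          pairing p i (monomial z) (lowDegree d P)
            ≡⟨ divided p i (monomial z) ⟩
          pairing p i (λ k → 1ℚ * monomial x k) F + pairing p i (ℒ (monomial z)) R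
            ≡⟨ cong₂ _+_ (sumOver-cong′ (λ (c , k) → cong (_* approx p i c) (*-identityˡ (monomial x k))) F)
                (trans (sumOver-cong′ (λ (c , k) → cong (_* approx p i c) (transpose-monomial (a₁ ∷ as) z (proj₂ (branch-solution b)) k)) R)
                  (pairing-0 p i R)) ⟩
          pairing p i (monomial x) F + 0ℚ
            ≡⟨ +-identityʳ (pairing p i (monomial x) F) ⟩
          pairing p i (monomial x) F ∎)
        (null-+ (null-≗ (λ i → pairing-monomial p i z P) (zeros z (branch-solution b) p))
          (null-* (- 1ℚ) (reduce (monomial z) p)))
        where
        open ≡-Reasoning
        z = ρ′ * inv a₁ ∷ x
        eq : ∀ a b → a + - 1ℚ * (a - b) ≡ b
        eq = solve-∀ ℚ-ring
      vanishesF : ∀ φ → Vanishes φ F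
      vanishesF φ p = null-≗ (λ i → begin
          sumOver (λ (w , x) → w * pairing p i (monomial x) F) W
            ≡⟨ sumOver-cong′ (λ (w , x) → sym (sumOver-* w (λ (c , k) → monomial x k * approx p i c) F)) W ⟩
          sumOver (λ (w , x) → sumOver (λ (c , k) → w * (monomial x k * approx p i c)) F) W
            ≡⟨ sumOver-swap (λ (w , x) (c , k) → w * (monomial x k * approx p i c)) W F ⟩
          sumOver (λ (c , k) → sumOver (λ (w , x) → w * (monomial x k * approx p i c)) W) F
            ≡⟨ sumOver-cong (All.map (λ {t} → term p i t) degF) ⟩
          pairing p i φ F ∎)
        (null-sumOver (λ (w , x) i → w * pairing p i (monomial x) F) W
          (All.map (λ {t} b → null-* (proj₁ t) (zerosF (proj₂ b) p)) (proj₁ (proj₂ weights))))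
        where
        open ≡-Reasoning
        weights = interpolation U uniqueU U≢1 as as≢0 1ℚ (λ ()) φ
        W = proj₁ weights
        eq : ∀ a b c → a * (b * c) ≡ c * (a * b)
        eq = solve-∀ ℚ-ring
        term : ∀ p i t → Vec.sum (proj₂ t) ℕ.≤ d →
          sumOver (λ (w , x) → w * (monomial x (proj₂ t) * approx p i (proj₁ t))) W ≡ φ (proj₂ t) * approx p i (proj₁ t)
        term p i t h = begin
          sumOver (λ (w , x) → w * (monomial x (proj₂ t) * v)) W  ≡⟨ sumOver-cong′ (λ (w , x) → eq w (monomial x (proj₂ t)) v) W ⟩
          sumOver (λ (w , x) → v * (w * monomial x (proj₂ t))) W  ≡⟨ sumOver-* v (λ (w , x) → w * monomial x (proj₂ t)) W ⟩
          v * sumOver (λ (w , x) → w * monomial x (proj₂ t)) W  ≡⟨ cong (v *_) (proj₂ (proj₂ weights) (proj₂ t) (ℕₚ.≤-<-trans h d<∣U∣)) ⟨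
          v * φ (proj₂ t)  ≡⟨ *-comm v (φ (proj₂ t)) ⟩
          φ (proj₂ t) * v  ∎
          where v = approx p i (proj₁ t)
      quotient : ∀ e p → Null (λ i → approx p i (coeff P e) - approx p i (coeff (linearMinusOne (a₁ ∷ as) *ᴾ R) e))
      quotient e p = null-≗ (λ i → sym (begin
          approx p i (coeff P e) - approx p i (coeff (linearMinusOne (a₁ ∷ as) *ᴾ R) e)
            ≡⟨ cong₂ _-_ (pairing-indicator p i e P)
                (trans (pairing-indicator p i e (linearMinusOne (a₁ ∷ as) *ᴾ R)) (pairing-linearMinusOne-*ᴾ p i (a₁ ∷ as) φ R)) ⟩
          pairing p i φ P - pairing p i (ℒ φ) R
            ≡⟨ eq₁ (pairing p i φ P) (pairing p i (ℒ φ) R) (pairing p i (φ ∘ (0 ∷_)) F) ⟩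
          pairing p i φ P - (pairing p i (φ ∘ (0 ∷_)) F + pairing p i (ℒ φ) R) + pairing p i (φ ∘ (0 ∷_)) F
            ≡⟨ cong (λ t → pairing p i φ P - t + pairing p i (φ ∘ (0 ∷_)) F) (divided p i φ) ⟨
          pairing p i φ P - pairing p i φ (lowDegree d P) + pairing p i (φ ∘ (0 ∷_)) F ∎))
        (null-+ (reduce φ p) (vanishesF (φ ∘ (0 ∷_)) p))
        where
        open ≡-Reasoning
        φ = indicator e
        eq₁ : ∀ a b c → a - b ≡ a - (c + b) + c
        eq₁ = solve-∀ ℚ-ring

    length≤degree : ∀ d → DegreeAttained (a₁ ∷ as) S d → length U ℕ.≤ d
    length≤degree d (P , (_ , degree) , ¬divides , zeros) = ℕₚ.≮⇒≥ λ d<∣U∣ → ¬divides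
      (divisible d<∣U∣ P
        (λ e d<e → ¬occurs⇒null (λ occurs → ℕₚ.<⇒≱ d<e (degree e occurs)))
        (λ x sol → ≃ᶜ0⇒null (zeros x sol)))

-- Primes, products of primes, and congruences between such products.

module SmoothNumbers where

  open import Data.List.Base as List using (List; []; _∷_; _++_; length; filter; map; take; drop; upTo; cartesianProduct; cartesianProductWith)
  open import Data.List.Membership.Propositional using (_∈_; _∉_)
  open import Data.List.Membership.Propositional.Properties
    using (∈-∃++; ∈-++⁺ˡ; ∈-++⁺ʳ; ∈-++⁻; ∈-map⁻; ∈-upTo⁺; ∈-filter⁺; ∈-filter⁻; ∈-cartesianProduct⁻; ∈-cartesianProductWith⁻)
  open import Data.List.Properties using (length-++; length-map; length-take; length-drop; length-upTo; take++drop≡id)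
  open import Data.List.Relation.Unary.All as All using (All; []; _∷_)
  import Data.List.Relation.Unary.All.Properties as Allₚ
  open import Data.List.Relation.Unary.AllPairs using ([]; _∷_)
  open import Data.List.Relation.Unary.Any using (here; there)
  open import Data.List.Relation.Unary.Unique.Propositional using (Unique)
  import Data.List.Relation.Unary.Unique.Propositional.Properties as Uniqueₚ
  open import Data.Nat.Base
  open import Data.Nat.Combinatorics using (_C_; k>n⇒nCk≡0; nC1≡n; nCk+nC[k+1]≡[n+1]C[k+1])
  open import Data.Nat.Divisibility
  open import Data.Nat.DivMod using (m%n<n; m≡m%n+[m/n]*n; m*n/n≡m; m<n*o⇒m/o<n)
  open import Data.Nat.Induction using (<-rec)
  open import Data.Nat.ListAction using (product)
  open import Data.Nat.Primality
  open import Data.Nat.Primality.Factorisation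
    using (factorise; factorisationHasAllPrimeFactors; module PrimeFactorisation)
  open import Data.Nat.Properties
  open import Data.Nat.Tactic.RingSolver using (solve-∀)
  open import Data.Product.Base using (∃-syntax; _×_; _,_; proj₁; proj₂)
  open import Data.Sum.Base using (_⊎_; inj₁; inj₂; [_,_]′; swap)
  open import Function.Base using (_∘_)
  open import Relation.Binary.PropositionalEquality
  open import Relation.Nullary using (¬_; Dec; yes; no; contradiction)
  open import Relation.Nullary.Decidable using (_×-dec_; ¬?)
  open import Relation.Unary using (Decidable)
  open import Data.List.Membership.DecPropositional _≟_ using (_∈?_)

  -- Chebyshev’s bound

  absorption : ∀ n k → suc k * (suc n C suc k) ≡ suc n * (n C k)
  absorption zero    zero    = refl
  absorption zero    (suc k) = begin
    suc (suc k) * (1 C suc (suc k))  ≡⟨ cong (suc (suc k) *_) (k>n⇒nCk≡0 {1} {suc (suc k)} (s≤s (s≤s z≤n))) ⟩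
    suc (suc k) * 0  ≡⟨ *-zeroʳ (suc (suc k)) ⟩
    0  ≡⟨ cong (1 *_) (k>n⇒nCk≡0 {0} {suc k} (s≤s z≤n)) ⟨
    1 * (0 C suc k)  ∎
    where open ≡-Reasoning
  absorption (suc n) zero    = begin
    1 * (suc (suc n) C 1)  ≡⟨ *-identityˡ (suc (suc n) C 1) ⟩
    suc (suc n) C 1  ≡⟨ nC1≡n (suc (suc n)) ⟩
    suc (suc n)  ≡⟨ *-identityʳ (suc (suc n)) ⟨
    suc (suc n) * 1  ∎
    where open ≡-Reasoning
  absorption (suc n) (suc k) = begin
    (2 + k) * (suc (suc n) C (2 + k))  ≡⟨ cong ((2 + k) *_) (nCk+nC[k+1]≡[n+1]C[k+1] (suc n) (suc k)) ⟨
    (2 + k) * (P + (suc n C (2 + k)))  ≡⟨ eq₁ k P (suc n C (2 + k)) ⟩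
    suc k * P + P + (2 + k) * (suc n C (2 + k))  ≡⟨ cong₂ (λ s t → s + P + t) (absorption n k) (absorption n (suc k)) ⟩
    suc n * (n C k) + P + suc n * (n C suc k)  ≡⟨ eq₂ n (n C k) P (n C suc k) ⟩
    suc n * ((n C k) + (n C suc k)) + P  ≡⟨ cong (λ t → suc n * t + P) (nCk+nC[k+1]≡[n+1]C[k+1] n k) ⟩
    suc n * P + P  ≡⟨ +-comm (suc n * P) P ⟩
    suc (suc n) * P  ∎
    where
    open ≡-Reasoning
    P = suc n C suc k
    eq₁ : ∀ k p q → (2 + k) * (p + q) ≡ suc k * p + p + (2 + k) * q
    eq₁ = solve-∀
    eq₂ : ∀ n a p b → suc n * a + p + suc n * b ≡ suc n * (a + b) + p
    eq₂ = solve-∀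

  CommonMultiple : ℕ → ℕ → Set
  CommonMultiple n D = ∀ m → 0 < m → m ≤ n → m ∣ D

  -- Leibniz' harmonic triangle: with L(n,k) = (n + 1) C(n,k), the identity
  -- 1 / L(n,k+1) = 1 / L(n-1,k) - 1 / L(n,k) exhibits D / L(n,k+1) as an integer.
  leibniz-∣ : ∀ n k {D} → 0 < D → k ≤ n → CommonMultiple (suc n) D → suc n * (n C k) ∣ D
  leibniz-∣ n       zero    {D} 0<D _   cm = subst (_∣ D) (sym (*-identityʳ (suc n))) (cm (suc n) (s≤s z≤n) ≤-refl)
  leibniz-∣ (suc n) (suc k) {D} 0<D (s≤s k≤n) cm
    with leibniz-∣ n k 0<D k≤n (λ m 0<m m≤ → cm m 0<m (m≤n⇒m≤1+n m≤))
       | leibniz-∣ (suc n) k 0<D (m≤n⇒m≤1+n k≤n) cm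
  ... | divides x D≡xl | divides y D≡yA = divides z (*-cancelˡ-≡ D (z * B) (suc k) (begin
      suc k * D  ≡⟨ cong (suc k *_) D≡yA ⟩
      suc k * (y * (suc (suc n) * c))  ≡⟨ eq₁ (suc k) y (suc (suc n)) c ⟩
      suc (suc n) * (y * (suc k * c))  ≡⟨ cong (suc (suc n) *_) zl≡ ⟨
      suc (suc n) * (z * l)  ≡⟨ eq₂ (suc (suc n)) z l ⟩
      z * (suc (suc n) * l)  ≡⟨ cong (λ t → z * (suc (suc n) * t)) (absorption n k) ⟨
      z * (suc (suc n) * (suc k * (suc n C suc k))) ≡⟨ eq₃ z (suc (suc n)) (suc k) (suc n C suc k) ⟩
      suc k * (z * B)  ∎))
    where
    open ≡-Reasoning
    c = suc n C k
    l = suc n * (n C k)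
    A = suc (suc n) * c
    B = suc (suc n) * (suc n C suc k)
    A≡ : A ≡ suc k * c + l
    A≡ = begin
      suc (suc n) * (suc n C k)  ≡⟨ absorption (suc n) k ⟨
      suc k * (suc (suc n) C suc k)  ≡⟨ cong (suc k *_) (nCk+nC[k+1]≡[n+1]C[k+1] (suc n) k) ⟨
      suc k * (c + (suc n C suc k))  ≡⟨ *-distribˡ-+ (suc k) c (suc n C suc k) ⟩
      suc k * c + suc k * (suc n C suc k)  ≡⟨ cong (suc k * c +_) (absorption n k) ⟩
      suc k * c + l  ∎
    -- `x`, `y` and `z` are the quotients of `D` by `l`, `A` and `B`, and the identity of the
    -- harmonic triangle reads `z = x - y`. Truncation does no harm, since `x * l = y * A ≥ y * l`.
    z = x ∸ y
    zl≡ : z * l ≡ y * (suc k * c)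
    zl≡ = begin
      (x ∸ y) * l  ≡⟨ *-distribʳ-∸ l x y ⟩
      x * l ∸ y * l  ≡⟨ cong (_∸ y * l) (trans (sym D≡xl) (trans D≡yA (cong (y *_) A≡))) ⟩
      y * (suc k * c + l) ∸ y * l  ≡⟨ cong (_∸ y * l) (*-distribˡ-+ y (suc k * c) l) ⟩
      y * (suc k * c) + y * l ∸ y * l  ≡⟨ m+n∸n≡m (y * (suc k * c)) (y * l) ⟩
      y * (suc k * c)  ∎
    eq₁ : ∀ k y n c → k * (y * (n * c)) ≡ n * (y * (k * c))
    eq₁ = solve-∀
    eq₂ : ∀ n z l → n * (z * l) ≡ z * (n * l)
    eq₂ = solve-∀
    eq₃ : ∀ z n k c → z * (n * (k * c)) ≡ k * (z * (n * c))
    eq₃ = solve-∀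

  rowSum : ℕ → ℕ → ℕ
  rowSum n zero    = 0
  rowSum n (suc k) = rowSum n k + (n C k)

  rowSum-suc : ∀ n k → rowSum (suc n) (suc k) ≡ rowSum n (suc k) + rowSum n k
  rowSum-suc n zero    = refl
  rowSum-suc n (suc k) = begin
    rowSum (suc n) (suc k) + (suc n C suc k)  ≡⟨ cong₂ _+_ (rowSum-suc n k) (sym (nCk+nC[k+1]≡[n+1]C[k+1] n k)) ⟩
    rowSum n (suc k) + rowSum n k + ((n C k) + (n C suc k))  ≡⟨ eq (rowSum n (suc k)) (rowSum n k) (n C k) (n C suc k) ⟩
    rowSum n (suc k) + (n C suc k) + (rowSum n k + (n C k))  ∎
    where
    open ≡-Reasoning
    eq : ∀ a b c d → a + b + (c + d) ≡ a + d + (b + c)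
    eq = solve-∀

  rowSum≡2^ : ∀ n → rowSum n (suc n) ≡ 2 ^ n
  rowSum≡2^ zero    = refl
  rowSum≡2^ (suc n) = begin
    rowSum (suc n) (suc (suc n))  ≡⟨ rowSum-suc n (suc n) ⟩
    rowSum n (suc n) + (n C suc n) + rowSum n (suc n)  ≡⟨ cong (λ t → rowSum n (suc n) + t + rowSum n (suc n)) (k>n⇒nCk≡0 {n} {suc n} ≤-refl) ⟩
    rowSum n (suc n) + 0 + rowSum n (suc n)  ≡⟨ cong₂ (λ s t → s + 0 + t) (rowSum≡2^ n) (rowSum≡2^ n) ⟩
    2 ^ n + 0 + 2 ^ n  ≡⟨ eq (2 ^ n) ⟩
    2 ^ suc n  ∎
    where
    open ≡-Reasoning
    eq : ∀ a → a + 0 + a ≡ a + (a + 0)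
    eq = solve-∀

  -- Each `(n + 1) C(n,k)` divides `D` and is at most `D`. Summed over the `n + 1` values of `k`
  -- this gives `(n + 1) 2 ^ n ≤ (n + 1) D`.
  2^≤commonMultiple : ∀ n {D} → 0 < D → CommonMultiple (suc n) D → 2 ^ n ≤ D
  2^≤commonMultiple n {D} 0<D cm = *-cancelˡ-≤ (suc n) (subst (λ t → suc n * t ≤ suc n * D) (rowSum≡2^ n) (partial (suc n) ≤-refl))
    where
    partial : ∀ k → k ≤ suc n → suc n * rowSum n k ≤ k * D
    partial zero    _         = ≤-reflexive (*-zeroʳ (suc n))
    partial (suc k) (s≤s k≤n) = begin
      suc n * (rowSum n k + (n C k))  ≡⟨ *-distribˡ-+ (suc n) (rowSum n k) (n C k) ⟩
      suc n * rowSum n k + suc n * (n C k)  ≤⟨ +-mono-≤ (partial k (m≤n⇒m≤1+n k≤n)) (∣⇒≤ {{>-nonZero 0<D}} (leibniz-∣ n k 0<D k≤n cm)) ⟩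
      k * D + D  ≡⟨ +-comm (k * D) D ⟩
      suc k * D  ∎
      where open ≤-Reasoning

  lastTrue : ∀ {P : ℕ → Set} → (∀ n → Dec (P n)) → P 0 → ∀ n → ¬ P n → ∃[ k ] (P k × ¬ P (suc k))
  lastTrue P? P0 zero    ¬P0 = contradiction P0 ¬P0
  lastTrue P? P0 (suc n) ¬Pn with P? n
  ... | yes Pn  = n , Pn , ¬Pn
  ... | no  ¬Pn′ = lastTrue P? P0 n ¬Pn′

  n<2^n : ∀ n → n < 2 ^ n
  n<2^n zero    = s≤s z≤n
  n<2^n (suc n) = subst (suc (suc n) ≤_) (cong (2 ^ n +_) (sym (+-identityʳ (2 ^ n))))
    (+-mono-≤ (m^n>0 2 n) (n<2^n n))

  largestPower : ∀ p N → 1 < p → 0 < N → ∃[ e ] (p ^ e ≤ N × N < p ^ suc e)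
  largestPower p N 1<p 0<N with lastTrue (λ k → p ^ k ≤? N) 0<N N
      (<⇒≱ (<-≤-trans (n<2^n N) (^-monoˡ-≤ N 1<p)))
  ... | e , p^e≤N , p^1+e≰N = e , p^e≤N , ≰⇒> p^1+e≰N

  primePart : ∀ p → Prime p → ∀ m → 0 < m → ∃[ a ] ∃[ m′ ] (m ≡ p ^ a * m′ × ¬ p ∣ m′)
  primePart p pp = <-rec (λ m → 0 < m → ∃[ a ] ∃[ m′ ] (m ≡ p ^ a * m′ × ¬ p ∣ m′)) split
    where
    split : ∀ m → (∀ {k} → k < m → 0 < k → ∃[ a ] ∃[ m′ ] (k ≡ p ^ a * m′ × ¬ p ∣ m′)) →
      0 < m → ∃[ a ] ∃[ m′ ] (m ≡ p ^ a * m′ × ¬ p ∣ m′)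
    split m rec 0<m with p ∣? m
    ... | no  p∤m            = 0 , m , sym (*-identityˡ m) , p∤m
    ... | yes (divides zero m≡0) = contradiction m≡0 (≢-sym (<⇒≢ 0<m))
    ... | yes (divides q@(suc _) m≡qp) with rec {q} (subst (q <_) (sym m≡qp) (m<m*n q p (nonTrivial⇒n>1 p {{prime⇒nonTrivial pp}}))) (s≤s z≤n)
    ... | a , m′ , q≡ , p∤m′ = suc a , m′ , trans m≡qp (trans (*-comm q p) (trans (cong (p *_) q≡) (sym (*-assoc p (p ^ a) m′)))) , p∤m′

  primeDivisor : ∀ m → 1 < m → ∃[ p ] (Prime p × p ∣ m)
  primeDivisor m@(suc _) 1<m = first (factors (factorise m)) (isFactorisation (factorise m)) (factorsPrime (factorise m))
    where
    open PrimeFactorisation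
    first : ∀ ps → m ≡ product ps → All Prime ps → ∃[ p ] (Prime p × p ∣ m)
    first []       m≡1 _        = contradiction m≡1 (≢-sym (<⇒≢ 1<m))
    first (p ∷ ps) m≡  (pp ∷ _) = p , pp , divides (product ps) (trans m≡ (*-comm p (product ps)))

  -- The multiple is the product over `ps` of the largest powers `p ^ e ≤ N`, each of which
  -- contributes at most a factor `N`. The induction splits off from `m` its full power of one prime
  -- at a time.
  smoothCommonMultiple : ∀ N → 0 < N → (ps : List ℕ) → All Prime ps →
    ∃[ D ] (0 < D × D ≤ N ^ length ps ×
      (∀ m → 0 < m → m ≤ N → (∀ p → Prime p → p ∣ m → p ∈ ps) → m ∣ D))
  smoothCommonMultiple N 0<N []       []         = 1 , s≤s z≤n , ≤-refl , trivial
    where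
    trivial : ∀ m → 0 < m → m ≤ N → (∀ p → Prime p → p ∣ m → p ∈ []) → m ∣ 1
    trivial (suc zero)      _ _ _    = ∣-refl
    trivial m@(suc (suc _)) _ _ none with primeDivisor m (s≤s (s≤s z≤n))
    ... | p , pp , p∣m = contradiction (none p pp p∣m) λ ()
  smoothCommonMultiple N 0<N (p ∷ ps) (pp ∷ pps)
    with smoothCommonMultiple N 0<N ps pps | largestPower p N (nonTrivial⇒n>1 p {{prime⇒nonTrivial pp}}) 0<N
  ... | D , 0<D , D≤ , smooth | e , p^e≤N , N<p^1+e =
    p ^ e * D , *-mono-≤ (m^n>0 p {{prime⇒nonZero pp}} e) 0<D , *-mono-≤ p^e≤N D≤ , divisor
    where
    instance p≢0 = prime⇒nonZero pp
    divisor : ∀ m → 0 < m → m ≤ N → (∀ q → Prime q → q ∣ m → q ∈ p ∷ ps) → m ∣ p ^ e * D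
    divisor m 0<m m≤N inPs with primePart p pp m 0<m
    ... | a , zero   , m≡ , p∤m′ = contradiction (p ∣0) p∤m′
    ... | a , m′@(suc _) , m≡ , p∤m′ = subst (_∣ p ^ e * D) (sym m≡)
      (*-pres-∣ (m≤n⇒m^o∣n^o′ a≤e) (smooth m′ (s≤s z≤n) (≤-trans m′≤m m≤N) inRest))
      where
      p^a≤m : p ^ a ≤ m
      p^a≤m = subst (p ^ a ≤_) (sym m≡) (m≤m*n (p ^ a) m′)
      m′≤m : m′ ≤ m
      m′≤m = subst (m′ ≤_) (sym m≡) (m≤n*m m′ (p ^ a) {{m^n≢0 p a}})
      a≤e : a ≤ e
      a≤e = ≮⇒≥ λ e<a → <⇒≱ N<p^1+e (≤-trans (^-monoʳ-≤ p e<a) (≤-trans p^a≤m m≤N))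
      m≤n⇒m^o∣n^o′ : ∀ {a e} → a ≤ e → p ^ a ∣ p ^ e
      m≤n⇒m^o∣n^o′ {a} {e} a≤e = divides (p ^ (e ∸ a)) (trans (cong (p ^_) (sym (m∸n+n≡m a≤e))) (^-distribˡ-+-* p (e ∸ a) a))
      inRest : ∀ q → Prime q → q ∣ m′ → q ∈ ps
      inRest q pq q∣m′ with inPs q pq (subst (q ∣_) (sym m≡) (∣-trans q∣m′ (n∣m*n (p ^ a))))
      ... | here refl  = contradiction q∣m′ p∤m′
      ... | there q∈ps = q∈ps

  primesUpTo : ℕ → List ℕ
  primesUpTo N = filter prime? (upTo (suc N))

  primesUpTo-prime : ∀ N → All Prime (primesUpTo N)
  primesUpTo-prime N = Allₚ.all-filter prime? (upTo (suc N))

  -- Take all primes up to `n + 1`: the multiple of 1, ..., n + 1 built from them is at most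
  -- `(n + 1)` to the power π(n + 1), while every common multiple is at least `2 ^ n`.
  chebyshev : ∀ n → 2 ^ n ≤ suc n ^ length (primesUpTo (suc n))
  chebyshev n with smoothCommonMultiple (suc n) (s≤s z≤n) (primesUpTo (suc n)) (primesUpTo-prime (suc n))
  ... | D , 0<D , D≤ , smooth = ≤-trans (2^≤commonMultiple n 0<D λ m 0<m m≤ → smooth m 0<m m≤ λ p pp p∣m →
    ∈-filter⁺ prime? (∈-upTo⁺ (s≤s (≤-trans (∣⇒≤ {{>-nonZero 0<m}} p∣m) m≤))) pp) D≤

  -- Lists of primes

  unique-⊆-length : ∀ {A : Set} {xs ys : List A} → Unique xs → (∀ {x} → x ∈ xs → x ∈ ys) → length xs ≤ length ys
  unique-⊆-length {xs = []}     _          _  = z≤n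
  unique-⊆-length {xs = x ∷ xs} (x∉xs ∷ u) xs⊆ys with ∈-∃++ (xs⊆ys (here refl))
  ... | as , bs , refl = begin
      suc (length xs)  ≤⟨ s≤s (unique-⊆-length u inRest) ⟩
      suc (length (as ++ bs))  ≡⟨ cong suc (length-++ as) ⟩
      suc (length as + length bs)  ≡⟨ +-suc (length as) (length bs) ⟨
      length as + length (x ∷ bs)  ≡⟨ length-++ as ⟨
      length (as ++ x ∷ bs)  ∎
    where
    open ≤-Reasoning
    inRest : ∀ {y} → y ∈ xs → y ∈ as ++ bs
    inRest y∈xs with ∈-++⁻ as (xs⊆ys (there y∈xs))
    ... | inj₁ y∈as          = ∈-++⁺ˡ y∈as
    ... | inj₂ (here refl)   = contradiction refl (All.lookup x∉xs y∈xs)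
    ... | inj₂ (there y∈bs)  = ∈-++⁺ʳ as y∈bs

  length-filter-cover : ∀ {A : Set} {P Q : A → Set} (P? : Decidable P) (Q? : Decidable Q) →
    (∀ x → P x ⊎ Q x) → ∀ xs → length xs ≤ length (filter P? xs) + length (filter Q? xs)
  length-filter-cover P? Q? cover []       = z≤n
  length-filter-cover P? Q? cover (x ∷ xs) with P? x | Q? x
  ... | yes _ | yes _ = s≤s (≤-trans (length-filter-cover P? Q? cover xs) (+-monoʳ-≤ (length (filter P? xs)) (n≤1+n _)))
  ... | yes _ | no  _ = s≤s (length-filter-cover P? Q? cover xs)
  ... | no  _ | yes _ = subst (suc (length xs) ≤_) (sym (+-suc (length (filter P? xs)) _)) (s≤s (length-filter-cover P? Q? cover xs))
  ... | no ¬p | no ¬q = contradiction (cover x) [ ¬p , ¬q ]′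

  primesBetween : ℕ → ℕ → List ℕ
  primesBetween Z Y = filter (Z <?_) (primesUpTo Y)

  primesBetween-count : ∀ Z Y → length (primesUpTo Y) ≤ length (primesBetween Z Y) + suc Z
  primesBetween-count Z Y = ≤-trans (length-filter-cover (Z <?_) (_≤? Z) (λ p → swap (≤-<-connex p Z)) (primesUpTo Y)) (+-monoʳ-≤ _
    (subst (length (filter (_≤? Z) (primesUpTo Y)) ≤_) (length-upTo (suc Z))
      (unique-⊆-length (Uniqueₚ.filter⁺ (_≤? Z) (Uniqueₚ.filter⁺ prime? (Uniqueₚ.upTo⁺ (suc Y))))
        λ x∈ → ∈-upTo⁺ (s≤s (proj₂ (∈-filter⁻ (_≤? Z) {xs = primesUpTo Y} x∈))))))

  -- Euclid: a prime divisor of `1 + product ps` lying in `ps` would divide 1.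
  newPrime : ∀ ps → All Prime ps → ∃[ p ] (Prime p × All (λ q → p ≢ q) ps)
  newPrime ps pps with primeDivisor (suc (product ps)) (s≤s (productOfPrimes≥1 pps))
  ... | p , pp , p∣1+Π = p , pp , All.tabulate λ {q} q∈ps p≡q →
    contradiction (subst Prime (∣1⇒≡1 (∣m+n∣m⇒∣n (subst (p ∣_) (+-comm 1 (product ps)) p∣1+Π)
      (subst (_∣ product ps) (sym p≡q) (∈⇒∣product q∈ps)))) pp) ¬prime[1]
    where
    ∈⇒∣product : ∀ {q qs} → q ∈ qs → q ∣ product qs
    ∈⇒∣product {qs = q ∷ qs} (here refl) = m∣m*n (product qs)
    ∈⇒∣product {qs = q ∷ qs} (there q∈)  = ∣n⇒∣m*n q (∈⇒∣product q∈)

  extendPrimeSet : (S : PrimeSet) → ∀ n → ∃[ T ] (cardinality T ≡ n + cardinality S × (∀ {p} → p ∈ primes S → p ∈ primes T))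
  extendPrimeSet S zero    = S , refl , λ p∈ → p∈
  extendPrimeSet S (suc n) with extendPrimeSet S n
  ... | T , ∣T∣≡ , S⊆T with newPrime (primes T) (PrimeSet.allPrime T)
  ... | p , pp , p∉T = record
    { primes   = p ∷ primes T
    ; allPrime = pp ∷ PrimeSet.allPrime T
    ; distinct = p∉T ∷ PrimeSet.distinct T
    } , cong suc ∣T∣≡ , λ q∈ → there (S⊆T q∈)

  withoutRepetition : ∀ ps → All Prime ps → ∃[ S ] (cardinality S ≤ length ps × (∀ {p} → p ∈ ps → p ∈ primes S))
  withoutRepetition []       []         = record { primes = [] ; allPrime = [] ; distinct = [] } , z≤n , λ ()
  withoutRepetition (p ∷ ps) (pp ∷ pps) with withoutRepetition ps pps
  ... | S , ∣S∣≤ , ps⊆S with p ∈? primes S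
  ... | yes p∈S = S , m≤n⇒m≤1+n ∣S∣≤ , λ { (here refl) → p∈S ; (there q∈) → ps⊆S q∈ }
  ... | no  p∉S = record
    { primes   = p ∷ primes S
    ; allPrime = pp ∷ PrimeSet.allPrime S
    ; distinct = Allₚ.¬Any⇒All¬ (primes S) p∉S ∷ PrimeSet.distinct S
    } , s≤s ∣S∣≤ , λ { (here refl) → here refl ; (there q∈) → there (ps⊆S q∈) }

  -- The cardinality has to be exactly `s`, while the primes required may repeat and be fewer.
  -- Repetitions are removed and fresh primes added, which loses no S-units.
  primeSetContaining : ∀ ps → All Prime ps → ∀ s → length ps ≤ s →
    ∃[ S ] (cardinality S ≡ s × (∀ {p} → p ∈ ps → p ∈ primes S))
  primeSetContaining ps pps s ∣ps∣≤s with withoutRepetition ps pps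
  ... | S , ∣S∣≤ , ps⊆S with extendPrimeSet S (s ∸ cardinality S)
  ... | T , ∣T∣≡ , S⊆T = T , trans ∣T∣≡ (m∸n+n≡m (≤-trans ∣S∣≤ ∣ps∣≤s)) , λ p∈ → S⊆T (ps⊆S p∈)

  -- The list is kept with multiplicity: every factor is at least 2, so its length is at most log₂
  -- k, and that is the price of adding the primes of `k` to `S`.
  primeFactors : ∀ k → 0 < k → ∃[ ps ] (All Prime ps × 2 ^ length ps ≤ k × (∀ p → Prime p → p ∣ k → p ∈ ps))
  primeFactors k@(suc _) 0<k = factors F , factorsPrime F ,
    subst (2 ^ length (factors F) ≤_) (sym (isFactorisation F)) (large (factorsPrime F)) ,
    λ p pp p∣k → factorisationHasAllPrimeFactors pp (subst (p ∣_) (isFactorisation F) p∣k) (factorsPrime F)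
    where
    open PrimeFactorisation
    F = factorise k
    large : ∀ {ps} → All Prime ps → 2 ^ length ps ≤ product ps
    large []               = ≤-refl
    large {p ∷ _} (pp ∷ pps) = *-mono-≤ (nonTrivial⇒n>1 p {{prime⇒nonTrivial pp}}) (large pps)

  primeFactors-length : ∀ {k j} {ps : List ℕ} → 2 ^ length ps ≤ k → k ≤ 2 ^ j → length ps ≤ j
  primeFactors-length {j = j} {ps} h k≤ = ≮⇒≥ λ j<∣ps∣ → <⇒≱ (^-monoʳ-< 2 (s≤s (s≤s z≤n)) j<∣ps∣) (≤-trans h k≤)

  -- Products of primes

  length-cartesianProductWith : ∀ {A B C : Set} (f : A → B → C) xs ys →
    length (cartesianProductWith f xs ys) ≡ length xs * length ys
  length-cartesianProductWith f []       ys = refl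
  length-cartesianProductWith f (x ∷ xs) ys = trans (length-++ (map (f x) ys))
    (cong₂ _+_ (length-map (f x) ys) (length-cartesianProductWith f xs ys))

  ∈-drop⇒∈ : ∀ {A : Set} m {xs : List A} {x} → x ∈ drop m xs → x ∈ xs
  ∈-drop⇒∈ m {xs} x∈ = subst (_ ∈_) (take++drop≡id m xs) (∈-++⁺ʳ (take m xs) x∈)

  ∈-take⇒∈ : ∀ {A : Set} m {xs : List A} {x} → x ∈ take m xs → x ∈ xs
  ∈-take⇒∈ m {xs} x∈ = subst (_ ∈_) (take++drop≡id m xs) (∈-++⁺ˡ x∈)

  take-drop-disjoint : ∀ {A : Set} m {xs : List A} → Unique xs → ∀ {x} → x ∈ take m xs → x ∉ drop m xs
  take-drop-disjoint (suc m) {x ∷ xs} (x∉xs ∷ _) (here refl) x∈ = contradiction refl (All.lookup x∉xs (∈-drop⇒∈ m x∈))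
  take-drop-disjoint (suc m) {x ∷ xs} (_ ∷ u)    (there y∈)  x∈ = take-drop-disjoint m u y∈ x∈

  PrimeDivisors⊆ : List ℕ → ℕ → Set
  PrimeDivisors⊆ ps x = ∀ p → Prime p → p ∣ x → p ∈ ps

  prime-∣-prime : ∀ {p q} → Prime p → Prime q → p ∣ q → p ≡ q
  prime-∣-prime pp pq p∣q with prime⇒irreducible pq p∣q
  ... | inj₁ refl = contradiction pp ¬prime[1]
  ... | inj₂ p≡q  = p≡q

  -- The factor from `bs` can be read off the product, as the only member of `bs` dividing it: the
  -- elements of `X` have their primes in `qs`, which is disjoint from `bs`.
  unique-products : ∀ bs {qs X} → All Prime bs → Unique bs → (∀ {b} → b ∈ bs → b ∉ qs) →
    Unique X → All (PrimeDivisors⊆ qs) X → Unique (cartesianProductWith _*_ bs X)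
  unique-products []       _          _          _        _  _  = []
  unique-products (b ∷ bs) {qs} {X} (pb ∷ pbs) (b∉bs ∷ u) disjoint uX hX = Uniqueₚ.++⁺
    (Uniqueₚ.map⁺ (λ {x} {y} → *-cancelˡ-≡ x y b {{prime⇒nonZero pb}}) uX)
    (unique-products bs pbs u (λ b∈ → disjoint (there b∈)) uX hX)
    λ (v∈₁ , v∈₂) → separate v∈₁ v∈₂
    where
    separate : ∀ {v} → v ∈ map (b *_) X → v ∉ cartesianProductWith _*_ bs X
    separate v∈₁ v∈₂ with ∈-map⁻ (b *_) v∈₁ | ∈-cartesianProductWith⁻ _*_ bs X v∈₂
    ... | x , x∈X , refl | c , y , c∈bs , y∈X , bx≡cy
      with euclidsLemma c y pb (subst (b ∣_) bx≡cy (m∣m*n x))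
    ... | inj₁ b∣c = contradiction (prime-∣-prime pb (All.lookup pbs c∈bs) b∣c) (All.lookup b∉bs c∈bs)
    ... | inj₂ b∣y = contradiction (All.lookup hX y∈X b pb b∣y) (disjoint (here refl))

  -- Products of one prime from each of u blocks of m primes.
  blockProducts : ∀ lo hi m u ps → Unique ps → All Prime ps → All (λ p → lo ≤ p × p ≤ hi) ps → length ps ≡ u * m →
    ∃[ X ] (Unique X × length X ≡ m ^ u × All (λ x → PrimeDivisors⊆ ps x × 0 < x × lo ^ u ≤ x × x ≤ hi ^ u) X)
  blockProducts lo hi m zero    ps _ _ _ _ = 1 ∷ [] , [] ∷ [] , refl ,
    ((λ p pp p∣1 → contradiction (subst Prime (∣1⇒≡1 p∣1) pp) ¬prime[1]) , s≤s z≤n , ≤-refl , ≤-refl) ∷ []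
  blockProducts lo hi m (suc u) ps ups pps hps ∣ps∣≡
    with blockProducts lo hi m u (drop m ps) (Uniqueₚ.drop⁺ m ups) (Allₚ.drop⁺ m pps) (Allₚ.drop⁺ m hps)
      (trans (length-drop m ps) (trans (cong (_∸ m) ∣ps∣≡) (m+n∸m≡n m (u * m))))
  ... | X , uX , ∣X∣≡ , hX = cartesianProductWith _*_ bs X ,
    unique-products bs pbs (Uniqueₚ.take⁺ m ups) (take-drop-disjoint m ups) uX (All.map proj₁ hX) ,
    trans (length-cartesianProductWith _*_ bs X) (cong₂ _*_ ∣bs∣≡m ∣X∣≡) ,
    All.tabulate member
    where
    bs = take m ps
    pbs = Allₚ.take⁺ m pps
    ∣bs∣≡m : length bs ≡ m
    ∣bs∣≡m = trans (length-take m ps) (m≤n⇒m⊓n≡m (subst (m ≤_) (sym ∣ps∣≡) (m≤m+n m (u * m))))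
    member : ∀ {v} → v ∈ cartesianProductWith _*_ bs X →
      PrimeDivisors⊆ ps v × 0 < v × lo ^ suc u ≤ v × v ≤ hi ^ suc u
    member v∈ with ∈-cartesianProductWith⁻ _*_ bs X v∈
    ... | b , x , b∈bs , x∈X , refl with All.lookup hX x∈X | All.lookup (Allₚ.take⁺ m hps) b∈bs
    ... | divisors , 0<x , lo≤x , x≤hi | lo≤b , b≤hi =
      primeDivisors , *-mono-≤ (>-nonZero⁻¹ b {{prime⇒nonZero pb}}) 0<x , *-mono-≤ lo≤b lo≤x , *-mono-≤ b≤hi x≤hi
      where
      pb = All.lookup pbs b∈bs
      primeDivisors : PrimeDivisors⊆ ps (b * x)
      primeDivisors p pp p∣bx with euclidsLemma b x pp p∣bx
      ... | inj₁ p∣b = subst (_∈ ps) (sym (prime-∣-prime pp pb p∣b)) (∈-take⇒∈ m b∈bs)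
      ... | inj₂ p∣x = ∈-drop⇒∈ m (divisors p pp p∣x)

  -- Counting congruences

  total : ∀ {A : Set} → (A → ℕ) → List A → ℕ
  total f []       = 0
  total f (x ∷ xs) = f x + total f xs

  total-cong : ∀ {A : Set} {f g : A → ℕ} {xs} → All (λ x → f x ≡ g x) xs → total f xs ≡ total g xs
  total-cong []       = refl
  total-cong (e ∷ es) = cong₂ _+_ e (total-cong es)

  total-mono : ∀ {A : Set} {f g : A → ℕ} {xs} → All (λ x → f x ≤ g x) xs → total f xs ≤ total g xs
  total-mono []       = z≤n
  total-mono (h ∷ hs) = +-mono-≤ h (total-mono hs)

  total-+ : ∀ {A : Set} (f g : A → ℕ) xs → total (λ x → f x + g x) xs ≡ total f xs + total g xs
  total-+ f g []       = refl
  total-+ f g (x ∷ xs) = trans (cong (f x + g x +_) (total-+ f g xs)) (eq (f x) (g x) (total f xs) (total g xs))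
    where
    eq : ∀ a b c d → a + b + (c + d) ≡ a + c + (b + d)
    eq = solve-∀

  total-* : ∀ {A : Set} k (f : A → ℕ) xs → total (λ x → k * f x) xs ≡ k * total f xs
  total-* k f []       = sym (*-zeroʳ k)
  total-* k f (x ∷ xs) = trans (cong (k * f x +_) (total-* k f xs)) (sym (*-distribˡ-+ k (f x) (total f xs)))

  total-const : ∀ {A : Set} k (xs : List A) → total (λ _ → k) xs ≡ length xs * k
  total-const k []       = refl
  total-const k (x ∷ xs) = cong (k +_) (total-const k xs)

  total-swap : ∀ {A B : Set} (f : A → B → ℕ) xs ys →
    total (λ x → total (f x) ys) xs ≡ total (λ y → total (λ x → f x y) xs) ys
  total-swap f []       ys = sym (trans (total-const 0 ys) (*-zeroʳ (length ys)))
  total-swap f (x ∷ xs) ys = trans (cong (total (f x) ys +_) (total-swap f xs ys))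
    (sym (total-+ (f x) (λ y → total (λ x → f x y) xs) ys))

  total-++ : ∀ {A : Set} (f : A → ℕ) xs ys → total f (xs ++ ys) ≡ total f xs + total f ys
  total-++ f []       ys = refl
  total-++ f (x ∷ xs) ys = trans (cong (f x +_) (total-++ f xs ys)) (sym (+-assoc (f x) (total f xs) (total f ys)))

  total-map : ∀ {A B : Set} (f : B → ℕ) (g : A → B) xs → total f (map g xs) ≡ total (f ∘ g) xs
  total-map f g []       = refl
  total-map f g (x ∷ xs) = cong (f (g x) +_) (total-map f g xs)

  total-cartesianProduct : ∀ {A B : Set} (f : A × B → ℕ) xs ys →
    total f (cartesianProduct xs ys) ≡ total (λ x → total (λ y → f (x , y)) ys) xs
  total-cartesianProduct f []       ys = refl
  total-cartesianProduct f (x ∷ xs) ys = trans (total-++ f (map (x ,_) ys) (cartesianProduct xs ys))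
    (cong₂ _+_ (total-map f (x ,_) ys) (total-cartesianProduct f xs ys))

  indicator : ∀ {P : Set} → Dec P → ℕ
  indicator (yes _) = 1
  indicator (no  _) = 0

  indicator-cover : ∀ {P Q R : Set} (P? : Dec P) (Q? : Dec Q) (R? : Dec R) → (P → R) →
    indicator P? ≤ indicator Q? + indicator (¬? Q? ×-dec R?)
  indicator-cover (no  _) _       _       _   = z≤n
  indicator-cover (yes _) (yes _) _       _   = s≤s z≤n
  indicator-cover (yes _) (no  _) (yes _) _   = ≤-refl
  indicator-cover (yes p) (no  _) (no ¬r) p⇒r = contradiction (p⇒r p) ¬r

  length-filter-total : ∀ {A : Set} {P : A → Set} (P? : Decidable P) xs → length (filter P? xs) ≡ total (indicator ∘ P?) xs
  length-filter-total P? []       = refl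
  length-filter-total P? (x ∷ xs) with P? x
  ... | yes _ = cong suc (length-filter-total P? xs)
  ... | no  _ = length-filter-total P? xs

  δ : ℕ → ℕ → ℕ
  δ m n = indicator (m ≟ n)

  δ-refl : ∀ n → δ n n ≡ 1
  δ-refl n with n ≟ n
  ... | yes _   = refl
  ... | no  n≢n = contradiction refl n≢n

  δ-≢ : ∀ {m n} → m ≢ n → δ m n ≡ 0
  δ-≢ {m} {n} m≢n with m ≟ n
  ... | yes m≡n = contradiction m≡n m≢n
  ... | no  _   = refl

  total-δ : ∀ (f : ℕ → ℕ) {xs} → Unique xs → ∀ {k} → k ∈ xs → total (λ j → f j * δ k j) xs ≡ f k
  total-δ f {j ∷ xs} (j∉xs ∷ _) {k} (here refl) = begin
    f k * δ k k + total (λ j → f j * δ k j) xs  ≡⟨ cong₂ _+_ (cong (f k *_) (δ-refl k))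
        (total-cong (All.map (λ {j} k≢j → trans (cong (f j *_) (δ-≢ k≢j)) (*-zeroʳ (f j))) j∉xs)) ⟩
    f k * 1 + total (λ _ → 0) xs  ≡⟨ cong₂ _+_ (*-identityʳ (f k)) (trans (total-const 0 xs) (*-zeroʳ (length xs))) ⟩
    f k + 0  ≡⟨ +-identityʳ (f k) ⟩
    f k  ∎
    where open ≡-Reasoning
  total-δ f {j ∷ xs} (j∉xs ∷ u) {k} (there k∈) = trans
    (cong (_+ total (λ j → f j * δ k j) xs) (trans (cong (f j *_) (δ-≢ (λ k≡j → All.lookup j∉xs k∈ (sym k≡j)))) (*-zeroʳ (f j))))
    (total-δ f u k∈)

  total-δ-1 : ∀ {xs} → Unique xs → ∀ {k} → k ∈ xs → total (δ k) xs ≡ 1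
  total-δ-1 {xs} u {k} k∈ = trans (total-cong (All.universal (λ j → sym (*-identityˡ (δ k j))) xs)) (total-δ (λ _ → 1) u k∈)

  private
    2mn≤m²+n² : ∀ m n → 2 * (m * n) ≤ m * m + n * n
    2mn≤m²+n² m n with ≤-total m n
    ... | inj₁ m≤n = subst (λ t → 2 * (m * t) ≤ m * m + t * t) (m+[n∸m]≡n m≤n) (le m (n ∸ m))
      where
      eq : ∀ a b → a * a + (a + b) * (a + b) ≡ 2 * (a * (a + b)) + b * b
      eq = solve-∀
      le : ∀ a b → 2 * (a * (a + b)) ≤ a * a + (a + b) * (a + b)
      le a b = subst (2 * (a * (a + b)) ≤_) (sym (eq a b)) (m≤m+n _ (b * b))
    ... | inj₂ n≤m = subst (λ t → 2 * (t * n) ≤ t * t + n * n) (m+[n∸m]≡n n≤m) (le n (m ∸ n))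
      where
      eq : ∀ a b → (a + b) * (a + b) + a * a ≡ 2 * ((a + b) * a) + b * b
      eq = solve-∀
      le : ∀ a b → 2 * ((a + b) * a) ≤ (a + b) * (a + b) + a * a
      le a b = subst (2 * ((a + b) * a) ≤_) (sym (eq a b)) (m≤m+n _ (b * b))

  -- Cauchy–Schwarz for the class sizes N, linearised as N² ≥ 2 l N - l².
  collisions : ∀ {A : Set} (r : A → ℕ) q l xs → All (λ x → r x < q) xs → l * q ≤ length xs →
    l * length xs ≤ total (λ x → total (λ y → δ (r y) (r x)) xs) xs
  collisions r q l xs r<q lq≤ = subst (l * length xs ≤_) squares (+-cancelʳ-≤ (l * length xs) (l * length xs) (total (λ j → N j * N j) (upTo q)) (begin
    l * length xs + l * length xs  ≡⟨ cong (λ t → l * t + l * t) classes ⟨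
    l * total N (upTo q) + l * total N (upTo q)  ≡⟨ eq l (total N (upTo q)) ⟩
    2 * l * total N (upTo q)  ≡⟨ total-* (2 * l) N (upTo q) ⟨
    total (λ j → 2 * l * N j) (upTo q)  ≤⟨ total-mono (All.universal (λ j → subst (_≤ N j * N j + l * l) (eq₂ l (N j)) (2mn≤m²+n² (N j) l)) (upTo q)) ⟩
    total (λ j → N j * N j + l * l) (upTo q)  ≡⟨ total-+ (λ j → N j * N j) (λ _ → l * l) (upTo q) ⟩
    total (λ j → N j * N j) (upTo q) + total (λ _ → l * l) (upTo q)  ≡⟨ cong (total (λ j → N j * N j) (upTo q) +_) (trans (total-const (l * l) (upTo q)) (cong (_* (l * l)) (length-upTo q))) ⟩
    total (λ j → N j * N j) (upTo q) + q * (l * l)  ≡⟨ cong (total (λ j → N j * N j) (upTo q) +_) (eq₃ q l) ⟩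
    total (λ j → N j * N j) (upTo q) + l * (l * q)  ≤⟨ +-monoʳ-≤ (total (λ j → N j * N j) (upTo q)) (*-monoʳ-≤ l lq≤) ⟩
    total (λ j → N j * N j) (upTo q) + l * length xs  ∎))
    where
    open ≤-Reasoning
    N : ℕ → ℕ
    N j = total (λ x → δ (r x) j) xs
    eq : ∀ l t → l * t + l * t ≡ 2 * l * t
    eq = solve-∀
    eq₂ : ∀ l n → 2 * (n * l) ≡ 2 * l * n
    eq₂ = solve-∀
    eq₃ : ∀ q l → q * (l * l) ≡ l * (l * q)
    eq₃ = solve-∀
    classes : total N (upTo q) ≡ length xs
    classes = trans (total-swap (λ j x → δ (r x) j) (upTo q) xs)
      (trans (total-cong (All.map (λ rx<q → total-δ-1 (Uniqueₚ.upTo⁺ q) (∈-upTo⁺ rx<q)) r<q))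
        (trans (total-const 1 xs) (*-identityʳ (length xs))))
    squares : total (λ j → N j * N j) (upTo q) ≡ total (λ x → N (r x)) xs
    squares = trans (total-cong (All.universal (λ j → sym (total-* (N j) (λ x → δ (r x) j) xs)) (upTo q)))
      (trans (total-swap (λ j x → N j * δ (r x) j) (upTo q) xs)
        (total-cong (All.map (λ rx<q → total-δ N (Uniqueₚ.upTo⁺ q) (∈-upTo⁺ rx<q)) r<q)))

  averaging : ∀ {A : Set} (f : A → ℕ) M x xs → M * length (x ∷ xs) ≤ total f (x ∷ xs) → ∃[ y ] (M ≤ f y)
  averaging f M x xs h with M ≤? f x
  ... | yes M≤fx = x , M≤fx
  averaging f M x []        h | no M≰fx = contradiction (subst₂ _≤_ (*-identityʳ M) (+-identityʳ (f x)) h) M≰fx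
  averaging f M x (y ∷ ys) h | no M≰fx = averaging f M y ys (+-cancelˡ-≤ M _ _
    (subst (_≤ M + total f (y ∷ ys)) (*-suc M (length (y ∷ ys))) (≤-trans h (+-monoˡ-≤ _ (<⇒≤ (≰⇒> M≰fx))))))

  pigeonhole : ∀ {A : Set} (key : A → ℕ) K M xs → All (λ x → key x < suc K) xs → M * suc K ≤ length xs →
    ∃[ k ] (M ≤ length (filter (λ x → key x ≟ k) xs))
  pigeonhole {A} key K M xs key< h = k , subst (M ≤_) (sym (length-filter-total (λ x → key x ≟ k) xs)) (proj₂ average)
    where
    open ≤-Reasoning
    class : ℕ → ℕ
    class k = total (λ x → δ (key x) k) xs
    average : ∃[ k ] (M ≤ class k)
    average = averaging class M 0 (List.applyUpTo suc K) (begin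
      M * length (upTo (suc K))  ≡⟨ cong (M *_) (length-upTo (suc K)) ⟩
      M * suc K  ≤⟨ h ⟩
      length xs  ≡⟨ trans (total-const 1 xs) (*-identityʳ (length xs)) ⟨
      total (λ _ → 1) xs  ≡⟨ total-cong (All.map (λ k< → total-δ-1 (Uniqueₚ.upTo⁺ (suc K)) (∈-upTo⁺ k<)) key<) ⟨
      total (λ x → total (δ (key x)) (upTo (suc K))) xs  ≡⟨ total-swap (λ x k → δ (key x) k) xs (upTo (suc K)) ⟩
      total class (upTo (suc K))  ∎)
    k = proj₁ average

  Triple : Set
  Triple = ℕ × ℕ × ℕ

  Congruent : Triple → Set
  Congruent (q , a , c) = a ≢ c × q ∣ ∣ a - c ∣

  congruent? : Decidable Congruent
  congruent? (q , a , c) = ¬? (a ≟ c) ×-dec (q ∣? ∣ a - c ∣)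

  congruentTriples : List ℕ → List ℕ → List Triple
  congruentTriples Q A = filter congruent? (cartesianProduct Q (cartesianProduct A A))

  %-≡⇒∣ : ∀ a c q .{{_ : NonZero q}} → c % q ≡ a % q → q ∣ ∣ a - c ∣
  %-≡⇒∣ a c q e = divides ∣ a / q - c / q ∣ (begin
    ∣ a - c ∣  ≡⟨ cong₂ ∣_-_∣ (m≡m%n+[m/n]*n a q) (trans (m≡m%n+[m/n]*n c q) (cong (_+ c / q * q) e)) ⟩
    ∣ a % q + a / q * q - a % q + c / q * q ∣  ≡⟨ ∣m+n-m+o∣≡∣n-o∣ (a % q) (a / q * q) (c / q * q) ⟩
    ∣ a / q * q - c / q * q ∣  ≡⟨ *-distribʳ-∣-∣ q (a / q) (c / q) ⟨
    ∣ a / q - c / q ∣ * q  ∎)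
    where open ≡-Reasoning

  -- `collisions` with `suc l` also counts the `length A` diagonal pairs; removing them lowers
  -- `suc l` to `l`.
  congruentPairs-count : ∀ A → Unique A → ∀ l q .{{_ : NonZero q}} → suc l * q ≤ length A →
    l * length A ≤ total (λ a → total (λ c → indicator (congruent? (q , a , c))) A) A
  congruentPairs-count A uA l q h = +-cancelˡ-≤ (length A) _ _ (begin
    suc l * length A  ≤⟨ collisions (_% q) q (suc l) A (All.universal (λ a → m%n<n a q) A) h ⟩
    total (λ a → total (λ c → δ (c % q) (a % q)) A) A  ≤⟨ total-mono (All.universal (λ a → total-mono (All.universal (λ c → split a c) A)) A) ⟩
    total (λ a → total (λ c → δ a c + G a c) A) A  ≡⟨ total-cong (All.universal (λ a → total-+ (δ a) (G a) A) A) ⟩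
    total (λ a → total (δ a) A + total (G a) A) A  ≡⟨ total-+ (λ a → total (δ a) A) (λ a → total (G a) A) A ⟩
    total (λ a → total (δ a) A) A + total (λ a → total (G a) A) A  ≡⟨ cong (_+ total (λ a → total (G a) A) A)
        (trans (total-cong (All.tabulate λ a∈ → total-δ-1 uA a∈)) (trans (total-const 1 A) (*-identityʳ (length A)))) ⟩
    length A + total (λ a → total (G a) A) A  ∎)
    where
    open ≤-Reasoning
    G : ℕ → ℕ → ℕ
    G a c = indicator (congruent? (q , a , c))
    split : ∀ a c → δ (c % q) (a % q) ≤ δ a c + G a c
    split a c = indicator-cover (c % q ≟ a % q) (a ≟ c) (q ∣? ∣ a - c ∣) (%-≡⇒∣ a c q)

  congruentTriples-count : ∀ Q A → Unique A → ∀ l → All (λ q → 0 < q × suc l * q ≤ length A) Q →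
    length Q * (l * length A) ≤ length (congruentTriples Q A)
  congruentTriples-count Q A uA l hQ = begin
    length Q * (l * length A)  ≡⟨ total-const (l * length A) Q ⟨
    total (λ _ → l * length A) Q  ≤⟨ total-mono (All.map (λ {q} (0<q , h) → congruentPairs-count A uA l q {{>-nonZero 0<q}} h) hQ) ⟩
    total (λ q → total (λ a → total (λ c → indicator (congruent? (q , a , c))) A) A) Q
      ≡⟨ total-cong (All.universal (λ q → total-cartesianProduct (λ t → indicator (congruent? (q , t))) A A) Q) ⟨
    total (λ q → total (λ t → indicator (congruent? (q , t))) (cartesianProduct A A)) Q
      ≡⟨ total-cartesianProduct (λ t → indicator (congruent? t)) Q (cartesianProduct A A) ⟨
    total (λ t → indicator (congruent? t)) (cartesianProduct Q (cartesianProduct A A))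
      ≡⟨ length-filter-total congruent? (cartesianProduct Q (cartesianProduct A A)) ⟨
    length (congruentTriples Q A)  ∎
    where open ≤-Reasoning

  -- The quotient `|a - c| / q`, with a default value at `q = 0`.
  key : Triple → ℕ
  key (zero      , a , c) = 0
  key (q@(suc _) , a , c) = ∣ a - c ∣ / q

  key< : ∀ q {a c} K → 0 < q → ∣ a - c ∣ ≤ K * q → key (q , a , c) < suc K
  key< q@(suc _) K _ h = m<n*o⇒m/o<n (≤-<-trans h (m<n+m (K * q) (s≤s z≤n)))

  key-quotient : ∀ q {a c} → 0 < q → q ∣ ∣ a - c ∣ → ∣ a - c ∣ ≡ key (q , a , c) * q
  key-quotient q@(suc _) {a} {c} _ (divides m e) = trans e (cong (_* q)
    (trans (sym (m*n/n≡m m q)) (cong (_/ q) (sym e))))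

  SameQuotient : List ℕ → List ℕ → ℕ → Triple → Set
  SameQuotient Q A k (q , a , c) = q ∈ Q × a ∈ A × c ∈ A × a ≢ c × ∣ a - c ∣ ≡ k * q

  ∈-congruentTriples⁻ : ∀ Q A {q a c} → (q , a , c) ∈ congruentTriples Q A →
    q ∈ Q × a ∈ A × c ∈ A × Congruent (q , a , c)
  ∈-congruentTriples⁻ Q A t∈ =
    let t∈′ , congruent = ∈-filter⁻ congruent? {xs = cartesianProduct Q (cartesianProduct A A)} t∈
        q∈ , ac∈ = ∈-cartesianProduct⁻ Q (cartesianProduct A A) t∈′
        a∈ , c∈ = ∈-cartesianProduct⁻ A A ac∈
    in q∈ , a∈ , c∈ , congruent

  -- At least `length Q * (l * length A)` congruent triples have their quotients among 0, ..., K, so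
  -- some quotient is shared by `M` of them.
  sameQuotientTriples : ∀ Q A → Unique Q → Unique A → ∀ l K M →
    All (λ q → 0 < q × suc l * q ≤ length A) Q →
    (∀ {q a c} → q ∈ Q → a ∈ A → c ∈ A → ∣ a - c ∣ ≤ K * q) →
    M * suc K ≤ length Q * (l * length A) →
    ∃[ k ] ∃[ T ] (Unique T × All (SameQuotient Q A k) T × M ≤ length T)
  sameQuotientTriples Q A uQ uA l K M hQ bound h = k , T ,
    Uniqueₚ.filter⁺ (λ t → key t ≟ k) (Uniqueₚ.filter⁺ congruent? (Uniqueₚ.cartesianProduct⁺ uQ (Uniqueₚ.cartesianProduct⁺ uA uA))) ,
    All.tabulate (λ t∈ → member t∈) , proj₂ hole
    where
    small : ∀ {t} → t ∈ congruentTriples Q A → key t < suc K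
    small {q , a , c} t∈ =
      let q∈ , a∈ , c∈ , _ = ∈-congruentTriples⁻ Q A t∈
      in key< q K (proj₁ (All.lookup hQ q∈)) (bound q∈ a∈ c∈)
    hole = pigeonhole key K M (congruentTriples Q A) (All.tabulate small) (≤-trans h (congruentTriples-count Q A uA l hQ))
    k = proj₁ hole
    T = filter (λ t → key t ≟ k) (congruentTriples Q A)
    member : ∀ {t} → t ∈ T → SameQuotient Q A k t
    member {q , a , c} t∈ =
      let t∈′ , key≡k = ∈-filter⁻ (λ t → key t ≟ k) {xs = congruentTriples Q A} t∈
          q∈ , a∈ , c∈ , a≢c , q∣ = ∈-congruentTriples⁻ Q A t∈′
      in q∈ , a∈ , c∈ , a≢c ,
         trans (key-quotient q (proj₁ (All.lookup hQ q∈)) q∣) (cong (_* q) key≡k)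

-- Many solutions of u + u′ = 1 in S-units, and the parameters.

module Solutions where

  open Rationals hiding (_^_)
  open SUnits
  open Polynomials using (Splits)
  open SmoothNumbers
  open import Data.Integer.Base as ℤ using (+_; _⊖_)
  import Data.Integer.Properties as ℤₚ
  open import Data.List.Base as List using (List; []; _∷_; _++_; length; map; take; drop)
  open import Data.List.Membership.Propositional using (_∈_; _∉_)
  open import Data.List.Membership.Propositional.Properties using (∈-++⁺ˡ; ∈-++⁺ʳ; ∈-filter⁻; ∈-upTo⁻)
  open import Data.List.Properties using (length-++; length-map; length-take; length-drop)
  open import Data.List.Relation.Unary.All as All using (All; []; _∷_)
  import Data.List.Relation.Unary.All.Properties as Allₚ
  open import Data.List.Relation.Unary.AllPairs using ([]; _∷_)
  open import Data.List.Relation.Unary.Any using (here; there)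
  open import Data.List.Relation.Unary.Unique.Propositional using (Unique)
  import Data.List.Relation.Unary.Unique.Propositional.Properties as Uniqueₚ
  open import Data.Nat.Base
  open import Data.Nat.Coprimality using (Coprime; coprime-divisor)
  open import Data.Nat.Divisibility
  open import Data.Nat.Primality
  open import Data.Nat.Properties
  open import Data.Nat.Tactic.RingSolver using (solve-∀)
  open import Data.Product.Base using (∃-syntax; _×_; _,_; proj₁; proj₂)
  import Data.Rational.Base as ℚ
  open ℚ using (ℚ; 0ℚ; 1ℚ; ↥_; ↧ₙ_)
  import Data.Rational.Properties as ℚₚ
  open import Data.Sum.Base using (inj₁; inj₂)
  open import Data.Vec.Base using (Vec; []; _∷_)
  import Data.Vec.Relation.Unary.All as VecAll
  open import Relation.Binary.PropositionalEquality
  open import Relation.Nullary using (¬_; contradiction)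
  import Tactic.RingSolver as RingSolver

  -- Solutions of u + u′ = 1 in S-units

  fromℕ-injective : ∀ {m n} → fromℕ m ≡ fromℕ n → m ≡ n
  fromℕ-injective {m} {n} e = ≤-antisym (≮⇒≥ (λ n<m → strict n<m (sym e))) (≮⇒≥ (λ m<n → strict m<n e))
    where
    strict : ∀ {m n} → m < n → fromℕ m ≢ fromℕ n
    strict {m} {n} m<n e = ℚₚ.<-irrefl e (ℚₚ.<-≤-trans (subst₂ ℚ._<_ (ℚₚ.+-identityˡ (fromℕ m)) (sym (fromℕ-suc m))
      (ℚₚ.+-monoˡ-< (fromℕ m) 0<1)) (fromℕ-mono m<n))

  ∣⊖∣≡∣-∣ : ∀ m n → ℤ.∣ m ⊖ n ∣ ≡ ∣ m - n ∣
  ∣⊖∣≡∣-∣ m n with ≤-total m n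
  ... | inj₁ m≤n = trans (ℤₚ.∣⊖∣-≤ m≤n) (sym (m≤n⇒∣m-n∣≡n∸m m≤n))
  ... | inj₂ n≤m = trans (cong ℤ.∣_∣ (ℤₚ.⊖-≥ n≤m)) (sym (m≤n⇒∣n-m∣≡n∸m n≤m))

  coprime-if-no-common-prime : ∀ m n → 0 < m → (∀ p → Prime p → p ∣ m → ¬ p ∣ n) → Coprime m n
  coprime-if-no-common-prime m n 0<m h {zero}          (0∣m , _)     = contradiction (0∣⇒≡0 0∣m) (≢-sym (<⇒≢ 0<m))
  coprime-if-no-common-prime m n 0<m h {suc zero}      _             = refl
  coprime-if-no-common-prime m n 0<m h {i@(suc (suc _))} (i∣m , i∣n) =
    let p , pp , p∣i = primeDivisor i (s≤s (s≤s z≤n))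
    in contradiction (∣-trans p∣i i∣n) (h p pp (∣-trans p∣i i∣m))

  unique-map-on : ∀ {A B : Set} (f : A → B) {xs} → (∀ {x y} → x ∈ xs → y ∈ xs → f x ≡ f y → x ≡ y) →
    Unique xs → Unique (map f xs)
  unique-map-on f inj []          = []
  unique-map-on f inj (x∉xs ∷ u) =
    Allₚ.map⁺ (All.tabulate λ y∈ fx≡fy → All.lookup x∉xs y∈ (inj (here refl) (there y∈) fx≡fy)) ∷
    unique-map-on f (λ x∈ y∈ → inj (there x∈) (there y∈)) u

  ratio : Triple → ℚ
  ratio (q , a , c) = fromℕ a ℚ.* inv (fromℕ c)

  ratio-cross : ∀ {q a c q′ a′ c′} → 0 < c → 0 < c′ → ratio (q , a , c) ≡ ratio (q′ , a′ , c′) → a * c′ ≡ a′ * c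
  ratio-cross {q} {a} {c} {q′} {a′} {c′} 0<c 0<c′ e = fromℕ-injective (begin
    fromℕ (a * c′)  ≡⟨ fromℕ-* a c′ ⟩
    fromℕ a ℚ.* fromℕ c′  ≡⟨ cancel (fromℕ a) (fromℕ c′) (fromℕ c) (inv (fromℕ c)) (*-inv (0<fromℕ c {{>-nonZero 0<c}})) ⟨
    fromℕ c ℚ.* fromℕ c′ ℚ.* ratio (q , a , c)  ≡⟨ cong (fromℕ c ℚ.* fromℕ c′ ℚ.*_) e ⟩
    fromℕ c ℚ.* fromℕ c′ ℚ.* ratio (q′ , a′ , c′)  ≡⟨ cong (ℚ._* ratio (q′ , a′ , c′)) (ℚₚ.*-comm (fromℕ c) (fromℕ c′)) ⟩
    fromℕ c′ ℚ.* fromℕ c ℚ.* ratio (q′ , a′ , c′)  ≡⟨ cancel (fromℕ a′) (fromℕ c) (fromℕ c′) (inv (fromℕ c′)) (*-inv (0<fromℕ c′ {{>-nonZero 0<c′}})) ⟩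
    fromℕ a′ ℚ.* fromℕ c  ≡⟨ fromℕ-* a′ c ⟨
    fromℕ (a′ * c)  ∎)
    where
    open ≡-Reasoning
    eq : ∀ x y c i → c ℚ.* y ℚ.* (x ℚ.* i) ≡ x ℚ.* y ℚ.* (c ℚ.* i)
    eq = RingSolver.solve-∀ ℚ-ring
    cancel : ∀ x y c i → c ℚ.* i ≡ 1ℚ → c ℚ.* y ℚ.* (x ℚ.* i) ≡ x ℚ.* y
    cancel x y c i ci≡1 = trans (eq x y c i) (trans (cong (x ℚ.* y ℚ.*_) ci≡1) (ℚₚ.*-identityʳ (x ℚ.* y)))

  -- u = a / c determines 1 - u = ± k q / c, hence q / c, which is in lowest terms.
  ratio-injective : ∀ {k q a c q′ a′ c′} → 0 < c → 0 < c′ → 0 < q → 0 < q′ → Coprime q c → Coprime q′ c′ →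
    a ≢ c → ∣ a - c ∣ ≡ k * q → ∣ a′ - c′ ∣ ≡ k * q′ →
    ratio (q , a , c) ≡ ratio (q′ , a′ , c′) → (q , a , c) ≡ (q′ , a′ , c′)
  ratio-injective {k} {q} {a} {c} {q′} {a′} {c′} 0<c 0<c′ 0<q 0<q′ q⊥c q′⊥c′ a≢c kq kq′ e =
    cong₂ _,_ q≡q′ (cong₂ _,_ a≡a′ c≡c′)
    where
    open ≡-Reasoning
    cross : a * c′ ≡ a′ * c
    cross = ratio-cross {q} {a} {c} {q′} {a′} {c′} 0<c 0<c′ e
    k≢0 : NonZero k
    k≢0 = ≢-nonZero λ k≡0 → a≢c (∣m-n∣≡0⇒m≡n (trans kq (cong (_* q) k≡0)))
    qc′≡q′c : q * c′ ≡ q′ * c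
    qc′≡q′c = *-cancelˡ-≡ (q * c′) (q′ * c) k {{k≢0}} (begin
      k * (q * c′)  ≡⟨ *-assoc k q c′ ⟨
      k * q * c′  ≡⟨ cong (_* c′) kq ⟨
      ∣ a - c ∣ * c′  ≡⟨ *-distribʳ-∣-∣ c′ a c ⟩
      ∣ a * c′ - c * c′ ∣  ≡⟨ cong₂ ∣_-_∣ cross (*-comm c c′) ⟩
      ∣ a′ * c - c′ * c ∣  ≡⟨ *-distribʳ-∣-∣ c a′ c′ ⟨
      ∣ a′ - c′ ∣ * c  ≡⟨ cong (_* c) kq′ ⟩
      k * q′ * c  ≡⟨ *-assoc k q′ c ⟩
      k * (q′ * c)  ∎)
    q≡q′ : q ≡ q′
    q≡q′ = ∣-antisym
      (coprime-divisor q⊥c (subst (q ∣_) (trans qc′≡q′c (*-comm q′ c)) (m∣m*n c′)))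
      (coprime-divisor q′⊥c′ (subst (q′ ∣_) (trans (sym qc′≡q′c) (*-comm q c′)) (m∣m*n c)))
    c≡c′ : c ≡ c′
    c≡c′ = sym (*-cancelˡ-≡ c′ c q {{>-nonZero 0<q}} (trans qc′≡q′c (cong (_* c) (sym q≡q′))))
    a≡a′ : a ≡ a′
    a≡a′ = *-cancelʳ-≡ a a′ c {{>-nonZero 0<c}} (trans (cong (a *_) c≡c′) cross)

  -- `1 - a / c = (c - a) / c`. The signed difference `c ⊖ a` covers both orders of `a` and `c`, and
  -- its absolute value is the difference whose primes are controlled.
  ratio-splits : ∀ {S} q a c → 0 < a → 0 < c → a ≢ c → PrimeDivisorsIn S a → PrimeDivisorsIn S c →
    PrimeDivisorsIn S ∣ a - c ∣ → Splits S (ratio (q , a , c))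
  ratio-splits {S} q a c 0<a 0<c a≢c ha hc hac =
    sUnit-* (natural 0<a ha) invC ,
    subst (IsSUnit S) 1-u≡ (sUnit-* (sUnit-/ (c ⊖ a) 1 c⊖a≢0
      (subst (PrimeDivisorsIn S) (sym (trans (∣⊖∣≡∣-∣ c a) (∣-∣-comm c a))) hac) one) invC)
    where
    one : PrimeDivisorsIn S 1
    one p pp p∣1 = contradiction (subst Prime (∣1⇒≡1 p∣1) pp) ¬prime[1]
    natural : ∀ {n} → 0 < n → PrimeDivisorsIn S n → IsSUnit S (fromℕ n)
    natural {n} 0<n hn = sUnit-/ (+ n) 1 (λ e → <⇒≢ 0<n (sym (ℤₚ.+-injective e))) hn one
    invC = sUnit-inv (natural 0<c hc)
    c⊖a≢0 : c ⊖ a ≢ ℤ.0ℤ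
    c⊖a≢0 e = a≢c (sym (∣m-n∣≡0⇒m≡n (trans (sym (∣⊖∣≡∣-∣ c a)) (cong ℤ.∣_∣ e))))
    sum : ((c ⊖ a) ℚ./ 1) ℚ.+ fromℕ a ≡ fromℕ c
    sum = trans (sym (/1-+ (c ⊖ a) (+ a))) (cong (ℚ._/ 1) (trans (cong (ℤ._+ + a) (sym (ℤₚ.m-n≡m⊖n c a)))
      (trans (ℤₚ.+-assoc (+ c) (ℤ.- (+ a)) (+ a)) (trans (cong (λ t → + c ℤ.+ t) (ℤₚ.+-inverseˡ (+ a))) (ℤₚ.+-identityʳ (+ c))))))
    eq : ∀ d a i → d ℚ.* i ≡ (d ℚ.+ a) ℚ.* i ℚ.- a ℚ.* i
    eq = RingSolver.solve-∀ ℚ-ring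
    1-u≡ : ((c ⊖ a) ℚ./ 1) ℚ.* inv (fromℕ c) ≡ 1ℚ ℚ.- ratio (q , a , c)
    1-u≡ = trans (eq ((c ⊖ a) ℚ./ 1) (fromℕ a) (inv (fromℕ c)))
      (cong (ℚ._- ratio (q , a , c)) (trans (cong (ℚ._* inv (fromℕ c)) sum) (*-inv (0<fromℕ c {{>-nonZero 0<c}}))))

  2^-*-2^ : ∀ m n → 2 ^ m * 2 ^ n ≡ 2 ^ (m + n)
  2^-*-2^ m n = sym (^-distribˡ-+-* 2 m n)

  -- Chebyshev's bound reads 2 ^ (32 f) - 1 ≤ 32 f π(2 ^ (32 f)).
  enoughPrimes : ∀ f → 9 ≤ f → 7 * 2 ^ (30 * f) ≤ length (primesBetween (2 ^ (30 * f)) (2 ^ (32 * f)))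
  enoughPrimes f 9≤f = ≮⇒≥ λ few → <⇒≱ (exceeds (≤-trans (primesBetween-count Z Y) (crowded few))) bound
    where
    open ≤-Reasoning
    Z = 2 ^ (30 * f)
    Y = 2 ^ (32 * f)
    π = length (primesUpTo Y)
    instance Y≢0 = m^n≢0 2 (32 * f)
    bound : Y ≤ suc (32 * f * π)
    bound = subst (_≤ suc (32 * f * π)) (suc-pred Y) (s≤s (≮⇒≥ λ h →
      <⇒≱ (^-monoʳ-< 2 (s≤s (s≤s z≤n)) h) (begin
        2 ^ pred Y  ≤⟨ chebyshev (pred Y) ⟩
        suc (pred Y) ^ length (primesUpTo (suc (pred Y)))  ≡⟨ cong (λ t → t ^ length (primesUpTo t)) (suc-pred Y) ⟩
        Y ^ π  ≡⟨ ^-*-assoc 2 (32 * f) π ⟩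
        2 ^ (32 * f * π)  ∎)))
    crowded : length (primesBetween Z Y) < 7 * Z → length (primesBetween Z Y) + suc Z ≤ 8 * Z
    crowded few = subst₂ _≤_ (sym (+-suc (length (primesBetween Z Y)) Z)) (+-comm (7 * Z) Z) (+-monoˡ-≤ Z few)
    factor : ∀ f Z → Z + 32 * f * (8 * Z) ≡ (1 + 256 * f) * Z
    factor = solve-∀
    -- Here `256 * f` is 8 times log₂ Y, and `2 ^ (2 * f)` is the ratio `Y / Z`. The hypothesis
    -- `9 ≤ f` is what lets `2 ^ 9` be absorbed into `2 ^ f`.
    small : 1 + 256 * f < 2 ^ (2 * f)
    small = begin-strict
      1 + 256 * f  ≤⟨ +-monoˡ-≤ (256 * f) (≤-trans (s≤s z≤n) (≤-trans 9≤f (m≤n*m f 256))) ⟩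
      256 * f + 256 * f  ≡⟨ eq f ⟩
      2 ^ 9 * f  <⟨ *-monoʳ-< (2 ^ 9) (n<2^n f) ⟩
      2 ^ 9 * 2 ^ f  ≤⟨ *-monoˡ-≤ (2 ^ f) (^-monoʳ-≤ 2 9≤f) ⟩
      2 ^ f * 2 ^ f  ≡⟨ 2^-*-2^ f f ⟩
      2 ^ (f + f)  ≡⟨ cong (λ t → 2 ^ (f + t)) (+-identityʳ f) ⟨
      2 ^ (2 * f)  ∎
      where
      eq : ∀ f → 256 * f + 256 * f ≡ 512 * f
      eq = solve-∀
    exceeds : π ≤ 8 * Z → suc (32 * f * π) < Y
    exceeds h = begin-strict
      1 + 32 * f * π  ≤⟨ +-mono-≤ (m^n>0 2 (30 * f)) (*-monoʳ-≤ (32 * f) h) ⟩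
      Z + 32 * f * (8 * Z)  ≡⟨ factor f Z ⟩
      (1 + 256 * f) * Z  <⟨ *-monoˡ-< Z {{m^n≢0 2 (30 * f)}} small ⟩
      2 ^ (2 * f) * 2 ^ (30 * f)  ≡⟨ 2^-*-2^ (2 * f) (30 * f) ⟩
      2 ^ (2 * f + 30 * f)  ≡⟨ cong (2 ^_) (sym (*-distribʳ-+ f 2 30)) ⟩
      2 ^ (32 * f)  ∎

  -- Let B = 4 ^ f. The primes lie in (B ^ 15, B ^ 16] and come in blocks of m = B ^ 7;
  -- elements of A and Q take one prime from each of 5 w and 2 w blocks, where w = B ^ 8.
  -- Hence |A| = B ^ (35 w), |Q| = B ^ (14 w), B ^ (30 w) ≤ q ≤ B ^ (32 w) and a ≤ B ^ (80 w):
  -- about B ^ ((14 + 2 · 35 - 32) w) triples share B ^ ((80 - 30) w) quotients.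
  module Construction (f : ℕ) (9≤f : 9 ≤ f) where

    w m : ℕ
    w = 2 ^ (16 * f)
    m = 2 ^ (14 * f)

    private
      Z = 2 ^ (30 * f)
      Y = 2 ^ (32 * f)
      available = primesBetween Z Y
      g = f * w

      0<w : 0 < w
      0<w = m^n>0 2 (16 * f)

      3≤4g : 3 ≤ 4 * g
      3≤4g = ≤-trans (s≤s (s≤s (s≤s z≤n))) (*-monoʳ-≤ 4 {1} (*-mono-≤ (≤-trans (s≤s z≤n) 9≤f) 0<w))

      wm≡Z : w * m ≡ Z
      wm≡Z = trans (2^-*-2^ (16 * f) (14 * f)) (cong (2 ^_) (sym (*-distribʳ-+ f 16 14)))

      blocks : ∀ k → k * w * m ≡ k * Z
      blocks k = trans (*-assoc k w m) (cong (k *_) wm≡Z)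

      available-enough : 5 * w * m + 2 * w * m ≤ length available
      available-enough = subst (_≤ length available) (sym (trans (cong₂ _+_ (blocks 5) (blocks 2)) (sym (*-distribʳ-+ Z 5 2))))
        (enoughPrimes f 9≤f)

      psA psQ : List ℕ
      psA = take (5 * w * m) available
      psQ = take (2 * w * m) (drop (5 * w * m) available)

      ∣psA∣ : length psA ≡ 5 * w * m
      ∣psA∣ = trans (length-take (5 * w * m) available) (m≤n⇒m⊓n≡m (m+n≤o⇒m≤o (5 * w * m) available-enough))

      ∣psQ∣ : length psQ ≡ 2 * w * m
      ∣psQ∣ = trans (length-take (2 * w * m) (drop (5 * w * m) available)) (m≤n⇒m⊓n≡m
        (subst (2 * w * m ≤_) (sym (length-drop (5 * w * m) available)) (m+n≤o⇒m≤o∸n (2 * w * m)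
          (subst (_≤ length available) (+-comm (5 * w * m) (2 * w * m)) available-enough))))

      available-unique : Unique available
      available-unique = Uniqueₚ.filter⁺ (Z <?_) (Uniqueₚ.filter⁺ prime? (Uniqueₚ.upTo⁺ (suc Y)))

      available-prime : All Prime available
      available-prime = Allₚ.filter⁺ (Z <?_) (primesUpTo-prime Y)

      available-range : All (λ p → Z ≤ p × p ≤ Y) available
      available-range = All.tabulate λ p∈ →
        let p∈′ , Z<p = ∈-filter⁻ (Z <?_) {xs = primesUpTo Y} p∈
        in <⇒≤ Z<p , m<1+n⇒m≤n (∈-upTo⁻ (proj₁ (∈-filter⁻ prime? {xs = List.upTo (suc Y)} p∈′)))

      takeA : ∀ {P : ℕ → Set} → All P available → All P psA
      takeA = Allₚ.take⁺ (5 * w * m)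

      takeQ : ∀ {P : ℕ → Set} → All P available → All P psQ
      takeQ h = Allₚ.take⁺ (2 * w * m) (Allₚ.drop⁺ (5 * w * m) h)

      disjoint : ∀ {p} → p ∈ psQ → p ∉ psA
      disjoint p∈Q p∈A = take-drop-disjoint (5 * w * m) available-unique p∈A (∈-take⇒∈ (2 * w * m) p∈Q)

      productsA = blockProducts Z Y m (5 * w) psA (Uniqueₚ.take⁺ (5 * w * m) available-unique)
        (takeA available-prime) (takeA available-range) ∣psA∣
      productsQ = blockProducts Z Y m (2 * w) psQ (Uniqueₚ.take⁺ (2 * w * m) (Uniqueₚ.drop⁺ (5 * w * m) available-unique))
        (takeQ available-prime) (takeQ available-range) ∣psQ∣

      A Q : List ℕ
      A = proj₁ productsA
      Q = proj₁ productsQ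

      uA : Unique A
      uA = proj₁ (proj₂ productsA)
      uQ : Unique Q
      uQ = proj₁ (proj₂ productsQ)

      propsA : All (λ x → PrimeDivisors⊆ psA x × 0 < x × Z ^ (5 * w) ≤ x × x ≤ Y ^ (5 * w)) A
      propsA = proj₂ (proj₂ (proj₂ productsA))
      propsQ : All (λ x → PrimeDivisors⊆ psQ x × 0 < x × Z ^ (2 * w) ≤ x × x ≤ Y ^ (2 * w)) Q
      propsQ = proj₂ (proj₂ (proj₂ productsQ))

      power : ∀ a b c → a * f * (b * w) ≡ c * g → (2 ^ (a * f)) ^ (b * w) ≡ 2 ^ (c * g)
      power a b c e = trans (^-*-assoc 2 (a * f) (b * w)) (cong (2 ^_) e)

      ∣A∣ : length A ≡ 2 ^ (70 * g)
      ∣A∣ = trans (proj₁ (proj₂ (proj₂ productsA))) (power 14 5 70 (eq f w))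
        where
        eq : ∀ f w → 14 * f * (5 * w) ≡ 70 * (f * w)
        eq = solve-∀

      ∣Q∣ : length Q ≡ 2 ^ (28 * g)
      ∣Q∣ = trans (proj₁ (proj₂ (proj₂ productsQ))) (power 14 2 28 (eq f w))
        where
        eq : ∀ f w → 14 * f * (2 * w) ≡ 28 * (f * w)
        eq = solve-∀

      A≤ : ∀ {a} → a ∈ A → a ≤ 2 ^ (160 * g)
      A≤ {a} a∈ = subst (a ≤_) (power 32 5 160 (eq f w)) (proj₂ (proj₂ (proj₂ (All.lookup propsA a∈))))
        where
        eq : ∀ f w → 32 * f * (5 * w) ≡ 160 * (f * w)
        eq = solve-∀

      Q≤ : ∀ {q} → q ∈ Q → q ≤ 2 ^ (64 * g)
      Q≤ {q} q∈ = subst (q ≤_) (power 32 2 64 (eq f w)) (proj₂ (proj₂ (proj₂ (All.lookup propsQ q∈))))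
        where
        eq : ∀ f w → 32 * f * (2 * w) ≡ 64 * (f * w)
        eq = solve-∀

      ≤Q : ∀ {q} → q ∈ Q → 2 ^ (60 * g) ≤ q
      ≤Q {q} q∈ = subst (_≤ q) (power 30 2 60 (eq f w)) (proj₁ (proj₂ (proj₂ (All.lookup propsQ q∈))))
        where
        eq : ∀ f w → 30 * f * (2 * w) ≡ 60 * (f * w)
        eq = solve-∀

      -- `K` is the bound for A over the lower bound for Q, with exponent 160 - 60. `suc l` is
      -- `length A` over the upper bound for Q, with exponent 70 - 64. `M` has exponent 28 + 6 + 70
      -- - 100 = 4; its loss of a factor 4 pays for `K + 1 ≤ 2 K` and `suc l ≤ 2 l`.
      K l M : ℕ
      K = 2 ^ (100 * g)
      l = pred (2 ^ (6 * g))
      M = 2 ^ (4 * g ∸ 2)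

      suc-l : suc l ≡ 2 ^ (6 * g)
      suc-l = suc-pred (2 ^ (6 * g)) {{m^n≢0 2 (6 * g)}}

      classes : All (λ q → 0 < q × suc l * q ≤ length A) Q
      classes = All.tabulate λ {q} q∈ → proj₁ (proj₂ (All.lookup propsQ q∈)) , (begin
        suc l * q  ≤⟨ *-mono-≤ (≤-reflexive suc-l) (Q≤ q∈) ⟩
        2 ^ (6 * g) * 2 ^ (64 * g)  ≡⟨ trans (2^-*-2^ (6 * g) (64 * g)) (cong (2 ^_) (sym (*-distribʳ-+ g 6 64))) ⟩
        2 ^ (70 * g)  ≡⟨ ∣A∣ ⟨
        length A  ∎)
        where open ≤-Reasoning

      differences : ∀ {q a c} → q ∈ Q → a ∈ A → c ∈ A → ∣ a - c ∣ ≤ K * q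
      differences {q} {a} {c} q∈ a∈ c∈ = begin
        ∣ a - c ∣  ≤⟨ ∣m-n∣≤m⊔n a c ⟩
        a ⊔ c  ≤⟨ ⊔-lub (A≤ a∈) (A≤ c∈) ⟩
        2 ^ (160 * g)  ≡⟨ trans (cong (2 ^_) (*-distribʳ-+ g 100 60)) (sym (2^-*-2^ (100 * g) (60 * g))) ⟩
        2 ^ (100 * g) * 2 ^ (60 * g)  ≤⟨ *-monoʳ-≤ K (≤Q q∈) ⟩
        K * q  ∎
        where open ≤-Reasoning

      count : M * suc K ≤ length Q * (l * length A)
      count = *-cancelˡ-≤ 2 (begin
        2 * (M * suc K)  ≤⟨ *-monoʳ-≤ 2 (*-monoʳ-≤ M (+-monoˡ-≤ K (m^n>0 2 (100 * g)))) ⟩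
        2 * (M * (K + K))  ≡⟨ eq₁ M K ⟩
        2 ^ 2 * M * K  ≡⟨ cong (_* K) (trans (2^-*-2^ 2 (4 * g ∸ 2)) (cong (2 ^_) (m+[n∸m]≡n (≤-trans (n≤1+n 2) 3≤4g)))) ⟩
        2 ^ (4 * g) * K  ≡⟨ trans (2^-*-2^ (4 * g) (100 * g)) (cong (2 ^_) (sym (*-distribʳ-+ g 4 100))) ⟩
        2 ^ (104 * g)  ≡⟨ trans (cong (2 ^_) (eq₂ g)) (trans (sym (2^-*-2^ (28 * g) (6 * g + 70 * g))) (cong (2 ^ (28 * g) *_) (sym (2^-*-2^ (6 * g) (70 * g))))) ⟩
        2 ^ (28 * g) * (2 ^ (6 * g) * 2 ^ (70 * g))  ≡⟨ cong (λ t → 2 ^ (28 * g) * (t * 2 ^ (70 * g))) suc-l ⟨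
        2 ^ (28 * g) * (suc l * 2 ^ (70 * g))  ≤⟨ *-monoʳ-≤ (2 ^ (28 * g)) (*-monoˡ-≤ (2 ^ (70 * g)) (+-monoˡ-≤ l 0<l)) ⟩
        2 ^ (28 * g) * ((l + l) * 2 ^ (70 * g))  ≡⟨ eq₃ (2 ^ (28 * g)) l (2 ^ (70 * g)) ⟩
        2 * (2 ^ (28 * g) * (l * 2 ^ (70 * g)))  ≡⟨ cong₂ (λ s t → 2 * (s * (l * t))) ∣Q∣ ∣A∣ ⟨
        2 * (length Q * (l * length A))  ∎)
        where
        open ≤-Reasoning
        0<l : 0 < l
        0<l = s≤s⁻¹ (subst (2 ≤_) (sym suc-l) (^-monoʳ-≤ 2 {1} {6 * g} (≤-trans (≤-trans (s≤s z≤n) 3≤4g) (*-monoˡ-≤ g {4} {6} (m≤m+n 4 2)))))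
        eq₁ : ∀ M K → 2 * (M * (K + K)) ≡ 4 * M * K
        eq₁ = solve-∀
        eq₂ : ∀ g → 104 * g ≡ 28 * g + (6 * g + 70 * g)
        eq₂ = solve-∀
        eq₃ : ∀ a l b → a * ((l + l) * b) ≡ 2 * (a * (l * b))
        eq₃ = solve-∀

      triples = sameQuotientTriples Q A uQ uA l K M classes differences count
      k = proj₁ triples
      T = proj₁ (proj₂ triples)
      uT = proj₁ (proj₂ (proj₂ triples))
      same : All (SameQuotient Q A k) T
      same = proj₁ (proj₂ (proj₂ (proj₂ triples)))
      M≤∣T∣ : M ≤ length T
      M≤∣T∣ = proj₂ (proj₂ (proj₂ (proj₂ triples)))

      -- The range of `k` is read off a single triple: `a ≢ c` makes `k` positive, and the bound on
      -- differences makes it at most `K`. Hence the need for a nonempty list.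
      inhabitant : ∀ {T} → All (SameQuotient Q A k) T → 0 < length T → 0 < k × k ≤ K
      inhabitant (_∷_ {x = q , a , c} (q∈ , a∈ , c∈ , a≢c , e) _) _ =
        n≢0⇒n>0 (λ k≡0 → a≢c (∣m-n∣≡0⇒m≡n (trans e (cong (_* q) k≡0)))) ,
        *-cancelʳ-≤ k K q {{>-nonZero (proj₁ (proj₂ (All.lookup propsQ q∈)))}} (subst (_≤ K * q) e (differences q∈ a∈ c∈))

      k-range : 0 < k × k ≤ K
      k-range = inhabitant same (≤-trans (m^n>0 2 (4 * g ∸ 2)) M≤∣T∣)

      factorsK = primeFactors k (proj₁ k-range)
      psK = proj₁ factorsK

    solutionPrimes : List ℕ
    solutionPrimes = psA ++ psQ ++ psK

    solutionPrimes-prime : All Prime solutionPrimes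
    solutionPrimes-prime = Allₚ.++⁺ (takeA available-prime) (Allₚ.++⁺ (takeQ available-prime) (proj₁ (proj₂ factorsK)))

    -- As `k ≤ 2 ^ (100 g)`, it adds at most `100 g` primes. These are negligible beside `7 Z`,
    -- since `g = f * 2 ^ (16 * f)` and `Z = 2 ^ (30 * f)`.
    solutionPrimes-length : length solutionPrimes ≤ 7 * 2 ^ (30 * f) + 100 * (f * w)
    solutionPrimes-length = begin
      length (psA ++ psQ ++ psK)  ≡⟨ trans (length-++ psA) (cong (λ t → length psA + t) (length-++ psQ)) ⟩
      length psA + (length psQ + length psK)  ≡⟨ cong₂ (λ s t → s + (t + length psK)) (trans ∣psA∣ (blocks 5)) (trans ∣psQ∣ (blocks 2)) ⟩
      5 * Z + (2 * Z + length psK)  ≤⟨ +-monoʳ-≤ (5 * Z) (+-monoʳ-≤ (2 * Z)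
          (primeFactors-length {ps = psK} (proj₁ (proj₂ (proj₂ factorsK))) (proj₂ k-range))) ⟩
      5 * Z + (2 * Z + 100 * g)  ≡⟨ eq Z (100 * g) ⟩
      7 * Z + 100 * g  ∎
      where
      open ≤-Reasoning
      eq : ∀ z h → 5 * z + (2 * z + h) ≡ 7 * z + h
      eq = solve-∀

    module _ (S : PrimeSet) (inS : ∀ {p} → p ∈ solutionPrimes → p ∈ primes S) where

      solutions : List ℚ
      solutions = map ratio T

      private
        divisorsA : ∀ {a} → a ∈ A → PrimeDivisorsIn S a
        divisorsA a∈ p pp p∣a = inS (∈-++⁺ˡ (proj₁ (All.lookup propsA a∈) p pp p∣a))

        divisorsQ : ∀ {q} → q ∈ Q → PrimeDivisorsIn S q
        divisorsQ q∈ p pp p∣q = inS (∈-++⁺ʳ psA (∈-++⁺ˡ (proj₁ (All.lookup propsQ q∈) p pp p∣q)))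

        divisorsK : PrimeDivisorsIn S k
        divisorsK p pp p∣k = inS (∈-++⁺ʳ psA (∈-++⁺ʳ psQ (proj₂ (proj₂ (proj₂ factorsK)) p pp p∣k)))

        positiveA : ∀ {a} → a ∈ A → 0 < a
        positiveA a∈ = proj₁ (proj₂ (All.lookup propsA a∈))

        positiveQ : ∀ {q} → q ∈ Q → 0 < q
        positiveQ q∈ = proj₁ (proj₂ (All.lookup propsQ q∈))

        coprime : ∀ {q c} → q ∈ Q → c ∈ A → Coprime q c
        coprime {q} {c} q∈ c∈ = coprime-if-no-common-prime q c (positiveQ q∈) λ p pp p∣q p∣c →
          disjoint (proj₁ (All.lookup propsQ q∈) p pp p∣q) (proj₁ (All.lookup propsA c∈) p pp p∣c)

        injective : ∀ {s t} → SameQuotient Q A k s → SameQuotient Q A k t → ratio s ≡ ratio t → s ≡ t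
        injective {q , a , c} {q′ , a′ , c′} (q∈ , a∈ , c∈ , a≢c , e) (q∈′ , a∈′ , c∈′ , _ , e′) =
          ratio-injective {k} (positiveA c∈) (positiveA c∈′) (positiveQ q∈) (positiveQ q∈′) (coprime q∈ c∈) (coprime q∈′ c∈′) a≢c e e′

      solutions-unique : Unique solutions
      solutions-unique = unique-map-on ratio (λ s∈ t∈ → injective (All.lookup same s∈) (All.lookup same t∈)) uT

      solutions-split : All (Splits S) solutions
      solutions-split = Allₚ.map⁺ (All.map (λ {t} → splits {t}) same)
        where
        splits : ∀ {t} → SameQuotient Q A k t → Splits S (ratio t)
        splits {q , a , c} (q∈ , a∈ , c∈ , a≢c , e) = ratio-splits q a c (positiveA a∈) (positiveA c∈) a≢c
          (divisorsA a∈) (divisorsA c∈)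
          (subst (PrimeDivisorsIn S) (sym e) (primeDivisors-* {S} k q divisorsK (divisorsQ q∈)))

      solutions-count : 2 ^ (4 * (f * w) ∸ 2) ≤ length solutions
      solutions-count = subst (M ≤_) (sym (length-map ratio T)) M≤∣T∣

  -- Choice of the parameters

  -- The tree of solutions divides by the coefficients, so these have to be S-units; the primes
  -- needed depend on the coefficients alone, not on `s`.
  coefficientPrimes : ∀ {n} (a : Vec ℚ n) → VecAll.All (_≢ 0ℚ) a →
    ∃[ ps ] (All Prime ps × (∀ S → (∀ {p} → p ∈ ps → p ∈ primes S) → VecAll.All (IsSUnit S) a))
  coefficientPrimes []      VecAll.[]             = [] , [] , λ _ _ → VecAll.[]
  coefficientPrimes (q ∷ a) (q≢0 VecAll.∷ a≢0) =
    let ns , ns-prime , _ , ns-factors = primeFactors ℤ.∣ ↥ q ∣ (n≢0⇒n>0 (λ e → ↥≢0 q≢0 (ℤₚ.∣i∣≡0⇒i≡0 e)))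
        ds , ds-prime , _ , ds-factors = primeFactors (↧ₙ q) (s≤s z≤n)
        ps , ps-prime , units = coefficientPrimes a a≢0
    in ns ++ ds ++ ps , Allₚ.++⁺ ns-prime (Allₚ.++⁺ ds-prime ps-prime) , λ S inS →
      record
        { x≢0         = q≢0
        ; numerator   = λ p pp p∣ → inS (∈-++⁺ˡ (ns-factors p pp p∣))
        ; denominator = λ p pp p∣ → inS (∈-++⁺ʳ ns (∈-++⁺ˡ (ds-factors p pp p∣)))
        } VecAll.∷
      units S (λ p∈ → inS (∈-++⁺ʳ ns (∈-++⁺ʳ ds p∈)))

  -- `lastTrue` yields a place where `2 ^ (30 * k + 3) ≤ s` ceases to hold; monotonicity puts it at
  -- `f₀` or beyond. The lower bound makes room for the primes, and the upper bound controls √s and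
  -- log s.
  scale : ∀ s f₀ → 2 ^ (30 * f₀ + 3) ≤ s →
    ∃[ f ] (f₀ ≤ f × 2 ^ (30 * f + 3) ≤ s × s < 2 ^ (30 * suc f + 3))
  scale s f₀ large =
    let f , low , ¬high = lastTrue (λ k → 2 ^ (30 * k + 3) ≤? s)
          (≤-trans (^-monoʳ-≤ 2 (m≤n+m 3 (30 * f₀))) large) s
          (<⇒≱ (<-≤-trans (n<2^n s) (^-monoʳ-≤ 2 (≤-trans (m≤n*m s 30) (m≤m+n (30 * s) 3)))))
    in f , ≮⇒≥ (λ f<f₀ → ¬high (≤-trans (^-monoʳ-≤ 2 (+-monoˡ-≤ 3 (*-monoʳ-≤ 30 f<f₀))) large)) , low , ≰⇒> ¬high

  module _ (f : ℕ) (40≤f : 40 ≤ f) where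

    private
      open ≤-Reasoning
      w = 2 ^ (16 * f)

      0<f : 0 < f
      0<f = ≤-trans (s≤s z≤n) 40≤f

      0<fw : 0 < f * w
      0<fw = *-mono-≤ 0<f (m^n>0 2 (16 * f))

    -- The `+ 3` in the exponent provides `8 Z`. Seven of these hold the primes of A and Q, and the
    -- eighth takes in the primes of `k` and of the coefficients.
    primes-fit : ∀ ω → ω ≤ f → 7 * 2 ^ (30 * f) + 100 * (f * w) + ω ≤ 2 ^ (30 * f + 3)
    primes-fit ω ω≤f = begin
      7 * Z + 100 * (f * w) + ω  ≡⟨ +-assoc (7 * Z) (100 * (f * w)) ω ⟩
      7 * Z + (100 * (f * w) + ω)  ≤⟨ +-monoʳ-≤ (7 * Z) (begin
        100 * (f * w) + ω  ≤⟨ +-monoʳ-≤ (100 * (f * w)) (≤-trans ω≤f (m≤m*n f w {{m^n≢0 2 (16 * f)}})) ⟩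
        100 * (f * w) + f * w  ≡⟨ +-comm (100 * (f * w)) (f * w) ⟩
        101 * (f * w)  ≤⟨ *-mono-≤ (m≤m+n 101 27) (*-monoˡ-≤ w (<⇒≤ (n<2^n f))) ⟩
        2 ^ 7 * (2 ^ f * 2 ^ (16 * f))  ≡⟨ cong (2 ^ 7 *_) (^-distribˡ-+-* 2 f (16 * f)) ⟨
        2 ^ 7 * 2 ^ (f + 16 * f)  ≡⟨ ^-distribˡ-+-* 2 7 (f + 16 * f) ⟨
        2 ^ (7 + (f + 16 * f))  ≤⟨ ^-monoʳ-≤ 2 (+-monoˡ-≤ (f + 16 * f) (≤-trans (m≤m+n 7 33) (≤-trans 40≤f (m≤n*m f 13)))) ⟩
        2 ^ (13 * f + (f + 16 * f))  ≡⟨ cong (2 ^_) (eq f) ⟩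
        2 ^ (30 * f)  ∎) ⟩
      7 * Z + Z  ≡⟨ +-comm (7 * Z) Z ⟩
      8 * Z  ≡⟨ *-comm 8 Z ⟩
      Z * 2 ^ 3  ≡⟨ ^-distribˡ-+-* 2 (30 * f) 3 ⟨
      2 ^ (30 * f + 3)  ∎
      where
      Z = 2 ^ (30 * f)
      eq : ∀ f → 13 * f + (f + 16 * f) ≡ 30 * f
      eq = solve-∀

    -- The exponent `30 * suc f + 3 = 30 f + 33` is odd; raising it by one makes the root a power of
    -- 2.
    sqrtBound : ∀ s → s < 2 ^ (30 * suc f + 3) → s ≤ 2 ^ (15 * f + 17) * 2 ^ (15 * f + 17)
    sqrtBound s s< = begin
      s  ≤⟨ <⇒≤ s< ⟩
      2 ^ (30 * suc f + 3)  ≤⟨ ^-monoʳ-≤ 2 (n≤1+n (30 * suc f + 3)) ⟩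
      2 ^ suc (30 * suc f + 3)  ≡⟨ cong (2 ^_) (eq f) ⟩
      2 ^ ((15 * f + 17) + (15 * f + 17))  ≡⟨ ^-distribˡ-+-* 2 (15 * f + 17) (15 * f + 17) ⟩
      2 ^ (15 * f + 17) * 2 ^ (15 * f + 17)  ∎
      where
      eq : ∀ f → suc (30 * suc f + 3) ≡ (15 * f + 17) + (15 * f + 17)
      eq = solve-∀

    -- The comparison of `√s log s` with `w`: the left exponent is a constant times
    -- `C f 2 ^ (15 f)`, the right one about `4 f 2 ^ (16 f)`. One factor `2 ^ f` absorbs `C` and
    -- all constants, which multiply to `2 ^ 31`, that is `2 · 16 · 16 · 32` times `2 ^ 17`.
    exponent≤ : ∀ C → C + 31 ≤ f →
      4 ^ (C * (16 * 2 ^ (15 * f + 17) * (16 * (3 + (30 * suc f + 3))))) ≤ 2 ^ (4 * (f * w) ∸ 2)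
    exponent≤ C C+31≤f = subst (_≤ 2 ^ (4 * (f * w) ∸ 2)) (sym (^-*-assoc 2 2 E))
      (^-monoʳ-≤ 2 (m+n≤o⇒m≤o∸n (2 * E) (begin
        2 * E + 2  ≤⟨ +-mono-≤ 2E≤fw (≤-trans (s≤s (s≤s z≤n)) (*-monoʳ-≤ 3 0<fw)) ⟩
        f * w + 3 * (f * w)  ≡⟨⟩
        4 * (f * w)  ∎)))
      where
      R = 2 ^ (15 * f + 17)
      E = C * (16 * R * (16 * (3 + (30 * suc f + 3))))
      eq₁ : ∀ f → 3 + (30 * suc f + 3) ≡ 30 * f + 36
      eq₁ = solve-∀
      eq₂ : ∀ f → 32 * f ≡ 30 * f + 2 * f
      eq₂ = solve-∀
      eq₃ : ∀ C P T f → 2 * (C * (16 * (P * T) * (16 * (32 * f)))) ≡ f * (C * (16384 * T) * P)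
      eq₃ = solve-∀
      L≤ : 3 + (30 * suc f + 3) ≤ 32 * f
      L≤ = subst₂ _≤_ (sym (eq₁ f)) (sym (eq₂ f)) (+-monoʳ-≤ (30 * f) (≤-trans (m≤m+n 36 44) (*-monoʳ-≤ 2 40≤f)))
      2E≤fw : 2 * E ≤ f * w
      2E≤fw = begin
        2 * (C * (16 * R * (16 * (3 + (30 * suc f + 3)))))  ≤⟨ *-monoʳ-≤ 2 (*-monoʳ-≤ C (*-monoʳ-≤ (16 * R) (*-monoʳ-≤ 16 L≤))) ⟩
        2 * (C * (16 * R * (16 * (32 * f))))  ≡⟨ cong (λ t → 2 * (C * (16 * t * (16 * (32 * f))))) (^-distribˡ-+-* 2 (15 * f) 17) ⟩
        2 * (C * (16 * (2 ^ (15 * f) * 2 ^ 17) * (16 * (32 * f))))  ≡⟨ eq₃ C (2 ^ (15 * f)) (2 ^ 17) f ⟩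
        f * (C * (16384 * 2 ^ 17) * 2 ^ (15 * f))  ≤⟨ *-monoʳ-≤ f (*-monoˡ-≤ (2 ^ (15 * f)) (begin
          C * (16384 * 2 ^ 17)  ≤⟨ *-monoˡ-≤ (16384 * 2 ^ 17) (<⇒≤ (n<2^n C)) ⟩
          2 ^ C * 2 ^ 31  ≡⟨ ^-distribˡ-+-* 2 C 31 ⟨
          2 ^ (C + 31)  ≤⟨ ^-monoʳ-≤ 2 C+31≤f ⟩
          2 ^ f  ∎)) ⟩
        f * (2 ^ f * 2 ^ (15 * f))  ≡⟨ cong (f *_) (^-distribˡ-+-* 2 f (15 * f)) ⟨
        f * w  ∎

-- Assembly of the set of primes and of the inequality for g.

open LowerBounds using (lowerBound≤)
open Polynomials using (length≤degree)
open SmoothNumbers using (primeSetContaining)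
open Solutions
open import Data.List.Base using (length; _++_)
open import Data.List.Membership.Propositional.Properties using (∈-++⁺ˡ; ∈-++⁺ʳ)
import Data.List.Relation.Unary.All.Properties as Allₚ
open import Data.List.Properties using (length-++)
open import Data.Nat.Base using (_+_; _*_; _^_; s≤s)
open import Data.Nat.Properties using (≤-trans; <⇒≤; m≤m+n; m≤n+m; m^n>0; +-monoˡ-≤; +-mono-≤)
open import Data.Product.Base using (_,_; proj₁; proj₂)
open import Data.Vec.Base using (_∷_)
import Data.Vec.Relation.Unary.All as VecAll
open import Relation.Binary.PropositionalEquality using (subst; sym)
open import Data.Nat.Base using (ℕ; _≤_; _<_; NonTrivial)
open import Data.Product.Base using (∃-syntax; _×_)
open import Data.Rational.Base using (ℚ; 0ℚ)
open import Data.Vec.Base using (Vec)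
open import Data.Vec.Relation.Unary.All using (All)
open import Relation.Binary.PropositionalEquality using (_≡_; _≢_)

theorem2 : ∀ (n : ℕ) → 2 ≤ n →
    ∀ (ε : ℝ) → 0ᴿ <ᴿ ε →
    ∀ (a : Vec ℚ n) → All (_≢ 0ℚ) a →
    ∃[ s₁ ] (0 < s₁ × (∀ (s : ℕ) .{{_ : NonTrivial s}} → s₁ ≤ s →
    ∃[ S ] (cardinality S ≡ s ×
    (∀ g → Is-g a S g → lowerBound ε s ≤ᴿ fromℕᴿ g))))
-- The threshold `s₁` is computed from a bound for `|4 - ε|` and from the number of prime factors of
-- the coefficients, which is its effectivity.
theorem2 _ (s≤s _) ε _ (a₁ ∷ as) a≢0 = 2 ^ (30 * f₀ + 3) , m^n>0 2 (30 * f₀ + 3) , primeSet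
  where
  coefficients = coefficientPrimes (a₁ ∷ as) a≢0
  psa = proj₁ coefficients
  C = proj₁ (lowerBound≤ ε)
  -- One summand for each demand on `f`: `C + 31 ≤ f` so that `2 ^ f` absorbs the constants of the
  -- lower bound, `length psa ≤ f` so that the primes of the coefficients fit, and `40 ≤ f` for the
  -- numerical estimates.
  f₀ = C + length psa + 40

  primeSet : ∀ s .{{_ : NonTrivial s}} → 2 ^ (30 * f₀ + 3) ≤ s →
    ∃[ S ] (cardinality S ≡ s × (∀ g → Is-g (a₁ ∷ as) S g → lowerBound ε s ≤ᴿ fromℕᴿ g))
  primeSet s s₁≤s = S , ∣S∣≡s , λ g (attained , _) →
    proj₂ (lowerBound≤ ε) s (30 * (1 + f) + 3) (2 ^ (15 * f + 17)) (<⇒≤ high) (sqrtBound f 40≤f s high) g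
      (≤-trans (exponent≤ f 40≤f C C+31≤f) (≤-trans (solutions-count S inS)
        (length≤degree a₁ as S (solutions S inS) (solutions-unique S inS) (solutions-split S inS)
          (VecAll.head units) (VecAll.tail units) g attained)))
    where
    scaled = scale s f₀ s₁≤s
    f = proj₁ scaled
    f₀≤f : f₀ ≤ f
    f₀≤f = proj₁ (proj₂ scaled)
    low = proj₁ (proj₂ (proj₂ scaled))
    high = proj₂ (proj₂ (proj₂ scaled))
    40≤f : 40 ≤ f
    40≤f = ≤-trans (m≤n+m 40 (C + length psa)) f₀≤f
    C+31≤f : C + 31 ≤ f
    C+31≤f = ≤-trans (+-mono-≤ (m≤m+n C (length psa)) (m≤m+n 31 9)) f₀≤f
    ω≤f : length psa ≤ f
    ω≤f = ≤-trans (≤-trans (m≤n+m (length psa) C) (m≤m+n (C + length psa) 40)) f₀≤f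
    open Construction f (≤-trans (m≤m+n 9 31) 40≤f)
    fits : length (solutionPrimes ++ psa) ≤ s
    fits = ≤-trans (subst (_≤ 7 * 2 ^ (30 * f) + 100 * (f * w) + length psa) (sym (length-++ solutionPrimes))
      (+-monoˡ-≤ (length psa) solutionPrimes-length)) (≤-trans (primes-fit f 40≤f (length psa) ω≤f) low)
    containing = primeSetContaining (solutionPrimes ++ psa) (Allₚ.++⁺ solutionPrimes-prime (proj₁ (proj₂ coefficients))) s fits
    S = proj₁ containing
    ∣S∣≡s = proj₁ (proj₂ containing)
    ps⊆S = proj₂ (proj₂ containing)
    inS = λ {p} p∈ → ps⊆S {p} (∈-++⁺ˡ p∈)
    units = proj₂ (proj₂ coefficients) S (λ p∈ → ps⊆S (∈-++⁺ʳ solutionPrimes p∈))
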